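{- For every $n\ge1$ and every permutation $\pi\in\mathfrak S_n$, $$\Phi_{\mathrm{FZ}}^{ -1}\circ\xi\circ\Phi_{\mathrm{FZ}}(\pi)=\theta(\pi),$$ $$\Phi_{\mathrm{YZL}}(\pi)=\Phi_{\mathrm{FZ}}\circ\theta(\pi^{\mathrm{rci}})=\Phi_{\mathrm{FZ}}\circ\varkappa(\pi).$$
   Context: $[n]=\{1,\dots,n\}$; $\mathfrak S_n$ is the set of permutations of $[n]$, written $\pi=\pi(1)\cdots\pi(n)$. $\chi$ of a statement is $1$ if it is true and $0$ otherwise. Maps on permutations. $\pi^{\mathrm{rci}}$ is obtained from $\pi$ by taking the inverse, then the complement ($\sigma(i)\mapsto n+1-\sigma(i)$), then the reverse ($\sigma(1)\cdots\sigma(n)\mapsto\sigma(n)\cdots\sigma(1)$); i.e. $\pi^{\mathrm{rci}}(i)=n+1-\pi^{ -1}(n+1-i)$. $\theta(\pi)=\theta_1\cdots\theta_n$ with $\theta_n=n+1-\pi(n)$ and $\theta_i=n+1-\pi(n-i)$ for $1\le i<n$. The Kreweras complement is $\varkappa(\pi)=\pi^{ -1}(2)\,\pi^{ -1}(3)\cdots\pi^{ -1}(n)\,\pi^{ -1}(1)$ in one-line notation. Histories. A 2-Motzkin path of length $n$ is a word $w=w_1\cdots w_n$ over $\{\mathrm N,\mathrm S,\mathrm E,\mathrm{dE}\}$ such that, with $h_i:=\#\{j<i: w_j=\mathrm N\}-\#\{j<i: w_j=\mathrm S\}$ for $1\le i\le n+1$, one has $h_i\ge 0$ for all $i$ and $h_{n+1}=0$.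 An sr-Laguerre history of length $n$ is a triple $W=(w,h,c)$ where $w$ is a 2-Motzkin path of length $n$, $h=h_1\cdots h_n$ is its height sequence, and $c=c_1\cdots c_n$ is a sequence of integers with $0\le c_i\le h_i$ if $w_i\in\{\mathrm N,\mathrm E\}$ and $1\le c_i\le h_i$ if $w_i\in\{\mathrm S,\mathrm{dE}\}$. $\mathfrak L_n$ is the set of all of these; $\mathrm{cs}(W):=\max\{i\in[n]: c_i=0\}$. The map $\xi:\mathfrak L_n\to\mathfrak L_n$ is the unique involution such that for $W=(w,h,c)$ with $\mathrm{cs}(W)=m$ and $\xi(W)=(v,g,b)$: (1) $\mathrm{cs}(\xi(W))=n+1-m$; (2) for $j\ne n+1-m$, $v_j\in\{\mathrm N,\mathrm E\}$ iff $w_{n+1-j}\in\{\mathrm S,\mathrm{dE}\}$; (3) $g_j=h_{n+1-j}+1$ if $j>n+1-m$ and $v_j\in\{\mathrm S,\mathrm{dE}\}$, $g_j=h_{n+1-j}-1$ if $j<n+1-m$ and $v_j\in\{\mathrm N,\mathrm E\}$, and $g_j=h_{n+1-j}$ otherwise; (4) $b_j=g_j-h_{n+1-j}+c_{n+1-j}$ for all $j\in[n]$. The bijection $\Phi_{\mathrm{FZ}}:\mathfrak S_n\to\mathfrak L_n$. Let $\mathrm{Ep}(\pi)=\{i\in[n]:\pi(i)>i\}$; side numbers: if $i\in\mathrm{Ep}(\pi)$, $s_i=\#\{j\in\mathrm{Ep}(\pi): j<i,\ \pi(j)>\pi(i)\}$; if $i\notin\mathrm{Ep}(\pi)$, $s_i=\#\{j\notin\mathrm{Ep}(\pi):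 j>i,\ \pi(j)<\pi(i)\}$. Then $\Phi_{\mathrm{FZ}}(\pi)=(w,h,c)$ where $w_i=\mathrm N$ if $\pi^{ -1}(i)>i<\pi(i)$; $w_i=\mathrm S$ if $\pi^{ -1}(i)<i>\pi(i)$; $w_i=\mathrm E$ if $\pi^{ -1}(i)\ge i\ge\pi(i)$; $w_i=\mathrm{dE}$ if $\pi^{ -1}(i)<i<\pi(i)$; $h$ is the height sequence of $w$; and $c_i=s_{\pi^{ -1}(i)}+\chi(w_i\in\{\mathrm S,\mathrm{dE}\})$. The bijection $\Phi_{\mathrm{YZL}}:\mathfrak S_n\to\mathfrak L_n$. Let $\mathrm{pone}(\pi)=\pi^{ -1}(1)$. Define $\Phi_{\mathrm{YZL}}(\pi)=(w,h,c)$ as follows. For $i\in[n-1]$ with $i\ne\mathrm{pone}(\pi)$: $w_i=\mathrm N$ if $i<\pi(i)$ and $i+1\le\pi^{ -1}(i+1)$; $w_i=\mathrm S$ if $i\ge\pi(i)$ and $i+1>\pi^{ -1}(i+1)$; $w_i=\mathrm E$ if $i<\pi(i)$ and $i+1>\pi^{ -1}(i+1)$; $w_i=\mathrm{dE}$ if $i\ge\pi(i)$ and $i+1\le\pi^{ -1}(i+1)$. If $i=\mathrm{pone}(\pi)\le n-1$: $w_i=\mathrm N$ if $i+1\le\pi^{ -1}(i+1)$ and $w_i=\mathrm E$ if $i+1>\pi^{ -1}(i+1)$. Finally $w_n=\mathrm S$ if $\mathrm{pone}(\pi)\ne n$ and $w_n=\mathrm E$ if $\mathrm{pone}(\pi)=n$.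 The sequence $h$ is the height sequence of $w$, and $c_i=\mathrm{vnest}_i(\pi)+\chi(w_i\in\{\mathrm S,\mathrm{dE}\})$ for $i\in[n]$, where $\mathrm{nest}_i(\pi)=\#\{j: j<i<\pi(i)<\pi(j)\text{ or }\pi(j)<\pi(i)\le i<j\}$ and $\mathrm{vnest}_i(\pi)=\mathrm{nest}_i(\pi)-1$ if $\pi(i)\le i$ and $i<\mathrm{pone}(\pi)$; $\mathrm{vnest}_i(\pi)=\mathrm{nest}_i(\pi)+1$ if $\pi(i)>i$ and $i>\mathrm{pone}(\pi)$; $\mathrm{vnest}_i(\pi)=\mathrm{nest}_i(\pi)$ otherwise. -}

module Defs where

open import Data.Bool.Base using (if_then_else_)
open import Data.Fin.Base as Fin using (Fin; zero; suc; toℕ; fromℕ; inject₁; opposite)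
open import Data.Fin.Induction using (<-weakInduction; <-wellFounded)
open import Data.Fin.Permutation as Perm using (Permutation′; _⟨$⟩ʳ_; _⟨$⟩ˡ_; _∘ₚ_)
import Data.Fin.Properties as Fin
open import Data.Fin.Relation.Unary.Top using (view; ‵fromℕ; ‵inject₁)
open import Data.Integer.Base as ℤ using (ℤ; +_; 0ℤ; 1ℤ; -1ℤ)
import Data.Integer.Properties as ℤ
import Data.Integer.Tactic.RingSolver as ℤ-Solver
open import Data.Nat.Base as ℕ using (ℕ; zero; suc)
import Data.Nat.Properties as ℕ
import Data.Nat.Tactic.RingSolver as ℕ-Solver
open import Algebra.Properties.CommutativeMonoid.Sum ℕ.+-0-commutativeMonoid
  using (sum; sum-cong-≗; ∑-distrib-+; ∑-comm; sum-permute)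
open import Data.Product.Base using (∃; _×_; _,_; proj₁; proj₂)
open import Data.Sum.Base using (_⊎_; inj₁; inj₂; [_,_]′)
open import Function.Base using (_∘_)
open import Function.Bundles using (_⇔_; mk⇔; Equivalence)
open import Function.Definitions using (Injective; Bijective)
open import Induction.WellFounded using (Acc; acc)
open import Relation.Binary.Definitions using (tri<; tri≈; tri>)
open import Relation.Binary.PropositionalEquality
  using (_≡_; _≢_; refl; sym; trans; cong; cong₂; subst; subst₂; module ≡-Reasoning)
open import Relation.Nullary using (¬_; Dec; yes; no; does; contradiction)
open import Relation.Nullary.Decidable using (_×-dec_; _⊎-dec_; ¬?)
open import Relation.Unary using (Decidable)

private variable
  n m : ℕ

-- Throughout, [n] is Fin n, so positions and values are shifted down by one:
-- order comparisons are unaffected, and opposite i stands for n + 1 - i.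

χ : {P : Set} → Dec P → ℕ
χ P? = if does P? then 1 else 0

# : {P : Fin n → Set} → Decidable P → ℕ
# P? = sum (λ i → χ (P? i))

complement reversal rci : Permutation′ n → Permutation′ n
complement π = π ∘ₚ Perm.reverse
reversal   π = Perm.reverse ∘ₚ π
rci        π = reversal (complement (Perm.flip π))

-- In one-based terms, i ↦ n - i for i < n, and n ↦ n.
reverseInit : Permutation′ (suc m)
reverseInit = Perm.insert (fromℕ _) (fromℕ _) Perm.reverse

-- In one-based terms, i ↦ i + 1 for i < n, and n ↦ 1.
cycle : Permutation′ (suc m)
cycle = Perm.insert (fromℕ _) zero Perm.id

-- In π ∘ₚ ρ, the permutation π is applied first.
θ : Permutation′ (suc m) → Permutation′ (suc m)
θ π = complement (reverseInit ∘ₚ π)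

ϰ : Permutation′ (suc m) → Permutation′ (suc m)
ϰ π = cycle ∘ₚ Perm.flip π

data Step : Set where
  N S E dE : Step

infix 4 _≟_

_≟_ : (a b : Step) → Dec (a ≡ b)
N  ≟ N  = yes refl
N  ≟ S  = no λ ()
N  ≟ E  = no λ ()
N  ≟ dE = no λ ()
S  ≟ N  = no λ ()
S  ≟ S  = yes refl
S  ≟ E  = no λ ()
S  ≟ dE = no λ ()
E  ≟ N  = no λ ()
E  ≟ S  = no λ ()
E  ≟ E  = yes refl
E  ≟ dE = no λ ()
dE ≟ N  = no λ ()
dE ≟ S  = no λ ()
dE ≟ E  = no λ ()
dE ≟ dE = yes refl

NE SdE : Step → Set
NE  a = a ≡ N ⊎ a ≡ E
SdE a = a ≡ S ⊎ a ≡ dE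

NE? : Decidable NE
NE? a = (a ≟ N) ⊎-dec (a ≟ E)

SdE? : Decidable SdE
SdE? a = (a ≟ S) ⊎-dec (a ≟ dE)

before : Step → (Fin n → Step) → ℕ → ℕ
before a w k = # (λ j → (toℕ j ℕ.<? k) ×-dec (w j ≟ a))

-- height w k is the height after k steps, i.e. h_{k+1}.
height : (Fin n → Step) → ℕ → ℤ
height w k = + before N w k ℤ.- + before S w k

record Is2Motzkin {n} (w : Fin n → Step) : Set where
  field
    nonneg : ∀ k → k ℕ.≤ n → 0ℤ ℤ.≤ height w k
    closed : height w n ≡ 0ℤ

record Triple (n : ℕ) : Set where
  field
    w : Fin n → Step
    h : Fin n → ℤ
    c : Fin n → ℤ

heights : (Fin n → Step) → Fin n → ℤ
heights w i = height w (toℕ i)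

infix 4 _≋_

record _≋_ (W V : Triple n) : Set where
  private
    module W = Triple W
    module V = Triple V
  field
    w≗ : ∀ i → W.w i ≡ V.w i
    h≗ : ∀ i → W.h i ≡ V.h i
    c≗ : ∀ i → W.c i ≡ V.c i

record IsSrLaguerre (W : Triple n) : Set where
  open Triple W
  field
    motzkin : Is2Motzkin w
    h-def   : ∀ i → h i ≡ heights w i
    c-NE    : ∀ i → NE  (w i) → 0ℤ ℤ.≤ c i × c i ℤ.≤ h i
    c-SdE   : ∀ i → SdE (w i) → 1ℤ ℤ.≤ c i × c i ℤ.≤ h i

record 𝔏 (n : ℕ) : Set where
  constructor _,_
  field
    triple       : Triple n
    isSrLaguerre : IsSrLaguerre triple
  open Triple triple public
  open IsSrLaguerre isSrLaguerre public

open 𝔏 using (triple)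

infix 4 _≈_

_≈_ : 𝔏 n → 𝔏 n → Set
W ≈ V = triple W ≋ triple V

module _ (π : Permutation′ n) where

  -- The final clause is the remaining case π⁻¹(i) < i < π(i).
  wFZ : Fin n → Step
  wFZ i =
    if does ((i Fin.<? π ⟨$⟩ˡ i) ×-dec (i Fin.<? π ⟨$⟩ʳ i)) then N else
    if does ((π ⟨$⟩ˡ i Fin.<? i) ×-dec (π ⟨$⟩ʳ i Fin.<? i)) then S else
    if does ((i Fin.≤? π ⟨$⟩ˡ i) ×-dec (π ⟨$⟩ʳ i Fin.≤? i)) then E else
    dE

  Ep : Fin n → Set
  Ep i = i Fin.< π ⟨$⟩ʳ i

  Ep? : Decidable Ep
  Ep? i = i Fin.<? π ⟨$⟩ʳ i

  sideNumber : Fin n → ℕ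
  sideNumber i = if does (Ep? i)
    then # (λ j → Ep? j ×-dec (j Fin.<? i) ×-dec (π ⟨$⟩ʳ i Fin.<? π ⟨$⟩ʳ j))
    else # (λ j → ¬? (Ep? j) ×-dec (i Fin.<? j) ×-dec (π ⟨$⟩ʳ j Fin.<? π ⟨$⟩ʳ i))

  tripleFZ : Triple n
  tripleFZ = record
    { w = wFZ
    ; h = heights wFZ
    ; c = λ i → + (sideNumber (π ⟨$⟩ˡ i) ℕ.+ χ (SdE? (wFZ i)))
    }

module _ (π : Permutation′ (suc m)) where

  pone : Fin (suc m)
  pone = π ⟨$⟩ˡ zero

  -- For i = inject₁ j, the element i + 1 is suc j.
  wYZL : Fin (suc m) → Step
  wYZL i with view i
  ... | ‵fromℕ = if does (pone Fin.≟ fromℕ m) then E else S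
  ... | ‵inject₁ j with i Fin.≟ pone | i Fin.<? π ⟨$⟩ʳ i | suc j Fin.≤? π ⟨$⟩ˡ suc j
  ...   | yes _ | _     | yes _ = N
  ...   | yes _ | _     | no  _ = E
  ...   | no  _ | yes _ | yes _ = N
  ...   | no  _ | no  _ | no  _ = S
  ...   | no  _ | yes _ | no  _ = E
  ...   | no  _ | no  _ | yes _ = dE

  nest : Fin (suc m) → ℕ
  nest i = # λ j →
    ((j Fin.<? i) ×-dec (i Fin.<? π ⟨$⟩ʳ i) ×-dec (π ⟨$⟩ʳ i Fin.<? π ⟨$⟩ʳ j))
    ⊎-dec
    ((π ⟨$⟩ʳ j Fin.<? π ⟨$⟩ʳ i) ×-dec (π ⟨$⟩ʳ i Fin.≤? i) ×-dec (i Fin.<? j))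

  vnest : Fin (suc m) → ℤ
  vnest i =
    if does ((π ⟨$⟩ʳ i Fin.≤? i) ×-dec (i Fin.<? pone)) then + nest i ℤ.- 1ℤ else
    if does ((i Fin.<? π ⟨$⟩ʳ i) ×-dec (pone Fin.<? i)) then + nest i ℤ.+ 1ℤ else
    + nest i

  Φ-YZL : Triple (suc m)
  Φ-YZL = record
    { w = wYZL
    ; h = heights wYZL
    ; c = λ i → vnest i ℤ.+ + χ (SdE? (wYZL i))
    }

χ-yes : {P : Set} (P? : Dec P) → P → χ P? ≡ 1
χ-yes (yes _) _ = refl
χ-yes (no ¬p) p = contradiction p ¬p

χ-no : {P : Set} (P? : Dec P) → ¬ P → χ P? ≡ 0
χ-no (yes p) ¬p = contradiction p ¬p
χ-no (no _)  _  = refl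

χ-mono : {P Q : Set} (P? : Dec P) (Q? : Dec Q) → (P → Q) → χ P? ℕ.≤ χ Q?
χ-mono (no _)  _       _ = ℕ.z≤n
χ-mono (yes p) (yes _) _ = ℕ.≤-refl
χ-mono (yes p) (no ¬q) f = contradiction (f p) ¬q

χ-cong : {P Q : Set} (P? : Dec P) (Q? : Dec Q) → (P → Q) → (Q → P) → χ P? ≡ χ Q?
χ-cong P? Q? f g = ℕ.≤-antisym (χ-mono P? Q? f) (χ-mono Q? P? g)

χ-split : {P Q R : Set} (P? : Dec P) (Q? : Dec Q) (R? : Dec R) →
          (P → Q ⊎ R) → (Q → P × ¬ R) → (R → P) → χ P? ≡ χ Q? ℕ.+ χ R?
χ-split (yes p) (yes q) (yes r) f g h = contradiction r (proj₂ (g q))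
χ-split (yes p) (yes q) (no _)  f g h = refl
χ-split (yes p) (no _)  (yes r) f g h = refl
χ-split (yes p) (no ¬q) (no ¬r) f g h with f p
... | inj₁ q = contradiction q ¬q
... | inj₂ r = contradiction r ¬r
χ-split (no ¬p) (yes q) _       f g h = contradiction (proj₁ (g q)) ¬p
χ-split (no ¬p) (no _)  (yes r) f g h = contradiction (h r) ¬p
χ-split (no ¬p) (no _)  (no _)  f g h = refl

sum-mono : (f g : Fin n → ℕ) → (∀ i → f i ℕ.≤ g i) → sum f ℕ.≤ sum g
sum-mono {zero}  f g p = ℕ.≤-refl
sum-mono {suc n} f g p = ℕ.+-mono-≤ (p zero) (sum-mono (f ∘ suc) (g ∘ suc) (p ∘ suc))

term≤sum : (f : Fin n → ℕ) (i : Fin n) → f i ℕ.≤ sum f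
term≤sum f zero    = ℕ.m≤m+n _ _
term≤sum f (suc i) = ℕ.≤-trans (term≤sum (f ∘ suc) i) (ℕ.m≤n+m _ _)

sum-zero : (f : Fin n → ℕ) → (∀ i → f i ≡ 0) → sum f ≡ 0
sum-zero {zero}  f p = refl
sum-zero {suc n} f p = cong₂ ℕ._+_ (p zero) (sum-zero (f ∘ suc) (p ∘ suc))

module _ {P Q : Fin n → Set} (P? : Decidable P) (Q? : Decidable Q) where

  #-mono : (∀ i → P i → Q i) → # P? ℕ.≤ # Q?
  #-mono f = sum-mono _ _ (λ i → χ-mono (P? i) (Q? i) (f i))

  #-cong : (∀ i → P i → Q i) → (∀ i → Q i → P i) → # P? ≡ # Q?
  #-cong f g = sum-cong-≗ (λ i → χ-cong (P? i) (Q? i) (f i) (g i))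

  #-split : {R : Fin n → Set} (R? : Decidable R) →
            (∀ i → P i → Q i ⊎ R i) → (∀ i → Q i → P i × ¬ R i) → (∀ i → R i → P i) →
            # P? ≡ # Q? ℕ.+ # R?
  #-split R? f g h = trans
    (sum-cong-≗ (λ i → χ-split (P? i) (Q? i) (R? i) (f i) (g i) (h i)))
    (∑-distrib-+ (λ i → χ (Q? i)) (λ i → χ (R? i)))

#-none : {P : Fin n → Set} (P? : Decidable P) → (∀ i → ¬ P i) → # P? ≡ 0
#-none P? f = sum-zero _ (λ i → χ-no (P? i) (f i))

#-some : {P : Fin n → Set} (P? : Decidable P) → ∀ i → P i → 1 ℕ.≤ # P?
#-some P? i p = ℕ.≤-trans (ℕ.≤-reflexive (sym (χ-yes (P? i) p))) (term≤sum (λ i → χ (P? i)) i)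

#-strict : {P Q : Fin n → Set} (P? : Decidable P) (Q? : Decidable Q) →
           (∀ i → P i → Q i) → ∀ x → Q x → ¬ P x → # P? ℕ.< # Q?
#-strict P? Q? f x q ¬p = begin-strict
  # P?                                        ≡⟨ ℕ.+-identityʳ _ ⟨
  # P? ℕ.+ 0                                  <⟨ ℕ.+-monoʳ-< (# P?) (#-some R? x (q , ¬p)) ⟩
  # P? ℕ.+ # R?                               ≡⟨ #-split Q? P? R? split (λ i p → f i p , λ r → proj₂ r p) (λ _ → proj₁) ⟨
  # Q?                                        ∎
  where
  open ℕ.≤-Reasoning
  R? = λ i → Q? i ×-dec ¬? (P? i)
  split : ∀ i → _
  split i q with P? i
  ... | yes p = inj₁ p
  ... | no ¬p = inj₂ (q , ¬p)

#-perm : {P : Fin n → Set} (P? : Decidable P) (π : Permutation′ n) → # P? ≡ # (λ i → P? (π ⟨$⟩ʳ i))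
#-perm P? π = sum-permute (λ i → χ (P? i)) π

#-single : (i : Fin n) {P : Set} (P? : Dec P) → # (λ j → (j Fin.≟ i) ×-dec P?) ≡ χ P?
#-single {n = suc n} zero P? = trans
  (cong₂ ℕ._+_
    (χ-cong ((zero {n} Fin.≟ zero) ×-dec P?) P? proj₂ (λ p → refl , p))
    (#-none (λ (j : Fin n) → (suc j Fin.≟ zero) ×-dec P?) (λ { _ () })))
  (ℕ.+-identityʳ _)
#-single (suc i) P? = cong₂ ℕ._+_
  (χ-no ((zero Fin.≟ suc i) ×-dec P?) (λ { () }))
  (trans
    (#-cong (λ j → (suc j Fin.≟ suc i) ×-dec P?) (λ j → (j Fin.≟ i) ×-dec P?)
      (λ { j (eq , p) → Fin.suc-injective eq , p }) (λ { j (eq , p) → cong suc eq , p }))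
    (#-single i P?))

#-below-suc : {P : Fin n → Set} (P? : Decidable P) (i : Fin n) →
              # (λ j → (toℕ j ℕ.<? suc (toℕ i)) ×-dec P? j)
              ≡ # (λ j → (toℕ j ℕ.<? toℕ i) ×-dec P? j) ℕ.+ χ (P? i)
#-below-suc {P = P} P? i = trans
  (#-split (λ j → (toℕ j ℕ.<? suc (toℕ i)) ×-dec P? j) below? (λ j → (j Fin.≟ i) ×-dec P? i) f g h)
  (cong (# below? ℕ.+_) (#-single i (P? i)))
  where
  below? = λ j → (toℕ j ℕ.<? toℕ i) ×-dec P? j
  f : ∀ j → toℕ j ℕ.< suc (toℕ i) × P j → (toℕ j ℕ.< toℕ i × P j) ⊎ (j ≡ i × P i)
  f j (j<1+i , p) with ℕ.m≤n⇒m<n∨m≡n (ℕ.s≤s⁻¹ j<1+i)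
  ... | inj₁ j<i = inj₁ (j<i , p)
  ... | inj₂ j≡i with refl ← Fin.toℕ-injective j≡i = inj₂ (refl , p)
  g : ∀ j → toℕ j ℕ.< toℕ i × P j → (toℕ j ℕ.< suc (toℕ i) × P j) × ¬ (j ≡ i × P i)
  g j (j<i , p) = (ℕ.m<n⇒m<1+n j<i , p) , λ { (refl , _) → ℕ.<-irrefl refl j<i }
  h : ∀ j → j ≡ i × P i → toℕ j ℕ.< suc (toℕ i) × P j
  h j (refl , p) = ℕ.n<1+n _ , p

#-image : {X Y : Fin n → Set} (X? : Decidable X) (Y? : Decidable Y) (f : Fin n → Fin n) →
          (∀ j → X j → ∃ λ v → j ≡ f v × Y v) → # X? ℕ.≤ # Y?
#-image X? Y? f g = begin
  # X?                                                      ≤⟨ sum-mono _ _ le ⟩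
  sum (λ j → sum (λ v → χ ((j Fin.≟ f v) ×-dec Y? v)))      ≡⟨ ∑-comm (λ j v → χ ((j Fin.≟ f v) ×-dec Y? v)) ⟩
  sum (λ v → sum (λ j → χ ((j Fin.≟ f v) ×-dec Y? v)))      ≡⟨ sum-cong-≗ (λ v → #-single (f v) (Y? v)) ⟩
  # Y?                                                      ∎
  where
  open ℕ.≤-Reasoning
  le : ∀ j → χ (X? j) ℕ.≤ sum (λ v → χ ((j Fin.≟ f v) ×-dec Y? v))
  le j with X? j
  ... | no _  = ℕ.z≤n
  ... | yes x = let v , q = g j x in #-some (λ v → (j Fin.≟ f v) ×-dec Y? v) v q

rise : Step → ℤ
rise N  = 1ℤ
rise S  = -1ℤ
rise E  = 0ℤ
rise dE = 0ℤ

before-zero : ∀ a (w : Fin n → Step) → before a w 0 ≡ 0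
before-zero a w = #-none (λ j → (toℕ j ℕ.<? 0) ×-dec (w j ≟ a)) (λ _ ())

height-zero : (w : Fin n → Step) → height w 0 ≡ 0ℤ
height-zero w = cong₂ (λ a b → + a ℤ.- + b) (before-zero N w) (before-zero S w)

height-suc : (w : Fin n → Step) (i : Fin n) →
             height w (suc (toℕ i)) ≡ height w (toℕ i) ℤ.+ rise (w i)
height-suc w i = begin
  height w (suc (toℕ i))
    ≡⟨ cong₂ (λ a b → + a ℤ.- + b) (#-below-suc (λ j → w j ≟ N) i) (#-below-suc (λ j → w j ≟ S) i) ⟩
  (+ a ℤ.+ + χ (w i ≟ N)) ℤ.- (+ b ℤ.+ + χ (w i ≟ S))
    ≡⟨ lemma (+ a) (+ χ (w i ≟ N)) (+ b) (+ χ (w i ≟ S)) ⟩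
  (+ a ℤ.- + b) ℤ.+ (+ χ (w i ≟ N) ℤ.- + χ (w i ≟ S))
    ≡⟨ cong (λ x → (+ a ℤ.- + b) ℤ.+ x) (χ-rise (w i)) ⟩
  height w (toℕ i) ℤ.+ rise (w i) ∎
  where
  open ≡-Reasoning
  a = before N w (toℕ i)
  b = before S w (toℕ i)
  lemma : ∀ a x b y → (a ℤ.+ x) ℤ.- (b ℤ.+ y) ≡ (a ℤ.- b) ℤ.+ (x ℤ.- y)
  lemma = ℤ-Solver.solve-∀
  χ-rise : ∀ s → + χ (s ≟ N) ℤ.- + χ (s ≟ S) ≡ rise s
  χ-rise N  = refl
  χ-rise S  = refl
  χ-rise E  = refl
  χ-rise dE = refl

height-cong : {w v : Fin n → Step} → (∀ i → w i ≡ v i) → ∀ k → height w k ≡ height v k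
height-cong {w = w} {v} eq k = cong₂ (λ a b → + a ℤ.- + b) (before-cong N) (before-cong S)
  where
  before-cong : ∀ a → before a w k ≡ before a v k
  before-cong a = #-cong (λ j → (toℕ j ℕ.<? k) ×-dec (w j ≟ a)) (λ j → (toℕ j ℕ.<? k) ×-dec (v j ≟ a))
    (λ i → λ { (lt , refl) → lt , sym (eq i) })
    (λ i → λ { (lt , refl) → lt , eq i })

difference : ∀ a b h → a ≡ b ℕ.+ h → + a ℤ.- + b ≡ + h
difference _ b h refl = lemma (+ b) (+ h)
  where
  lemma : ∀ b h → (b ℤ.+ h) ℤ.- b ≡ h
  lemma = ℤ-Solver.solve-∀

difference⁻¹ : ∀ a b h → + a ℤ.- + b ≡ + h → a ≡ b ℕ.+ h
difference⁻¹ a b h eq = ℤ.+-injective (trans (lemma (+ a) (+ b)) (cong (λ x → + b ℤ.+ x) eq))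
  where
  lemma : ∀ a b → a ≡ b ℤ.+ (a ℤ.- b)
  lemma = ℤ-Solver.solve-∀

≤-elim : ∀ {i j} → + i ℤ.≤ j → ∃ λ k → j ≡ + k × i ℕ.≤ k
≤-elim (ℤ.+≤+ p) = _ , refl , p

if-elim : {A P : Set} {x y : A} (R : A → Set) (P? : Dec P) →
          (P → R x) → (¬ P → R y) → R (if does P? then x else y)
if-elim R (yes p) f g = f p
if-elim R (no ¬p) f g = g ¬p

data StepFZ {n} (π : Permutation′ n) (i : Fin n) : Step → Set where
  isN  : i Fin.< π ⟨$⟩ʳ i → ¬ π ⟨$⟩ˡ i Fin.< i → StepFZ π i N
  isS  : ¬ i Fin.< π ⟨$⟩ʳ i → π ⟨$⟩ˡ i Fin.< i → StepFZ π i S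
  isE  : ¬ i Fin.< π ⟨$⟩ʳ i → ¬ π ⟨$⟩ˡ i Fin.< i → StepFZ π i E
  isdE : i Fin.< π ⟨$⟩ʳ i → π ⟨$⟩ˡ i Fin.< i → StepFZ π i dE

module _ (π : Permutation′ n) where

  private
    p q : Fin n → Fin n
    p = π ⟨$⟩ʳ_
    q = π ⟨$⟩ˡ_

    pq : ∀ {i} → p (q i) ≡ i
    pq = Perm.inverseʳ π

    qp : ∀ {i} → q (p i) ≡ i
    qp = Perm.inverseˡ π

    <p⇒≢q : ∀ {i} → i Fin.< p i → q i ≢ i
    <p⇒≢q {i} lt eq = Fin.<⇒≢ lt (trans (sym pq) (cong p eq))

    q<⇒≢p : ∀ {i} → q i Fin.< i → p i ≢ i
    q<⇒≢p {i} lt eq = Fin.<⇒≢ lt (trans (cong q (sym eq)) qp)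

    flip-< : ∀ {i j : Fin n} → ¬ i Fin.< j → j ≢ i → j Fin.< i
    flip-< ¬lt ne = Fin.≤∧≢⇒< (ℕ.≮⇒≥ ¬lt) ne

  stepFZ : ∀ i → StepFZ π i (wFZ π i)
  stepFZ i =
    if-elim (StepFZ π i) ((i Fin.<? q i) ×-dec (i Fin.<? p i))
      (λ (a , b) → isN b (Fin.<-asym a)) λ ¬N →
    if-elim (StepFZ π i) ((q i Fin.<? i) ×-dec (p i Fin.<? i))
      (λ (a , b) → isS (Fin.<-asym b) a) λ ¬S →
    if-elim (StepFZ π i) ((i Fin.≤? q i) ×-dec (p i Fin.≤? i))
      (λ (a , b) → isE (ℕ.≤⇒≯ b) (ℕ.≤⇒≯ a)) λ ¬E →
    remaining ¬N ¬S ¬E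
    where
    remaining : ¬ (i Fin.< q i × i Fin.< p i) → ¬ (q i Fin.< i × p i Fin.< i) →
                ¬ (i Fin.≤ q i × p i Fin.≤ i) → StepFZ π i dE
    remaining ¬N ¬S ¬E with i Fin.<? p i | q i Fin.<? i
    ... | yes a | yes b = isdE a b
    ... | yes a | no ¬b = contradiction (flip-< ¬b (<p⇒≢q a ∘ sym) , a) ¬N
    ... | no ¬a | yes b = contradiction (b , flip-< ¬a (q<⇒≢p b)) ¬S
    ... | no ¬a | no ¬b = contradiction (ℕ.≮⇒≥ ¬b , ℕ.≮⇒≥ ¬a) ¬E

  stepFZ-unique : ∀ {i a b} → StepFZ π i a → StepFZ π i b → a ≡ b
  stepFZ-unique (isN _ _)  (isN _ _)   = refl
  stepFZ-unique (isN x y)  (isS x′ y′)  = contradiction x x′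
  stepFZ-unique (isN x y)  (isE x′ y′)  = contradiction x x′
  stepFZ-unique (isN x y)  (isdE x′ y′) = contradiction y′ y
  stepFZ-unique (isS x y)  (isN x′ y′)  = contradiction x′ x
  stepFZ-unique (isS x y)  (isS x′ y′)  = refl
  stepFZ-unique (isS x y)  (isE x′ y′)  = contradiction y y′
  stepFZ-unique (isS x y)  (isdE x′ y′) = contradiction x′ x
  stepFZ-unique (isE x y)  (isN x′ y′)  = contradiction x′ x
  stepFZ-unique (isE x y)  (isS x′ y′)  = contradiction y′ y
  stepFZ-unique (isE x y)  (isE x′ y′)  = refl
  stepFZ-unique (isE x y)  (isdE x′ y′) = contradiction x′ x
  stepFZ-unique (isdE x y) (isN x′ y′)  = contradiction y y′
  stepFZ-unique (isdE x y) (isS x′ y′)  = contradiction x x′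
  stepFZ-unique (isdE x y) (isE x′ y′)  = contradiction x x′
  stepFZ-unique (isdE x y) (isdE x′ y′) = refl

  NE⇒¬q< : ∀ {i} → NE (wFZ π i) → ¬ q i Fin.< i
  NE⇒¬q< {i} ne with wFZ π i | stepFZ i
  NE⇒¬q< (inj₁ refl) | _ | isN _ b = b
  NE⇒¬q< (inj₂ refl) | _ | isE _ b = b

  SdE⇒q< : ∀ {i} → SdE (wFZ π i) → q i Fin.< i
  SdE⇒q< {i} sd with wFZ π i | stepFZ i
  SdE⇒q< (inj₁ refl) | _ | isS _ b  = b
  SdE⇒q< (inj₂ refl) | _ | isdE _ b = b

  -- The height after k steps counts the j ≤ k < π(j) in one-based terms.
  arcs : ℕ → ℕ
  arcs k = # (λ j → (toℕ j ℕ.<? k) ×-dec (k ℕ.≤? toℕ (p j)))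

  before-FZ : ∀ k → before N (wFZ π) k ≡ before S (wFZ π) k ℕ.+ arcs k
  before-FZ k = ℕ.+-cancelʳ-≡ (# B) (# n?) (# s? ℕ.+ arcs k) (begin
    # n? ℕ.+ # B               ≡⟨ cong (# n? ℕ.+_) (#-split B s? d? splitB (λ j → λ { (a , b) → (a , SdE⇒q< (inj₁ b)) , λ { (_ , b′) → S≢dE (trans (sym b) b′) } }) (λ j → λ { (a , b) → a , SdE⇒q< (inj₂ b) })) ⟩
    # n? ℕ.+ (# s? ℕ.+ # d?)   ≡⟨ lemma (# n?) (# s?) (# d?) ⟩
    # s? ℕ.+ (# n? ℕ.+ # d?)   ≡⟨ cong (# s? ℕ.+_) (#-split A n? d? splitA nA dA) ⟨
    # s? ℕ.+ # A               ≡⟨ cong (# s? ℕ.+_) (#-split A arcs? B′ splitA′ (λ j → λ { (a , b) → (a , ℕ.<-≤-trans a b) , λ { (b′ , _) → ℕ.<⇒≱ b′ b } }) (λ j → λ { (a , b) → ℕ.<-trans b a , b })) ⟩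
    # s? ℕ.+ (arcs k ℕ.+ # B′) ≡⟨ cong (λ x → # s? ℕ.+ (arcs k ℕ.+ x)) B′≡B ⟩
    # s? ℕ.+ (arcs k ℕ.+ # B)  ≡⟨ ℕ.+-assoc (# s?) (arcs k) (# B) ⟨
    # s? ℕ.+ arcs k ℕ.+ # B    ∎)
    where
    open ≡-Reasoning
    n? = λ j → (toℕ j ℕ.<? k) ×-dec (wFZ π j ≟ N)
    s? = λ j → (toℕ j ℕ.<? k) ×-dec (wFZ π j ≟ S)
    d? = λ j → (toℕ j ℕ.<? k) ×-dec (wFZ π j ≟ dE)
    A  = λ j → (toℕ j ℕ.<? k) ×-dec (j Fin.<? p j)
    B  = λ j → (toℕ j ℕ.<? k) ×-dec (q j Fin.<? j)
    B′ = λ j → (toℕ (p j) ℕ.<? k) ×-dec (j Fin.<? p j)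
    arcs? = λ j → (toℕ j ℕ.<? k) ×-dec (k ℕ.≤? toℕ (p j))
    lemma : ∀ a b c → a ℕ.+ (b ℕ.+ c) ≡ b ℕ.+ (a ℕ.+ c)
    lemma = ℕ-Solver.solve-∀
    S≢dE : S ≢ dE
    S≢dE ()
    B′≡B : # B′ ≡ # B
    B′≡B = trans (#-cong B′ (λ j → (toℕ (p j) ℕ.<? k) ×-dec (q (p j) Fin.<? p j))
        (λ j → λ { (a , b) → a , subst (Fin._< p j) (sym qp) b })
        (λ j → λ { (a , b) → a , subst (Fin._< p j) qp b }))
      (sym (#-perm B π))
    splitB : ∀ j → _
    splitB j (a , b) with wFZ π j | stepFZ j
    ... | _ | isN _ ¬b = contradiction b ¬b
    ... | _ | isS _ _  = inj₁ (a , refl)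
    ... | _ | isE _ ¬b = contradiction b ¬b
    ... | _ | isdE _ _ = inj₂ (a , refl)
    splitA : ∀ j → _
    splitA j (a , b) with wFZ π j | stepFZ j
    ... | _ | isN _ _  = inj₁ (a , refl)
    ... | _ | isS ¬b _ = contradiction b ¬b
    ... | _ | isE ¬b _ = contradiction b ¬b
    ... | _ | isdE _ _ = inj₂ (a , refl)
    nA : ∀ j → _
    nA j (a , b) with wFZ π j | stepFZ j
    nA j (a , refl) | _ | isN b _ = (a , b) , λ ()
    dA : ∀ j → _
    dA j (a , b) with wFZ π j | stepFZ j
    dA j (a , refl) | _ | isdE b _ = a , b
    splitA′ : ∀ j → _
    splitA′ j (a , b) with k ℕ.≤? toℕ (p j)
    ... | yes k≤ = inj₁ (a , k≤)
    ... | no k≰  = inj₂ (ℕ.≰⇒> k≰ , b)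

  height-FZ : ∀ k → height (wFZ π) k ≡ + arcs k
  height-FZ k = difference (before N (wFZ π) k) (before S (wFZ π) k) (arcs k) (before-FZ k)

  sideEp side¬Ep : Fin n → ℕ
  sideEp  i = # (λ j → Ep? π j ×-dec (j Fin.<? i) ×-dec (p i Fin.<? p j))
  side¬Ep i = # (λ j → ¬? (Ep? π j) ×-dec (i Fin.<? j) ×-dec (p j Fin.<? p i))

  side-Ep : ∀ {i} → Ep π i → sideNumber π i ≡ sideEp i
  side-Ep {i} e = if-elim {x = sideEp i} {side¬Ep i} (_≡ sideEp i) (Ep? π i)
    (λ _ → refl) (λ ¬e → contradiction e ¬e)

  side-¬Ep : ∀ {i} → ¬ Ep π i → sideNumber π i ≡ side¬Ep i
  side-¬Ep {i} ¬e = if-elim {x = sideEp i} {side¬Ep i} (_≡ side¬Ep i) (Ep? π i)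
    (λ e → contradiction e ¬e) (λ _ → refl)

  Ep-q : ∀ {i} → q i Fin.< i → Ep π (q i)
  Ep-q {i} lt = subst (q i Fin.<_) (sym pq) lt

  ¬Ep-q : ∀ {i} → ¬ q i Fin.< i → ¬ Ep π (q i)
  ¬Ep-q {i} ¬lt e = ¬lt (subst (q i Fin.<_) pq e)

  side<arcs : ∀ i → q i Fin.< i → sideNumber π (q i) ℕ.< arcs (toℕ i)
  side<arcs i q<i = subst (ℕ._< arcs (toℕ i)) (sym (side-Ep (Ep-q q<i)))
    (#-strict
      (λ j → Ep? π j ×-dec (j Fin.<? q i) ×-dec (p (q i) Fin.<? p j))
      (λ j → (toℕ j ℕ.<? toℕ i) ×-dec (toℕ i ℕ.≤? toℕ (p j)))
      (λ j → λ { (_ , j<q , i<p) → ℕ.<-trans j<q q<i , ℕ.<⇒≤ (subst (Fin._< p j) pq i<p) })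
      (q i) (q<i , ℕ.≤-reflexive (cong toℕ (sym pq)))
      (λ { (_ , q<q , _) → ℕ.<-irrefl refl q<q }))

  side≤arcs : ∀ i → ¬ q i Fin.< i → sideNumber π (q i) ℕ.≤ arcs (toℕ i)
  side≤arcs i q≮i = begin
    sideNumber π (q i)
      ≡⟨ side-¬Ep (¬Ep-q q≮i) ⟩
    side¬Ep (q i)
      ≤⟨ #-mono (λ j → ¬? (Ep? π j) ×-dec (q i Fin.<? j) ×-dec (p j Fin.<? p (q i))) R? (λ j → λ { (_ , q<j , p<p) → subst (p j Fin.<_) pq p<p , ℕ.≤-trans (ℕ.≮⇒≥ q≮i) (ℕ.<⇒≤ q<j) }) ⟩
    # R?
      ≡⟨ ℕ.+-cancelˡ-≡ (# C?) (# R?) (arcs (toℕ i)) (trans (sym p<i) (trans (sym (#-perm (λ (j : Fin n) → j Fin.<? i) π)) j<i)) ⟩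
    arcs (toℕ i) ∎
    where
    open ℕ.≤-Reasoning
    R? = λ j → (p j Fin.<? i) ×-dec (i Fin.≤? j)
    C? = λ j → (p j Fin.<? i) ×-dec (j Fin.<? i)
    A? = λ j → (toℕ j ℕ.<? toℕ i) ×-dec (toℕ i ℕ.≤? toℕ (p j))
    p<i : # (λ j → p j Fin.<? i) ≡ # C? ℕ.+ # R?
    p<i = #-split (λ j → p j Fin.<? i) C? R? split
      (λ j → λ { (a , b) → a , λ { (_ , b′) → ℕ.<⇒≱ b b′ } }) (λ j → proj₁)
      where
      split : ∀ j → _
      split j a with j Fin.<? i
      ... | yes b = inj₁ (a , b)
      ... | no ¬b = inj₂ (a , ℕ.≮⇒≥ ¬b)
    j<i : # (λ (j : Fin n) → j Fin.<? i) ≡ # C? ℕ.+ arcs (toℕ i)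
    j<i = #-split (λ (j : Fin n) → j Fin.<? i) C? A? split
      (λ j → λ { (a , b) → b , λ { (_ , a′) → ℕ.<⇒≱ a a′ } }) (λ j → proj₁)
      where
      split : ∀ j → _
      split j b with p j Fin.<? i
      ... | yes a = inj₁ (a , b)
      ... | no ¬a = inj₂ (b , ℕ.≮⇒≥ ¬a)

  isSrLaguerreFZ : IsSrLaguerre (tripleFZ π)
  isSrLaguerreFZ = record
    { motzkin = record
      { nonneg = λ k _ → subst (0ℤ ℤ.≤_) (sym (height-FZ k)) (ℤ.+≤+ ℕ.z≤n)
      ; closed = trans (height-FZ n) (cong +_
          (#-none (λ j → (toℕ j ℕ.<? n) ×-dec (n ℕ.≤? toℕ (p j))) (λ j → λ { (_ , n≤) → ℕ.<⇒≱ (Fin.toℕ<n (p j)) n≤ })))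
      }
    ; h-def = λ _ → refl
    ; c-NE  = λ i ne → ℤ.+≤+ ℕ.z≤n , upper i (ne-le i ne)
    ; c-SdE = λ i sd → ℤ.+≤+ (sd-ge i sd) , upper i (sd-le i sd)
    }
    where
    c = λ i → sideNumber π (q i) ℕ.+ χ (SdE? (wFZ π i))
    upper : ∀ i → c i ℕ.≤ arcs (toℕ i) → + c i ℤ.≤ heights (wFZ π) i
    upper i le = subst (+ c i ℤ.≤_) (sym (height-FZ (toℕ i))) (ℤ.+≤+ le)
    ne-χ : ∀ a → NE a → χ (SdE? a) ≡ 0
    ne-χ _ (inj₁ refl) = refl
    ne-χ _ (inj₂ refl) = refl
    sd-χ : ∀ a → SdE a → χ (SdE? a) ≡ 1
    sd-χ a sd = χ-yes (SdE? a) sd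
    ne-le : ∀ i → NE (wFZ π i) → c i ℕ.≤ arcs (toℕ i)
    ne-le i ne = subst (ℕ._≤ arcs (toℕ i))
      (sym (trans (cong (sideNumber π (q i) ℕ.+_) (ne-χ _ ne)) (ℕ.+-identityʳ _)))
      (side≤arcs i (NE⇒¬q< ne))
    sd-c : ∀ i → SdE (wFZ π i) → c i ≡ suc (sideNumber π (q i))
    sd-c i sd = trans (cong (sideNumber π (q i) ℕ.+_) (sd-χ _ sd)) (ℕ.+-comm _ 1)
    sd-le : ∀ i → SdE (wFZ π i) → c i ℕ.≤ arcs (toℕ i)
    sd-le i sd = subst (ℕ._≤ arcs (toℕ i)) (sym (sd-c i sd)) (side<arcs i (SdE⇒q< sd))
    sd-ge : ∀ i → SdE (wFZ π i) → 1 ℕ.≤ c i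
    sd-ge i sd = subst (1 ℕ.≤_) (sym (sd-c i sd)) (ℕ.s≤s ℕ.z≤n)

Φ-FZ : Permutation′ n → 𝔏 n
Φ-FZ π = tripleFZ π , isSrLaguerreFZ π
open 𝔏 using (w; h; c)

greatest : {P : Fin n → Set} (P? : Decidable P) → ∃ P →
           ∃ λ i → P i × ∀ j → P j → j Fin.≤ i
greatest {zero}  P? (() , _)
greatest {suc n} {P} P? (k , Pk) with Fin.any? (P? ∘ suc)
... | yes p = let i , Pi , max = greatest (P? ∘ suc) p in
              suc i , Pi , λ { zero _ → ℕ.z≤n ; (suc j) Pj → ℕ.s≤s (max j Pj) }
... | no ¬p = zero , P0 k Pk , λ { zero _ → ℕ.z≤n ; (suc j) Pj → contradiction (j , Pj) ¬p }
  where
  P0 : ∀ k → P k → P zero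
  P0 zero    Pk = Pk
  P0 (suc k) Pk = contradiction (k , Pk) ¬p

NE⊎SdE : ∀ a → NE a ⊎ SdE a
NE⊎SdE N  = inj₁ (inj₁ refl)
NE⊎SdE S  = inj₂ (inj₁ refl)
NE⊎SdE E  = inj₁ (inj₂ refl)
NE⊎SdE dE = inj₂ (inj₂ refl)

¬NE×SdE : ∀ {a} → NE a → ¬ SdE a
¬NE×SdE (inj₁ refl) (inj₁ ())
¬NE×SdE (inj₁ refl) (inj₂ ())
¬NE×SdE (inj₂ refl) (inj₁ ())
¬NE×SdE (inj₂ refl) (inj₂ ())

NdE ES : Step → Set
NdE a = a ≡ N ⊎ a ≡ dE
ES  a = a ≡ E ⊎ a ≡ S

NdE? : Decidable NdE
NdE? a = (a ≟ N) ⊎-dec (a ≟ dE)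

ES? : Decidable ES
ES? a = (a ≟ E) ⊎-dec (a ≟ S)

NdE⊎ES : ∀ a → NdE a ⊎ ES a
NdE⊎ES N  = inj₁ (inj₁ refl)
NdE⊎ES S  = inj₂ (inj₂ refl)
NdE⊎ES E  = inj₂ (inj₁ refl)
NdE⊎ES dE = inj₁ (inj₂ refl)

¬NdE×ES : ∀ {a} → NdE a → ¬ ES a
¬NdE×ES (inj₁ refl) (inj₁ ())
¬NdE×ES (inj₁ refl) (inj₂ ())
¬NdE×ES (inj₂ refl) (inj₁ ())
¬NdE×ES (inj₂ refl) (inj₂ ())

c≡0⇒NE : (W : 𝔏 n) → ∀ {i} → c W i ≡ 0ℤ → NE (w W i)
c≡0⇒NE W {i} c≡0 with NE⊎SdE (w W i)
... | inj₁ ne = ne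
... | inj₂ sd with () ← ℤ.drop‿+≤+ (subst (1ℤ ℤ.≤_) c≡0 (proj₁ (𝔏.c-SdE W i sd)))

c-zero : (W : 𝔏 (suc m)) → c W zero ≡ 0ℤ
c-zero W with NE⊎SdE (w W zero)
... | inj₁ ne = ℤ.≤-antisym (subst (c W zero ℤ.≤_) h≡0 (proj₂ (𝔏.c-NE W zero ne))) (proj₁ (𝔏.c-NE W zero ne))
  where h≡0 = trans (𝔏.h-def W zero) (height-zero (w W))
... | inj₂ sd with ℤ.≤-trans (proj₁ (𝔏.c-SdE W zero sd)) (subst (c W zero ℤ.≤_) h≡0 (proj₂ (𝔏.c-SdE W zero sd)))
  where h≡0 = trans (𝔏.h-def W zero) (height-zero (w W))
... | ℤ.+≤+ ()

∃cs : (W : 𝔏 (suc m)) → ∃ λ i → c W i ≡ 0ℤ × ∀ j → c W j ≡ 0ℤ → j Fin.≤ i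
∃cs W = greatest (λ i → c W i ℤ.≟ 0ℤ) (zero , c-zero W)

cs : 𝔏 (suc m) → Fin (suc m)
cs W = proj₁ (∃cs W)

record ξSpec (W V : 𝔏 (suc m)) : Set where
  field
    cs-eq   : cs V ≡ opposite (cs W)
    NE⇔SdE  : ∀ j → j ≢ opposite (cs W) → NE (w V j) ⇔ SdE (w W (opposite j))
    h-above : ∀ j → opposite (cs W) Fin.< j → SdE (w V j) →
              h V j ≡ h W (opposite j) ℤ.+ 1ℤ
    h-below : ∀ j → j Fin.< opposite (cs W) → NE (w V j) →
              h V j ≡ h W (opposite j) ℤ.- 1ℤ
    h-other : ∀ j → ¬ (opposite (cs W) Fin.< j × SdE (w V j)) →
              ¬ (j Fin.< opposite (cs W) × NE (w V j)) →
              h V j ≡ h W (opposite j)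
    c-eq    : ∀ j → c V j ≡ h V j ℤ.- h W (opposite j) ℤ.+ c W (opposite j)

record Isξ (ξ : 𝔏 (suc m) → 𝔏 (suc m)) : Set where
  field
    involutive : ∀ W → ξ (ξ W) ≈ W
    spec       : ∀ W → ξSpec W (ξ W)

c-cs : (W : 𝔏 (suc m)) → c W (cs W) ≡ 0ℤ
c-cs W = proj₁ (proj₂ (∃cs W))

cs-max : (W : 𝔏 (suc m)) → ∀ j → c W j ≡ 0ℤ → j Fin.≤ cs W
cs-max W = proj₂ (proj₂ (∃cs W))

cs-unique : (W : 𝔏 (suc m)) → ∀ i → c W i ≡ 0ℤ → (∀ j → c W j ≡ 0ℤ → j Fin.≤ i) → cs W ≡ i
cs-unique W i c≡0 max = Fin.≤-antisym (max (cs W) (c-cs W)) (cs-max W i c≡0)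

opp-< : {i j : Fin n} → i Fin.< j → opposite j Fin.< opposite i
opp-< {suc n} {i} {suc j} i<j = begin-strict
  toℕ (opposite (suc j)) ≡⟨ Fin.opposite-prop (suc j) ⟩
  n ℕ.∸ suc (toℕ j)      <⟨ ℕ.∸-monoʳ-< i<j (Fin.toℕ<n j) ⟩
  n ℕ.∸ toℕ i            ≡⟨ Fin.opposite-prop i ⟨
  toℕ (opposite i)       ∎
  where open ℕ.≤-Reasoning

opp-opp : (i : Fin n) → opposite (opposite i) ≡ i
opp-opp = Fin.opposite-involutive

opp-<ˡ : {i j : Fin n} → opposite i Fin.< j → opposite j Fin.< i
opp-<ˡ {i = i} {j} lt = subst (opposite j Fin.<_) (opp-opp i) (opp-< lt)

opp-<ʳ : {i j : Fin n} → i Fin.< opposite j → j Fin.< opposite i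
opp-<ʳ {i = i} {j} lt = subst (Fin._< opposite i) (opp-opp j) (opp-< lt)

opp-≤ : {i j : Fin n} → i Fin.≤ j → opposite j Fin.≤ opposite i
opp-≤ {i = i} {j} le with Fin.<-cmp i j
... | tri< lt _ _   = ℕ.<⇒≤ (opp-< lt)
... | tri≈ _ refl _ = ℕ.≤-refl
... | tri> _ _ gt   = contradiction gt (ℕ.≤⇒≯ le)

opp-≡ : {i j : Fin n} → j ≡ opposite i → opposite j ≡ i
opp-≡ {i = i} eq = trans (cong opposite eq) (opp-opp i)

≈-sym : {W V : 𝔏 n} → W ≈ V → V ≈ W
≈-sym eq = record { w≗ = sym ∘ _≋_.w≗ eq ; h≗ = sym ∘ _≋_.h≗ eq ; c≗ = sym ∘ _≋_.c≗ eq }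

ℤ-cancelˡ : ∀ a x y → a ℤ.+ x ≡ a ℤ.+ y → x ≡ y
ℤ-cancelˡ a x y eq = trans (lemma a x) (trans (cong (λ z → z ℤ.- a) eq) (sym (lemma a y)))
  where
  lemma : ∀ a x → x ≡ a ℤ.+ x ℤ.- a
  lemma = ℤ-Solver.solve-∀

rise-injective-NE : ∀ {a b} → NE a → NE b → rise a ≡ rise b → a ≡ b
rise-injective-NE (inj₁ refl) (inj₁ refl) _ = refl
rise-injective-NE (inj₂ refl) (inj₂ refl) _ = refl
rise-injective-NE (inj₁ refl) (inj₂ refl) ()
rise-injective-NE (inj₂ refl) (inj₁ refl) ()

rise-injective-SdE : ∀ {a b} → SdE a → SdE b → rise a ≡ rise b → a ≡ b
rise-injective-SdE (inj₁ refl) (inj₁ refl) _ = refl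
rise-injective-SdE (inj₂ refl) (inj₂ refl) _ = refl
rise-injective-SdE (inj₁ refl) (inj₂ refl) ()
rise-injective-SdE (inj₂ refl) (inj₁ refl) ()

module _ {W V V′ : 𝔏 (suc m)} (s : ξSpec W V) (s′ : ξSpec W V′) where

  private
    module s  = ξSpec s
    module s′ = ξSpec s′

    cs-NE : ∀ {V} → ξSpec W V → ∀ {j} → j ≡ opposite (cs W) → NE (w V j)
    cs-NE {V} s refl = c≡0⇒NE V (trans (cong (c V) (sym (ξSpec.cs-eq s))) (c-cs V))

    ¬NE⇒SdE : ∀ {a} → ¬ NE a → SdE a
    ¬NE⇒SdE {a} ¬ne with NE⊎SdE a
    ... | inj₁ ne = contradiction ne ¬ne
    ... | inj₂ sd = sd

    kind : ∀ j → (NE (w V j) × NE (w V′ j)) ⊎ (SdE (w V j) × SdE (w V′ j))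
    kind j with j Fin.≟ opposite (cs W)
    ... | yes eq = inj₁ (cs-NE s eq , cs-NE s′ eq)
    ... | no ne with SdE? (w W (opposite j))
    ... | yes sd = inj₁ (Equivalence.from (s.NE⇔SdE j ne) sd , Equivalence.from (s′.NE⇔SdE j ne) sd)
    ... | no ¬sd = inj₂ (¬NE⇒SdE (¬sd ∘ Equivalence.to (s.NE⇔SdE j ne)) ,
                         ¬NE⇒SdE (¬sd ∘ Equivalence.to (s′.NE⇔SdE j ne)))

    h-eq : ∀ j → h V j ≡ h V′ j
    h-eq j with kind j | Fin.<-cmp j (opposite (cs W))
    ... | inj₁ (a , b) | tri< lt _ _ = trans (s.h-below j lt a) (sym (s′.h-below j lt b))
    ... | inj₁ (a , b) | tri≈ ¬lt _ _ =
      trans (s.h-other j (¬NE×SdE a ∘ proj₂) (¬lt ∘ proj₁)) (sym (s′.h-other j (¬NE×SdE b ∘ proj₂) (¬lt ∘ proj₁)))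
    ... | inj₁ (a , b) | tri> ¬lt _ _ =
      trans (s.h-other j (¬NE×SdE a ∘ proj₂) (¬lt ∘ proj₁)) (sym (s′.h-other j (¬NE×SdE b ∘ proj₂) (¬lt ∘ proj₁)))
    ... | inj₂ (a , b) | tri< _ _ ¬gt =
      trans (s.h-other j (¬gt ∘ proj₁) (λ (_ , x) → ¬NE×SdE x a)) (sym (s′.h-other j (¬gt ∘ proj₁) (λ (_ , x) → ¬NE×SdE x b)))
    ... | inj₂ (a , b) | tri≈ _ _ ¬gt =
      trans (s.h-other j (¬gt ∘ proj₁) (λ (_ , x) → ¬NE×SdE x a)) (sym (s′.h-other j (¬gt ∘ proj₁) (λ (_ , x) → ¬NE×SdE x b)))
    ... | inj₂ (a , b) | tri> _ _ gt = trans (s.h-above j gt a) (sym (s′.h-above j gt b))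

    height-eq : ∀ (j : Fin (suc m)) → height (w V) (toℕ j) ≡ height (w V′) (toℕ j)
    height-eq j = trans (sym (𝔏.h-def V j)) (trans (h-eq j) (𝔏.h-def V′ j))

    height-next : ∀ (j : Fin (suc m)) → height (w V) (suc (toℕ j)) ≡ height (w V′) (suc (toℕ j))
    height-next j with view j
    ... | ‵fromℕ {m} rewrite Fin.toℕ-fromℕ m =
      trans (Is2Motzkin.closed (𝔏.motzkin V)) (sym (Is2Motzkin.closed (𝔏.motzkin V′)))
    ... | ‵inject₁ i rewrite Fin.toℕ-inject₁ i = height-eq (suc i)

    rise-eq : ∀ j → rise (w V j) ≡ rise (w V′ j)
    rise-eq j = ℤ-cancelˡ (height (w V) (toℕ j)) _ _ (begin
      height (w V) (toℕ j) ℤ.+ rise (w V j)   ≡⟨ height-suc (w V) j ⟨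
      height (w V) (suc (toℕ j))              ≡⟨ height-next j ⟩
      height (w V′) (suc (toℕ j))             ≡⟨ height-suc (w V′) j ⟩
      height (w V′) (toℕ j) ℤ.+ rise (w V′ j) ≡⟨ cong (ℤ._+ rise (w V′ j)) (height-eq j) ⟨
      height (w V) (toℕ j) ℤ.+ rise (w V′ j)  ∎)
      where open ≡-Reasoning

    w-eq : ∀ j → w V j ≡ w V′ j
    w-eq j with kind j
    ... | inj₁ (a , b) = rise-injective-NE a b (rise-eq j)
    ... | inj₂ (a , b) = rise-injective-SdE a b (rise-eq j)

  ξSpec-unique : V ≈ V′
  ξSpec-unique = record
    { w≗ = w-eq
    ; h≗ = h-eq
    ; c≗ = λ j → trans (s.c-eq j)
        (trans (cong (λ x → x ℤ.- h W (opposite j) ℤ.+ c W (opposite j)) (h-eq j)) (sym (s′.c-eq j)))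
    }

ξSpec-sym : {W V : 𝔏 (suc m)} → ξSpec W V → ξSpec V W
ξSpec-sym {W = W} {V} s = record
  { cs-eq   = sym cs≡
  ; NE⇔SdE  = λ i i≢ → mk⇔ (to i i≢) (from i i≢)
  ; h-above = λ i lt sd → back (1ℤ) i (s.h-below (opposite i) (lt′ i lt) (Equivalence.from (s.NE⇔SdE _ (ne (lt≢ i lt))) (subst (λ k → SdE (w W k)) (sym (opp-opp i)) sd)))
  ; h-below = λ i lt ne′ → back′ i (s.h-above (opposite i) (gt′ i lt) (flipped i (gt≢ i lt) ne′))
  ; h-other = other
  ; c-eq    = λ i → begin
      c W i
        ≡⟨ lemma₀ (h W i) (h V (opposite i)) (c W i) ⟩
      h W i ℤ.- h V (opposite i) ℤ.+ (h V (opposite i) ℤ.- h W i ℤ.+ c W i)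
        ≡⟨ cong (λ k → h W i ℤ.- h V (opposite i) ℤ.+ (h V (opposite i) ℤ.- h W k ℤ.+ c W k)) (opp-opp i) ⟨
      h W i ℤ.- h V (opposite i) ℤ.+ (h V (opposite i) ℤ.- h W (opposite (opposite i)) ℤ.+ c W (opposite (opposite i)))
        ≡⟨ cong (λ x → h W i ℤ.- h V (opposite i) ℤ.+ x) (s.c-eq (opposite i)) ⟨
      h W i ℤ.- h V (opposite i) ℤ.+ c V (opposite i) ∎
  }
  where
  open ≡-Reasoning
  module s = ξSpec s
  lemma₀ : ∀ a b x → x ≡ a ℤ.- b ℤ.+ (b ℤ.- a ℤ.+ x)
  lemma₀ = ℤ-Solver.solve-∀
  cs≡ : opposite (cs V) ≡ cs W
  cs≡ = opp-≡ s.cs-eq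
  ne : ∀ {i} → i ≢ cs W → opposite i ≢ opposite (cs W)
  ne i≢ eq = i≢ (trans (sym (opp-opp _)) (opp-≡ eq))
  NE-opp : ∀ i → NE (w W i) → NE (w W (opposite (opposite i)))
  NE-opp i = subst (λ k → NE (w W k)) (sym (opp-opp i))
  flipped : ∀ i → i ≢ cs W → NE (w W i) → SdE (w V (opposite i))
  flipped i i≢ x with NE⊎SdE (w V (opposite i))
  ... | inj₂ sd = sd
  ... | inj₁ y  = contradiction (Equivalence.to (s.NE⇔SdE _ (ne i≢)) y) (¬NE×SdE (NE-opp i x))
  to : ∀ i → i ≢ opposite (cs V) → NE (w W i) → SdE (w V (opposite i))
  to i i≢ = flipped i (λ eq → i≢ (trans eq (sym cs≡)))
  from : ∀ i → i ≢ opposite (cs V) → SdE (w V (opposite i)) → NE (w W i)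
  from i i≢ sd with NE⊎SdE (w W i)
  ... | inj₁ x = x
  ... | inj₂ y = contradiction sd (¬NE×SdE (Equivalence.from (s.NE⇔SdE _ (ne (λ eq → i≢ (trans eq (sym cs≡)))))
                   (subst (λ k → SdE (w W k)) (sym (opp-opp i)) y)))
  lt′ : ∀ i → opposite (cs V) Fin.< i → opposite i Fin.< opposite (cs W)
  lt′ i lt = opp-< (subst (Fin._< i) cs≡ lt)
  lt≢ : ∀ i → opposite (cs V) Fin.< i → i ≢ cs W
  lt≢ i lt eq = Fin.<⇒≢ lt (trans cs≡ (sym eq))
  gt′ : ∀ i → i Fin.< opposite (cs V) → opposite (cs W) Fin.< opposite i
  gt′ i lt = opp-< (subst (i Fin.<_) cs≡ lt)
  gt≢ : ∀ i → i Fin.< opposite (cs V) → i ≢ cs W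
  gt≢ i lt eq = Fin.<⇒≢ lt (trans eq (sym cs≡))
  back : ∀ x i → h V (opposite i) ≡ h W (opposite (opposite i)) ℤ.- x → h W i ≡ h V (opposite i) ℤ.+ x
  back x i eq = trans (lemma (h W i) x) (cong (ℤ._+ x) (sym (trans eq (cong (λ k → h W k ℤ.- x) (opp-opp i)))))
    where
    lemma : ∀ a x → a ≡ a ℤ.- x ℤ.+ x
    lemma = ℤ-Solver.solve-∀
  back′ : ∀ i → h V (opposite i) ≡ h W (opposite (opposite i)) ℤ.+ 1ℤ → h W i ≡ h V (opposite i) ℤ.- 1ℤ
  back′ i eq = trans (lemma (h W i)) (cong (ℤ._- 1ℤ) (sym (trans eq (cong (λ k → h W k ℤ.+ 1ℤ) (opp-opp i)))))
    where
    lemma : ∀ a → a ≡ a ℤ.+ 1ℤ ℤ.- 1ℤ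
    lemma = ℤ-Solver.solve-∀
  other : ∀ i → ¬ (opposite (cs V) Fin.< i × SdE (w W i)) →
          ¬ (i Fin.< opposite (cs V) × NE (w W i)) → h W i ≡ h V (opposite i)
  other i ¬a ¬b = sym (trans (s.h-other (opposite i)
      (λ (lt , sd) → let lt₁ = subst (i Fin.<_) (sym cs≡) (subst (Fin._< cs W) (opp-opp i) (opp-<ˡ lt)) in
                     ¬b (lt₁ , from i (λ eq → Fin.<⇒≢ lt₁ eq) sd))
      (λ (lt , x) → let lt₁ = subst (Fin._< i) (sym cs≡) (subst (cs W Fin.<_) (opp-opp i) (opp-<ʳ lt)) in
                    ¬a (lt₁ , sd lt₁ x)))
    (cong (h W) (opp-opp i)))
    where
    sd : opposite (cs V) Fin.< i → NE (w V (opposite i)) → SdE (w W i)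
    sd lt x with NE⊎SdE (w W i)
    ... | inj₂ y = y
    ... | inj₁ y = contradiction (flipped i (lt≢ i lt) y) (¬NE×SdE x)

module ξConstruction (W : 𝔏 (suc m)) where

  private
    module W = 𝔏 W
    M = cs W

    H : Fin (suc m) → ℤ
    H = heights W.w

  -- The new height at opposite i is H i + e i, and the next one is H i + d i.
  e : Fin (suc m) → ℤ
  e i with Fin.<-cmp i M
  ... | tri< _ _ _ = + χ (NE? (W.w i))
  ... | tri≈ _ _ _ = 0ℤ
  ... | tri> _ _ _ = ℤ.- + χ (SdE? (W.w i))

  d : Fin (suc m) → ℤ
  d zero = 0ℤ
  d (suc i) with inject₁ i Fin.<? M
  ... | yes _ = + χ (ES? (W.w (inject₁ i)))
  ... | no  _ = ℤ.- + χ (NdE? (W.w (inject₁ i)))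

  private
    M-NE : NE (W.w M)
    M-NE = c≡0⇒NE W (c-cs W)

  up : ∀ i → Dec (i ≡ M ⊎ SdE (W.w i))
  up i = (i Fin.≟ M) ⊎-dec SdE? (W.w i)

  step : {P : Set} → Dec P → ℤ → Step
  step (yes _) z = if does (z ℤ.≟ 0ℤ) then E else N
  step (no  _) z = if does (z ℤ.≟ 0ℤ) then dE else S

  new : Fin (suc m) → Step
  new i = step (up i) (d i ℤ.- e i)

  private
    Bit -Bit : ℤ → Set
    Bit  z = z ≡ 0ℤ ⊎ z ≡ 1ℤ
    -Bit z = z ≡ 0ℤ ⊎ z ≡ -1ℤ

    χ-bit : {P : Set} (P? : Dec P) → Bit (+ χ P?)
    χ-bit (yes _) = inj₂ refl
    χ-bit (no _)  = inj₁ refl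

    -χ-bit : {P : Set} (P? : Dec P) → -Bit (ℤ.- + χ P?)
    -χ-bit (yes _) = inj₂ refl
    -χ-bit (no _)  = inj₁ refl

    d-bit : ∀ i → i Fin.≤ M → Bit (d i)
    d-bit zero    _ = inj₁ refl
    d-bit (suc i) i<M with inject₁ i Fin.<? M
    ... | yes _ = χ-bit (ES? (W.w (inject₁ i)))
    ... | no ¬p = contradiction (subst (ℕ._< toℕ M) (sym (Fin.toℕ-inject₁ i)) i<M) ¬p

    -d-bit : ∀ i → M Fin.< i → -Bit (d i)
    -d-bit (suc i) M<i with inject₁ i Fin.<? M
    ... | yes p = contradiction (subst (ℕ._< toℕ M) (Fin.toℕ-inject₁ i) p) (ℕ.≤⇒≯ (ℕ.s≤s⁻¹ M<i))
    ... | no _  = -χ-bit (NdE? (W.w (inject₁ i)))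

    rise-step-yes : {P : Set} (P? : Dec P) → P → ∀ {z} → Bit z → rise (step P? z) ≡ z
    rise-step-yes (yes _) _ (inj₁ refl) = refl
    rise-step-yes (yes _) _ (inj₂ refl) = refl
    rise-step-yes (no ¬p) p _ = contradiction p ¬p

    rise-step-no : {P : Set} (P? : Dec P) → ¬ P → ∀ {z} → -Bit z → rise (step P? z) ≡ z
    rise-step-no (yes p) ¬p _ = contradiction p ¬p
    rise-step-no (no _) _ (inj₁ refl) = refl
    rise-step-no (no _) _ (inj₂ refl) = refl

    step-NE : {P : Set} (P? : Dec P) → P → ∀ z → NE (step P? z)
    step-NE (yes _) _ z with z ℤ.≟ 0ℤ
    ... | yes _ = inj₂ refl
    ... | no _  = inj₁ refl
    step-NE (no ¬p) p z = contradiction p ¬p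

    step-SdE : {P : Set} (P? : Dec P) → ¬ P → ∀ z → SdE (step P? z)
    step-SdE (no _) _ z with z ℤ.≟ 0ℤ
    ... | yes _ = inj₂ refl
    ... | no _  = inj₁ refl
    step-SdE (yes p) ¬p z = contradiction p ¬p

    rise-new : ∀ i → rise (new i) ≡ d i ℤ.- e i
    rise-new i with Fin.<-cmp i M
    rise-new i | tri< lt i≢M _ with NE⊎SdE (W.w i)
    ... | inj₁ ne = rise-step-no (up i) (λ { (inj₁ eq) → i≢M eq ; (inj₂ sd) → ¬NE×SdE ne sd })
                      (minus (χ-yes (NE? (W.w i)) ne) (d-bit i (ℕ.<⇒≤ lt)))
      where
      minus : ∀ {x k} → k ≡ 1 → Bit x → -Bit (x ℤ.- + k)
      minus refl (inj₁ refl) = inj₂ refl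
      minus refl (inj₂ refl) = inj₁ refl
    ... | inj₂ sd = rise-step-yes (up i) (inj₂ sd)
                      (minus (χ-no (NE? (W.w i)) (λ ne → ¬NE×SdE ne sd)) (d-bit i (ℕ.<⇒≤ lt)))
      where
      minus : ∀ {x k} → k ≡ 0 → Bit x → Bit (x ℤ.- + k)
      minus refl (inj₁ refl) = inj₁ refl
      minus refl (inj₂ refl) = inj₂ refl
    rise-new i | tri≈ _ i≡M _ = rise-step-yes (up i) (inj₁ i≡M) (minus (d-bit i (ℕ.≤-reflexive (cong toℕ i≡M))))
      where
      minus : ∀ {x} → Bit x → Bit (x ℤ.- 0ℤ)
      minus (inj₁ refl) = inj₁ refl
      minus (inj₂ refl) = inj₂ refl
    rise-new i | tri> _ i≢M gt with NE⊎SdE (W.w i)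
    ... | inj₁ ne = rise-step-no (up i) (λ { (inj₁ eq) → i≢M eq ; (inj₂ sd) → ¬NE×SdE ne sd })
                      (minus (χ-no (SdE? (W.w i)) (¬NE×SdE ne)) (-d-bit i gt))
      where
      minus : ∀ {x k} → k ≡ 0 → -Bit x → -Bit (x ℤ.- (ℤ.- + k))
      minus refl (inj₁ refl) = inj₁ refl
      minus refl (inj₂ refl) = inj₂ refl
    ... | inj₂ sd = rise-step-yes (up i) (inj₂ sd) (minus (χ-yes (SdE? (W.w i)) sd) (-d-bit i gt))
      where
      minus : ∀ {x k} → k ≡ 1 → -Bit x → Bit (x ℤ.- (ℤ.- + k))
      minus refl (inj₁ refl) = inj₂ refl
      minus refl (inj₂ refl) = inj₁ refl

    e≡rise+d : ∀ i → e (inject₁ i) ≡ rise (W.w (inject₁ i)) ℤ.+ d (suc i)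
    e≡rise+d i with Fin.<-cmp (inject₁ i) M | inject₁ i Fin.<? M
    ... | tri< lt _ _ | no ¬lt = contradiction lt ¬lt
    ... | tri≈ ¬lt _ _ | yes lt = contradiction lt ¬lt
    ... | tri> ¬lt _ _ | yes lt = contradiction lt ¬lt
    ... | tri< _ _ _ | yes _ = case (W.w (inject₁ i))
      where
      case : ∀ a → + χ (NE? a) ≡ rise a ℤ.+ + χ (ES? a)
      case N  = refl
      case S  = refl
      case E  = refl
      case dE = refl
    ... | tri≈ _ eq _ | no _ = case (subst (λ k → NE (W.w k)) (sym eq) M-NE)
      where
      case : ∀ {a} → NE a → 0ℤ ≡ rise a ℤ.+ (ℤ.- + χ (NdE? a))
      case (inj₁ refl) = refl
      case (inj₂ refl) = refl
    ... | tri> _ _ _ | no _ = case (W.w (inject₁ i))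
      where
      case : ∀ a → ℤ.- + χ (SdE? a) ≡ rise a ℤ.+ (ℤ.- + χ (NdE? a))
      case N  = refl
      case S  = refl
      case E  = refl
      case dE = refl

    next : ∀ i → H (inject₁ i) ℤ.+ e (inject₁ i) ≡ H (suc i) ℤ.+ d (suc i)
    next i = begin
      H (inject₁ i) ℤ.+ e (inject₁ i)                             ≡⟨ cong (λ x → H (inject₁ i) ℤ.+ x) (e≡rise+d i) ⟩
      H (inject₁ i) ℤ.+ (rise (W.w (inject₁ i)) ℤ.+ d (suc i))    ≡⟨ ℤ.+-assoc (H (inject₁ i)) _ _ ⟨
      H (inject₁ i) ℤ.+ rise (W.w (inject₁ i)) ℤ.+ d (suc i)      ≡⟨ cong (ℤ._+ d (suc i)) (height-suc W.w (inject₁ i)) ⟨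
      height W.w (suc (toℕ (inject₁ i))) ℤ.+ d (suc i)            ≡⟨ cong (λ k → height W.w (suc k) ℤ.+ d (suc i)) (Fin.toℕ-inject₁ i) ⟩
      H (suc i) ℤ.+ d (suc i)                                     ∎
      where open ≡-Reasoning

    H-nonneg : ∀ i → 0ℤ ℤ.≤ H i
    H-nonneg i = Is2Motzkin.nonneg W.motzkin (toℕ i) (ℕ.<⇒≤ (Fin.toℕ<n i))

    c-NE : ∀ i → NE (W.w i) → 0ℤ ℤ.≤ W.c i × W.c i ℤ.≤ H i
    c-NE i ne = proj₁ (W.c-NE i ne) , subst (W.c i ℤ.≤_) (W.h-def i) (proj₂ (W.c-NE i ne))

    c-SdE : ∀ i → SdE (W.w i) → 1ℤ ℤ.≤ W.c i × W.c i ℤ.≤ H i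
    c-SdE i ne = proj₁ (W.c-SdE i ne) , subst (W.c i ℤ.≤_) (W.h-def i) (proj₂ (W.c-SdE i ne))

    c>0 : ∀ i → M Fin.< i → 1ℤ ℤ.≤ W.c i
    c>0 i M<i with NE⊎SdE (W.w i)
    ... | inj₂ sd = proj₁ (c-SdE i sd)
    ... | inj₁ ne = positive (proj₁ (c-NE i ne)) (λ c≡0 → ℕ.<⇒≱ M<i (cs-max W i c≡0))
      where
      positive : ∀ {x} → 0ℤ ℤ.≤ x → x ≢ 0ℤ → 1ℤ ℤ.≤ x
      positive (ℤ.+≤+ {n = zero}  _) x≢0 = contradiction refl x≢0
      positive (ℤ.+≤+ {n = suc _} _) _   = ℤ.+≤+ (ℕ.s≤s ℕ.z≤n)

    data E-View (i : Fin (suc m)) : ℤ → Set where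
      before-NE  : i Fin.< M → NE (W.w i) → E-View i 1ℤ
      before-SdE : i Fin.< M → SdE (W.w i) → E-View i 0ℤ
      at         : i ≡ M → E-View i 0ℤ
      after-NE   : M Fin.< i → NE (W.w i) → E-View i 0ℤ
      after-SdE  : M Fin.< i → SdE (W.w i) → E-View i -1ℤ

    e-view : ∀ i → E-View i (e i)
    e-view i with Fin.<-cmp i M | NE⊎SdE (W.w i)
    ... | tri< lt _ _ | inj₁ ne rewrite χ-yes (NE? (W.w i)) ne = before-NE lt ne
    ... | tri< lt _ _ | inj₂ sd rewrite χ-no (NE? (W.w i)) (λ ne → ¬NE×SdE ne sd) = before-SdE lt sd
    ... | tri≈ _ eq _ | _ = at eq
    ... | tri> _ _ gt | inj₁ ne rewrite χ-no (SdE? (W.w i)) (¬NE×SdE ne) = after-NE gt ne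
    ... | tri> _ _ gt | inj₂ sd rewrite χ-yes (SdE? (W.w i)) sd = after-SdE gt sd

    first : H (fromℕ m) ℤ.+ e (fromℕ m) ≡ 0ℤ
    first = last (e-view (fromℕ m)) closed
      where
      l = fromℕ m
      closed : H l ℤ.+ rise (W.w l) ≡ 0ℤ
      closed = trans (sym (height-suc W.w l))
        (trans (cong (λ k → height W.w (suc k)) (Fin.toℕ-fromℕ m)) (Is2Motzkin.closed W.motzkin))
      not-N : ∀ {x} → 0ℤ ℤ.≤ x → x ℤ.+ 1ℤ ≢ 0ℤ
      not-N (ℤ.+≤+ {n = k} _) eq with () ← trans (ℕ.+-comm 1 k) (ℤ.+-injective eq)
      NE-E : NE (W.w l) → rise (W.w l) ≡ 0ℤ
      NE-E (inj₁ eq) = contradiction (subst (λ a → H l ℤ.+ rise a ≡ 0ℤ) eq closed) (not-N (H-nonneg l))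
      NE-E (inj₂ eq) = cong rise eq
      same : NE (W.w l) → H l ℤ.+ 0ℤ ≡ 0ℤ
      same ne = trans (cong (λ x → H l ℤ.+ x) (sym (NE-E ne))) closed
      H≢0 : M Fin.< l → ∀ {x} → W.c l ℤ.≤ x → x ℤ.+ 0ℤ ≢ 0ℤ
      H≢0 M<l {x} c≤x eq with ℤ.≤-trans (c>0 l M<l) (subst (W.c l ℤ.≤_) (trans (sym (ℤ.+-identityʳ x)) eq) c≤x)
      ... | ℤ.+≤+ ()
      last : ∀ {x} → E-View l x → H l ℤ.+ rise (W.w l) ≡ 0ℤ → H l ℤ.+ x ≡ 0ℤ
      last (before-NE lt _)  _ = contradiction lt (ℕ.≤⇒≯ (Fin.≤fromℕ M))
      last (before-SdE lt _) _ = contradiction lt (ℕ.≤⇒≯ (Fin.≤fromℕ M))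
      last (at eq)           _ = same (subst (λ k → NE (W.w k)) (sym eq) M-NE)
      last (after-NE M<l ne) _ = same ne
      last (after-SdE M<l (inj₁ eq)) cl = subst (λ a → H l ℤ.+ rise a ≡ 0ℤ) eq cl
      last (after-SdE M<l (inj₂ eq)) cl =
        contradiction (subst (λ a → H l ℤ.+ rise a ≡ 0ℤ) eq cl) (H≢0 M<l (proj₂ (c-SdE l (inj₂ eq))))

  v : Fin (suc m) → Step
  v j = new (opposite j)

  private
    cancel : ∀ a x y → a ℤ.+ y ℤ.+ (x ℤ.- y) ≡ a ℤ.+ x
    cancel = ℤ-Solver.solve-∀

    opp-inject₁ : ∀ (i : Fin m) → opposite (inject₁ i) ≡ suc (opposite i)
    opp-inject₁ i = trans (cong opposite (cong inject₁ (sym (opp-opp i)))) (opp-opp (suc (opposite i)))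

    after : ∀ j → heights v j ≡ H (opposite j) ℤ.+ e (opposite j) →
            height v (suc (toℕ j)) ≡ H (opposite j) ℤ.+ d (opposite j)
    after j eq = begin
      height v (suc (toℕ j))                        ≡⟨ height-suc v j ⟩
      heights v j ℤ.+ rise (v j)                    ≡⟨ cong₂ ℤ._+_ eq (rise-new (opposite j)) ⟩
      H i ℤ.+ e i ℤ.+ (d i ℤ.- e i)                 ≡⟨ cancel (H i) (d i) (e i) ⟩
      H i ℤ.+ d i                                   ∎
      where
      open ≡-Reasoning
      i = opposite j

  heights-v : ∀ j → heights v j ≡ H (opposite j) ℤ.+ e (opposite j)
  heights-v = <-weakInduction (λ j → heights v j ≡ H (opposite j) ℤ.+ e (opposite j))
    (trans (height-zero v) (sym first))
    (λ j ih → begin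
      height v (suc (toℕ j))                                      ≡⟨ cong (height v ∘ suc) (Fin.toℕ-inject₁ j) ⟨
      height v (suc (toℕ (inject₁ j)))                            ≡⟨ after (inject₁ j) ih ⟩
      H (opposite (inject₁ j)) ℤ.+ d (opposite (inject₁ j))       ≡⟨ cong (λ i → H i ℤ.+ d i) (opp-inject₁ j) ⟩
      H (suc (opposite j)) ℤ.+ d (suc (opposite j))               ≡⟨ next (opposite j) ⟨
      H (inject₁ (opposite j)) ℤ.+ e (inject₁ (opposite j))       ∎)
    where open ≡-Reasoning

  private
    closed-v : height v (suc m) ≡ 0ℤ
    closed-v = begin
      height v (suc m)                                     ≡⟨ cong (height v ∘ suc) (Fin.toℕ-fromℕ m) ⟨
      height v (suc (toℕ (fromℕ m)))                       ≡⟨ after (fromℕ m) (heights-v (fromℕ m)) ⟩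
      H (opposite (fromℕ m)) ℤ.+ d (opposite (fromℕ m))    ≡⟨ cong (λ i → H i ℤ.+ d i) (opp-opp zero) ⟩
      H zero ℤ.+ 0ℤ                                        ≡⟨ cong (ℤ._+ 0ℤ) (height-zero W.w) ⟩
      0ℤ                                                   ∎
      where open ≡-Reasoning

    kind : ∀ i → NE (new i) → i ≡ M ⊎ SdE (W.w i)
    kind i ne with up i in eq
    ... | yes p = p
    ... | no ¬p = contradiction (subst (λ u → SdE (step u (d i ℤ.- e i))) eq (step-SdE (up i) ¬p _)) (¬NE×SdE ne)

    new-NE : ∀ i → i ≡ M ⊎ SdE (W.w i) → NE (new i)
    new-NE i p = step-NE (up i) p _

    new-SdE : ∀ i → i ≢ M → NE (W.w i) → SdE (new i)
    new-SdE i i≢M ne = step-SdE (up i) (λ { (inj₁ eq) → i≢M eq ; (inj₂ sd) → ¬NE×SdE ne sd }) _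

    nonneg-e : ∀ i → 0ℤ ℤ.≤ H i ℤ.+ e i
    nonneg-e i = go (e-view i)
      where
      go : ∀ {x} → E-View i x → 0ℤ ℤ.≤ H i ℤ.+ x
      go (before-NE _ _)  = ℤ.+-mono-≤ (H-nonneg i) (ℤ.+≤+ {n = 1} ℕ.z≤n)
      go (before-SdE _ _) = ℤ.+-mono-≤ (H-nonneg i) ℤ.≤-refl
      go (at _)           = ℤ.+-mono-≤ (H-nonneg i) ℤ.≤-refl
      go (after-NE _ _)   = ℤ.+-mono-≤ (H-nonneg i) ℤ.≤-refl
      go (after-SdE _ sd) = ℤ.+-monoˡ-≤ -1ℤ (ℤ.≤-trans (proj₁ (c-SdE i sd)) (proj₂ (c-SdE i sd)))

    nonneg-v : ∀ k → k ℕ.≤ suc m → 0ℤ ℤ.≤ height v k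
    nonneg-v k k≤ with ℕ.m≤n⇒m<n∨m≡n k≤
    ... | inj₂ refl = ℤ.≤-reflexive (sym closed-v)
    ... | inj₁ k<   = subst (λ k → 0ℤ ℤ.≤ height v k) (Fin.toℕ-fromℕ< k<)
      (subst (0ℤ ℤ.≤_) (sym (heights-v (Fin.fromℕ< k<))) (nonneg-e (opposite (Fin.fromℕ< k<))))

    b-le : ∀ i → e i ℤ.+ W.c i ℤ.≤ H i ℤ.+ e i
    b-le i = subst (e i ℤ.+ W.c i ℤ.≤_) (ℤ.+-comm (e i) (H i)) (ℤ.+-monoʳ-≤ (e i) c≤H)
      where
      c≤H : W.c i ℤ.≤ H i
      c≤H with NE⊎SdE (W.w i)
      ... | inj₁ ne = proj₂ (c-NE i ne)
      ... | inj₂ sd = proj₂ (c-SdE i sd)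

    b-NE : ∀ i → i ≡ M ⊎ SdE (W.w i) → 0ℤ ℤ.≤ e i ℤ.+ W.c i
    b-NE i p = go (e-view i)
      where
      go : ∀ {x} → E-View i x → 0ℤ ℤ.≤ x ℤ.+ W.c i
      go (before-NE lt ne) = contradiction p λ
        { (inj₁ eq) → ℕ.<⇒≢ lt (cong toℕ eq) ; (inj₂ sd) → ¬NE×SdE ne sd }
      go (before-SdE _ sd) = ℤ.+-mono-≤ (ℤ.≤-refl {0ℤ}) (ℤ.≤-trans (ℤ.+≤+ ℕ.z≤n) (proj₁ (c-SdE i sd)))
      go (at refl)         = ℤ.≤-reflexive (sym (trans (ℤ.+-identityˡ _) (c-cs W)))
      go (after-NE lt _)   = ℤ.+-mono-≤ (ℤ.≤-refl {0ℤ}) (ℤ.≤-trans (ℤ.+≤+ ℕ.z≤n) (c>0 i lt))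
      go (after-SdE lt _)  = ℤ.+-monoʳ-≤ -1ℤ (c>0 i lt)

    b-pos : ∀ i → ¬ (i ≡ M ⊎ M Fin.< i × SdE (W.w i)) → 1ℤ ℤ.≤ e i ℤ.+ W.c i
    b-pos i ¬p = go (e-view i)
      where
      go : ∀ {x} → E-View i x → 1ℤ ℤ.≤ x ℤ.+ W.c i
      go (before-NE _ ne)  = ℤ.+-mono-≤ (ℤ.≤-refl {1ℤ}) (proj₁ (c-NE i ne))
      go (before-SdE _ sd) = ℤ.+-mono-≤ (ℤ.≤-refl {0ℤ}) (proj₁ (c-SdE i sd))
      go (at eq)           = contradiction (inj₁ eq) ¬p
      go (after-NE lt _)   = ℤ.+-mono-≤ (ℤ.≤-refl {0ℤ}) (c>0 i lt)
      go (after-SdE lt sd) = contradiction (inj₂ (lt , sd)) ¬p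

    b-SdE : ∀ i → SdE (new i) → 1ℤ ℤ.≤ e i ℤ.+ W.c i
    b-SdE i sd = b-pos i λ
      { (inj₁ eq)        → ¬NE×SdE (new-NE i (inj₁ eq)) sd
      ; (inj₂ (_ , sd′)) → ¬NE×SdE (new-NE i (inj₂ sd′)) sd }

  image : 𝔏 (suc m)
  image = record
    { w = v
    ; h = heights v
    ; c = λ j → e (opposite j) ℤ.+ W.c (opposite j)
    } , record
    { motzkin = record { nonneg = nonneg-v ; closed = closed-v }
    ; h-def   = λ _ → refl
    ; c-NE    = λ j ne → b-NE (opposite j) (kind (opposite j) ne) , le j
    ; c-SdE   = λ j sd → b-SdE (opposite j) sd , le j
    }
    where
    le : ∀ j → e (opposite j) ℤ.+ W.c (opposite j) ℤ.≤ heights v j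
    le j = subst (e (opposite j) ℤ.+ W.c (opposite j) ℤ.≤_) (sym (heights-v j)) (b-le (opposite j))

  private
    at-M : ∀ {i x} → i ≡ M → E-View i x → x ≡ 0ℤ
    at-M refl (before-NE lt _)  = contradiction refl (ℕ.<⇒≢ lt)
    at-M refl (before-SdE lt _) = refl
    at-M refl (at _)            = refl
    at-M refl (after-NE lt _)   = refl
    at-M refl (after-SdE lt _)  = contradiction refl (ℕ.<⇒≢ lt)

    cs-image : cs image ≡ opposite M
    cs-image = cs-unique image (opposite M)
      (cong₂ ℤ._+_ (at-M (opp-opp M) (e-view (opposite (opposite M))))
                   (trans (cong W.c (opp-opp M)) (c-cs W)))
      max
      where
      max : ∀ j → e (opposite j) ℤ.+ W.c (opposite j) ≡ 0ℤ → j Fin.≤ opposite M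
      max j eq with j Fin.≤? opposite M
      ... | yes le = le
      ... | no ≰ with subst (1ℤ ℤ.≤_) eq (b-pos (opposite j) ¬p)
        where
        lt : opposite j Fin.< M
        lt = opp-<ˡ (ℕ.≰⇒> ≰)
        ¬p : ¬ (opposite j ≡ M ⊎ M Fin.< opposite j × SdE (W.w (opposite j)))
        ¬p (inj₁ eq)       = ℕ.<⇒≢ lt (cong toℕ eq)
        ¬p (inj₂ (gt , _)) = ℕ.<-asym lt gt
      ... | ℤ.+≤+ ()

    heights-image : ∀ j {x} → e (opposite j) ≡ x → heights v j ≡ W.h (opposite j) ℤ.+ x
    heights-image j refl = trans (heights-v j) (cong (ℤ._+ e (opposite j)) (sym (W.h-def (opposite j))))

  image-spec : ξSpec W image
  image-spec = record
    { cs-eq   = cs-image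
    ; NE⇔SdE  = λ j j≢ → mk⇔ (λ ne → to j j≢ (kind (opposite j) ne)) (λ sd → new-NE (opposite j) (inj₂ sd))
    ; h-above = λ j lt sd → heights-image j (above (opp-<ˡ lt) sd (e-view (opposite j)))
    ; h-below = λ j lt ne → heights-image j (below (opp-<ʳ lt) ne (e-view (opposite j)))
    ; h-other = λ j ¬a ¬b → trans (heights-image j (other j ¬a ¬b (e-view (opposite j)))) (ℤ.+-identityʳ _)
    ; c-eq    = λ j → cong (ℤ._+ W.c (opposite j))
        (trans (lemma (W.h (opposite j)) (e (opposite j))) (cong (ℤ._- W.h (opposite j)) (sym (heights-image j refl))))
    }
    where
    lemma : ∀ a x → x ≡ a ℤ.+ x ℤ.- a
    lemma = ℤ-Solver.solve-∀
    to : ∀ j → j ≢ opposite M → opposite j ≡ M ⊎ SdE (W.w (opposite j)) → SdE (W.w (opposite j))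
    to j j≢ (inj₁ eq) = contradiction (trans (sym (opp-opp j)) (cong opposite eq)) j≢
    to j j≢ (inj₂ sd) = sd
    above : ∀ {i x} → i Fin.< M → SdE (new i) → E-View i x → x ≡ 1ℤ
    above lt sd (before-NE _ _)     = refl
    above lt sd (before-SdE _ sd′)  = contradiction sd (¬NE×SdE (new-NE _ (inj₂ sd′)))
    above lt sd (at eq)             = contradiction (cong toℕ eq) (ℕ.<⇒≢ lt)
    above lt sd (after-NE gt _)     = contradiction gt (ℕ.<-asym lt)
    above lt sd (after-SdE gt _)    = contradiction gt (ℕ.<-asym lt)
    below : ∀ {i x} → M Fin.< i → NE (new i) → E-View i x → x ≡ -1ℤ
    below gt ne (before-NE lt _)    = contradiction gt (ℕ.<-asym lt)
    below gt ne (before-SdE lt _)   = contradiction gt (ℕ.<-asym lt)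
    below gt ne (at eq)             = contradiction (cong toℕ (sym eq)) (ℕ.<⇒≢ gt)
    below gt ne (after-NE _ ne′)    =
      contradiction (new-SdE _ (λ eq → ℕ.<⇒≢ gt (cong toℕ (sym eq))) ne′) (¬NE×SdE ne)
    below gt ne (after-SdE _ _)     = refl
    other : ∀ j → ¬ (opposite M Fin.< j × SdE (v j)) → ¬ (j Fin.< opposite M × NE (v j)) →
            ∀ {x} → E-View (opposite j) x → x ≡ 0ℤ
    other j ¬a ¬b (before-NE lt ne) =
      contradiction (opp-<ˡ lt , new-SdE _ (λ eq → ℕ.<⇒≢ lt (cong toℕ eq)) ne) ¬a
    other j ¬a ¬b (before-SdE _ _)  = refl
    other j ¬a ¬b (at _)            = refl
    other j ¬a ¬b (after-NE _ _)    = refl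
    other j ¬a ¬b (after-SdE gt sd) = contradiction (opp-<ʳ gt , new-NE _ (inj₂ sd)) ¬b

∃!ξ : ∃ λ (ξ : 𝔏 (suc m) → 𝔏 (suc m)) → Isξ ξ × (∀ ξ′ → Isξ ξ′ → ∀ W → ξ W ≈ ξ′ W)
∃!ξ = image
    , record { involutive = λ W → ξSpec-unique (image-spec (image W)) (ξSpec-sym (image-spec W))
             ; spec = image-spec }
    , λ ξ′ isξ′ W → ξSpec-unique (image-spec W) (Isξ.spec isξ′ W)
  where open ξConstruction

ξ : 𝔏 (suc m) → 𝔏 (suc m)
ξ = proj₁ ∃!ξ
module _ {n : ℕ} where

  module _ (V : Fin n → Set) {P : Fin n → Set} (P? : Decidable P) where

    code : Permutation′ n → Fin n → ℕ
    code π v = # (λ j → P? j ×-dec (j Fin.<? π ⟨$⟩ˡ v) ×-dec (v Fin.<? π ⟨$⟩ʳ j))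

    record Maps (π : Permutation′ n) : Set where
      field
        V⇒P : ∀ {v} → V v → P (π ⟨$⟩ˡ v)
        P⇒V : ∀ {j} → P j → V (π ⟨$⟩ʳ j)

    private
      half : ∀ π σ → Maps π → Maps σ → ∀ v → V v →
             (∀ {v′} → v′ Fin.< v → V v′ → π ⟨$⟩ˡ v′ ≡ σ ⟨$⟩ˡ v′) →
             π ⟨$⟩ˡ v Fin.< σ ⟨$⟩ˡ v → code π v ℕ.< code σ v
      half π σ mπ mσ v Vv ih x<y = #-strict
        (λ j → P? j ×-dec (j Fin.<? x) ×-dec (v Fin.<? π ⟨$⟩ʳ j))
        (λ j → P? j ×-dec (j Fin.<? y) ×-dec (v Fin.<? σ ⟨$⟩ʳ j))
        (λ j (Pj , j<x , v<) → Pj , Fin.<-trans j<x x<y , larger j Pj (Fin.<-trans j<x x<y) (ℕ.<⇒≤ v<))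
        x
        (Maps.V⇒P mπ Vv , x<y , larger x (Maps.V⇒P mπ Vv) x<y (ℕ.≤-reflexive (cong toℕ (sym (Perm.inverseʳ π)))))
        (λ (_ , x<x , _) → ℕ.<-irrefl refl x<x)
        where
        x = π ⟨$⟩ˡ v
        y = σ ⟨$⟩ˡ v
        larger : ∀ j → P j → j Fin.< y → v Fin.≤ π ⟨$⟩ʳ j → v Fin.< σ ⟨$⟩ʳ j
        larger j Pj j<y v≤ with Fin.<-cmp v (σ ⟨$⟩ʳ j)
        ... | tri< lt _ _ = lt
        ... | tri≈ _ eq _ = contradiction (trans (cong (σ ⟨$⟩ˡ_) eq) (Perm.inverseˡ σ)) (Fin.<⇒≢ j<y ∘ sym)
        ... | tri> _ _ gt = contradiction (subst (Fin._< v) (sym πj≡σj) gt) (ℕ.≤⇒≯ v≤)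
          where
          πj≡σj : π ⟨$⟩ʳ j ≡ σ ⟨$⟩ʳ j
          πj≡σj = trans (cong (π ⟨$⟩ʳ_) (sym (trans (ih gt (Maps.P⇒V mσ Pj)) (Perm.inverseˡ σ)))) (Perm.inverseʳ π)

    code-injective : ∀ π σ → Maps π → Maps σ → (∀ v → V v → code π v ≡ code σ v) →
                     ∀ v → V v → π ⟨$⟩ˡ v ≡ σ ⟨$⟩ˡ v
    code-injective π σ mπ mσ eq v = go v (<-wellFounded v)
      where
      go : ∀ v → Acc Fin._<_ v → V v → π ⟨$⟩ˡ v ≡ σ ⟨$⟩ˡ v
      go v (acc rs) Vv with Fin.<-cmp (π ⟨$⟩ˡ v) (σ ⟨$⟩ˡ v)
      ... | tri≈ _ x≡y _ = x≡y
      ... | tri< x<y _ _ = contradiction (eq v Vv)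
        (ℕ.<⇒≢ (half π σ mπ mσ v Vv (λ lt Vv′ → go _ (rs lt) Vv′) x<y))
      ... | tri> _ _ y<x = contradiction (sym (eq v Vv))
        (ℕ.<⇒≢ (half σ π mσ mπ v Vv (λ lt Vv′ → sym (go _ (rs lt) Vv′)) y<x))

conj : Permutation′ n → Permutation′ n
conj π = Perm.reverse ∘ₚ π ∘ₚ Perm.reverse

opp-injective : {i j : Fin n} → opposite i ≡ opposite j → i ≡ j
opp-injective eq = trans (sym (opp-opp _)) (opp-≡ eq)

SdE-χ : ∀ {a} → SdE a → χ (SdE? a) ≡ 1
SdE-χ {a} sd = χ-yes (SdE? a) sd

NE-χ : ∀ {a} → NE a → χ (SdE? a) ≡ 0
NE-χ {a} ne = χ-no (SdE? a) (¬NE×SdE ne)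

module _ (π : Permutation′ n) where

  private
    p q : Fin n → Fin n
    p = π ⟨$⟩ʳ_
    q = π ⟨$⟩ˡ_

  exc : Fin n → Set
  exc i = q i Fin.< i

  exc? : Decidable exc
  exc? i = q i Fin.<? i

  exc⇒SdE : ∀ i → exc i → SdE (wFZ π i)
  exc⇒SdE i lt with NE⊎SdE (wFZ π i)
  ... | inj₁ ne = contradiction lt (NE⇒¬q< π ne)
  ... | inj₂ sd = sd

  ¬exc⇒NE : ∀ i → ¬ exc i → NE (wFZ π i)
  ¬exc⇒NE i ¬lt with NE⊎SdE (wFZ π i)
  ... | inj₁ ne = ne
  ... | inj₂ sd = contradiction (SdE⇒q< π sd) ¬lt

  Ep⇒exc : ∀ {j} → Ep π j → exc (p j)
  Ep⇒exc {j} = subst (Fin._< p j) (sym (Perm.inverseˡ π))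

  ¬Ep⇒¬exc : ∀ {j} → ¬ Ep π j → ¬ exc (p j)
  ¬Ep⇒¬exc {j} ¬e lt = ¬e (subst (Fin._< p j) (Perm.inverseˡ π) lt)

  side-code : ∀ i → exc i → sideNumber π (q i) ≡ code exc (Ep? π) π i
  side-code i lt = trans (side-Ep π (Ep-q π lt)) (#-cong
    (λ j → Ep? π j ×-dec (j Fin.<? q i) ×-dec (p (q i) Fin.<? p j))
    (λ j → Ep? π j ×-dec (j Fin.<? q i) ×-dec (i Fin.<? p j))
    (λ j (a , b , x) → a , b , subst (Fin._< p j) (Perm.inverseʳ π) x)
    (λ j (a , b , x) → a , b , subst (Fin._< p j) (sym (Perm.inverseʳ π)) x))

  ¬Ep°? : Decidable (λ j → ¬ Ep π (opposite j))
  ¬Ep°? j = ¬? (Ep? π (opposite j))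

  ¬exc° : Fin n → Set
  ¬exc° i = ¬ exc (opposite i)

  side-code° : ∀ i → ¬ exc i → sideNumber π (q i) ≡ code ¬exc° ¬Ep°? (conj π) (opposite i)
  side-code° i ¬lt = trans (side-¬Ep π (¬Ep-q π ¬lt)) (trans
    (#-perm (λ j → ¬? (Ep? π j) ×-dec (q i Fin.<? j) ×-dec (p j Fin.<? p (q i))) Perm.reverse)
    (#-cong
      (λ j → ¬? (Ep? π (opposite j)) ×-dec (q i Fin.<? opposite j) ×-dec (p (opposite j) Fin.<? p (q i)))
      (λ j → ¬Ep°? j ×-dec (j Fin.<? conj π ⟨$⟩ˡ opposite i) ×-dec (opposite i Fin.<? conj π ⟨$⟩ʳ j))
      (λ j (a , b , x) → a , subst (λ k → j Fin.< opposite (q k)) (sym (opp-opp i)) (opp-<ʳ b)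
                           , opp-< (subst (p (opposite j) Fin.<_) (Perm.inverseʳ π) x))
      (λ j (a , b , x) → a , opp-<ʳ (subst (λ k → j Fin.< opposite (q k)) (opp-opp i) b)
                           , subst (p (opposite j) Fin.<_) (trans (opp-opp i) (sym (Perm.inverseʳ π))) (opp-<ʳ x))))

module _ {π σ : Permutation′ n} (eq : Φ-FZ π ≈ Φ-FZ σ) where

  private
    w-eq = _≋_.w≗ eq

    exc⇒ : ∀ {π σ : Permutation′ n} → (∀ i → wFZ π i ≡ wFZ σ i) → ∀ {i} → exc π i → exc σ i
    exc⇒ {π} {σ} w-eq {i} lt = SdE⇒q< σ (subst SdE (w-eq i) (exc⇒SdE π i lt))

    Ep⇒ : ∀ {π σ : Permutation′ n} → (∀ i → wFZ π i ≡ wFZ σ i) → ∀ {i} → Ep π i → Ep σ i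
    Ep⇒ {π} {σ} w-eq {i} lt with wFZ π i | w-eq i | stepFZ π i
    ... | _ | e | isN _ _   = isEp (subst (StepFZ σ i) (sym e) (stepFZ σ i))
      where
      isEp : StepFZ σ i N → Ep σ i
      isEp (isN a _) = a
    ... | _ | e | isdE _ _  = isEp (subst (StepFZ σ i) (sym e) (stepFZ σ i))
      where
      isEp : StepFZ σ i dE → Ep σ i
      isEp (isdE a _) = a
    ... | _ | _ | isS ¬lt _ = contradiction lt ¬lt
    ... | _ | _ | isE ¬lt _ = contradiction lt ¬lt

    side-eq : ∀ i → sideNumber π (π ⟨$⟩ˡ i) ≡ sideNumber σ (σ ⟨$⟩ˡ i)
    side-eq i = ℕ.+-cancelʳ-≡ (χ (SdE? (wFZ π i))) _ _
      (trans (ℤ.+-injective (_≋_.c≗ eq i)) (cong (λ a → sideNumber σ (σ ⟨$⟩ˡ i) ℕ.+ χ (SdE? a)) (sym (w-eq i))))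

    πσ = exc⇒ {π} {σ} w-eq
    σπ = exc⇒ {σ} {π} (sym ∘ w-eq)
    πσE = Ep⇒ {π} {σ} w-eq
    σπE = Ep⇒ {σ} {π} (sym ∘ w-eq)

    on-exc : ∀ i → exc π i → π ⟨$⟩ˡ i ≡ σ ⟨$⟩ˡ i
    on-exc = code-injective (exc π) (Ep? π) π σ
      (record { V⇒P = Ep-q π ; P⇒V = Ep⇒exc π })
      (record { V⇒P = σπE ∘ Ep-q σ ∘ πσ ; P⇒V = σπ ∘ Ep⇒exc σ ∘ πσE })
      (λ i e → trans (sym (side-code π i e)) (trans (side-eq i) (trans (side-code σ i (πσ e)) (#-cong
        (λ j → Ep? σ j ×-dec (j Fin.<? σ ⟨$⟩ˡ i) ×-dec (i Fin.<? σ ⟨$⟩ʳ j))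
        (λ j → Ep? π j ×-dec (j Fin.<? σ ⟨$⟩ˡ i) ×-dec (i Fin.<? σ ⟨$⟩ʳ j))
        (λ j (a , b) → σπE a , b) (λ j (a , b) → πσE a , b)))))

    off-exc° : ∀ i → ¬exc° π i → conj π ⟨$⟩ˡ i ≡ conj σ ⟨$⟩ˡ i
    off-exc° = code-injective (¬exc° π) (¬Ep°? π) (conj π) (conj σ)
      (record { V⇒P = V⇒P π ; P⇒V = P⇒V π })
      (record { V⇒P = λ ¬e → V⇒P σ (¬e ∘ σπ) ∘ πσE ; P⇒V = λ ¬e → P⇒V σ (¬e ∘ σπE) ∘ πσ })
      (λ i ¬e → trans (sym (code° π i ¬e)) (trans (side-eq (opposite i)) (trans (code° σ i (¬e ∘ σπ)) (#-cong
        (λ j → ¬Ep°? σ j ×-dec (j Fin.<? conj σ ⟨$⟩ˡ i) ×-dec (i Fin.<? conj σ ⟨$⟩ʳ j))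
        (λ j → ¬Ep°? π j ×-dec (j Fin.<? conj σ ⟨$⟩ˡ i) ×-dec (i Fin.<? conj σ ⟨$⟩ʳ j))
        (λ j (a , b) → a ∘ πσE , b) (λ j (a , b) → a ∘ σπE , b)))))
      where
      V⇒P : ∀ π {v} → ¬exc° π v → ¬ Ep π (opposite (conj π ⟨$⟩ˡ v))
      V⇒P π {v} ¬e = subst (λ k → ¬ Ep π k) (sym (opp-opp _)) (¬Ep-q π ¬e)
      P⇒V : ∀ π {j} → ¬ Ep π (opposite j) → ¬exc° π (conj π ⟨$⟩ʳ j)
      P⇒V π {j} ¬e = subst (λ k → ¬ exc π k) (sym (opp-opp _)) (¬Ep⇒¬exc π ¬e)
      code° : ∀ π i → ¬exc° π i → sideNumber π (π ⟨$⟩ˡ opposite i) ≡ code (¬exc° π) (¬Ep°? π) (conj π) i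
      code° π i ¬e = trans (side-code° π (opposite i) ¬e) (cong (code (¬exc° π) (¬Ep°? π) (conj π)) (opp-opp i))

    inverse-eq : ∀ i → π ⟨$⟩ˡ i ≡ σ ⟨$⟩ˡ i
    inverse-eq i with exc? π i
    ... | yes e = on-exc i e
    ... | no ¬e = subst (λ k → π ⟨$⟩ˡ k ≡ σ ⟨$⟩ˡ k) (opp-opp i)
      (opp-injective (off-exc° (opposite i) (subst (λ k → ¬ exc π k) (sym (opp-opp i)) ¬e)))

  Φ-FZ-injective : π Perm.≈ σ
  Φ-FZ-injective i = begin
    π ⟨$⟩ʳ i                         ≡⟨ Perm.inverseʳ σ ⟨
    σ ⟨$⟩ʳ (σ ⟨$⟩ˡ (π ⟨$⟩ʳ i))       ≡⟨ cong (σ ⟨$⟩ʳ_) (inverse-eq (π ⟨$⟩ʳ i)) ⟨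
    σ ⟨$⟩ʳ (π ⟨$⟩ˡ (π ⟨$⟩ʳ i))       ≡⟨ cong (σ ⟨$⟩ʳ_) (Perm.inverseˡ π) ⟩
    σ ⟨$⟩ʳ i                         ∎
    where open ≡-Reasoning

module _ {π σ : Permutation′ n} (eq : π Perm.≈ σ) where

  private
    p = π ⟨$⟩ʳ_
    q = π ⟨$⟩ˡ_

  inverse-cong : ∀ i → π ⟨$⟩ˡ i ≡ σ ⟨$⟩ˡ i
  inverse-cong i = begin
    π ⟨$⟩ˡ i                        ≡⟨ Perm.inverseˡ σ ⟨
    σ ⟨$⟩ˡ (σ ⟨$⟩ʳ (π ⟨$⟩ˡ i))      ≡⟨ cong (σ ⟨$⟩ˡ_) (eq (π ⟨$⟩ˡ i)) ⟨
    σ ⟨$⟩ˡ (π ⟨$⟩ʳ (π ⟨$⟩ˡ i))      ≡⟨ cong (σ ⟨$⟩ˡ_) (Perm.inverseʳ π) ⟩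
    σ ⟨$⟩ˡ i                        ∎
    where open ≡-Reasoning

  wFZ-cong : ∀ i → wFZ π i ≡ wFZ σ i
  wFZ-cong i rewrite eq i | inverse-cong i = refl

  side-cong : ∀ i → sideNumber π i ≡ sideNumber σ i
  side-cong i with i Fin.<? π ⟨$⟩ʳ i
  ... | yes e = trans (side-Ep π e) (trans (#-cong
      (λ j → Ep? π j ×-dec (j Fin.<? i) ×-dec (π ⟨$⟩ʳ i Fin.<? π ⟨$⟩ʳ j))
      (λ j → Ep? σ j ×-dec (j Fin.<? i) ×-dec (σ ⟨$⟩ʳ i Fin.<? σ ⟨$⟩ʳ j))
      (λ j (a , b , x) → subst (j Fin.<_) (eq j) a , b , <-resp (eq i) (eq j) x)
      (λ j (a , b , x) → subst (j Fin.<_) (sym (eq j)) a , b , <-resp (sym (eq i)) (sym (eq j)) x))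
    (sym (side-Ep σ (subst (i Fin.<_) (eq i) e))))
    where
    <-resp : {a b c d : Fin n} → a ≡ b → c ≡ d → a Fin.< c → b Fin.< d
    <-resp refl refl lt = lt
  ... | no ¬e = trans (side-¬Ep π ¬e) (trans (#-cong
      (λ j → ¬? (Ep? π j) ×-dec (i Fin.<? j) ×-dec (π ⟨$⟩ʳ j Fin.<? π ⟨$⟩ʳ i))
      (λ j → ¬? (Ep? σ j) ×-dec (i Fin.<? j) ×-dec (σ ⟨$⟩ʳ j Fin.<? σ ⟨$⟩ʳ i))
      (λ j (a , b , x) → subst (λ k → ¬ j Fin.< k) (eq j) a , b , <-resp (eq j) (eq i) x)
      (λ j (a , b , x) → subst (λ k → ¬ j Fin.< k) (sym (eq j)) a , b , <-resp (sym (eq j)) (sym (eq i)) x))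
    (sym (side-¬Ep σ (subst (λ k → ¬ i Fin.< k) (eq i) ¬e))))
    where
    <-resp : {a b c d : Fin n} → a ≡ b → c ≡ d → a Fin.< c → b Fin.< d
    <-resp refl refl lt = lt

  Φ-FZ-cong : Φ-FZ π ≈ Φ-FZ σ
  Φ-FZ-cong = record
    { w≗ = wFZ-cong
    ; h≗ = λ i → height-cong wFZ-cong (toℕ i)
    ; c≗ = λ i → cong +_ (cong₂ ℕ._+_
        (trans (cong (sideNumber π) (inverse-cong i)) (side-cong (σ ⟨$⟩ˡ i)))
        (cong (λ a → χ (SdE? a)) (wFZ-cong i)))
    }

select : {P : Fin n → Set} (P? : Decidable P) (r : ℕ) → r ℕ.< # P? →
         ∃ λ x → P x × # (λ j → P? j ×-dec (j Fin.<? x)) ≡ r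
select {suc n} P? r r<# with P? zero
select {suc n} P? zero r<# | yes p = zero , p , #-none (λ j → P? (suc j) ×-dec (suc j Fin.<? zero {n})) (λ _ ())
select {suc n} P? (suc r) r<# | yes p =
  let x , Px , rank = select (P? ∘ suc) r (ℕ.s≤s⁻¹ r<#) in
  suc x , Px , cong suc
    (trans (#-cong (λ j → P? (suc j) ×-dec (suc j Fin.<? suc x)) (λ j → P? (suc j) ×-dec (j Fin.<? x))
       (λ _ (a , b) → a , ℕ.s<s⁻¹ b) (λ _ (a , b) → a , ℕ.s<s b)) rank)
select {suc n} P? r r<# | no ¬p =
  let x , Px , rank = select (P? ∘ suc) r r<# in
  suc x , Px , 
    trans (#-cong (λ j → P? (suc j) ×-dec (suc j Fin.<? suc x)) (λ j → P? (suc j) ×-dec (j Fin.<? x))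
       (λ _ (a , b) → a , ℕ.s<s⁻¹ b) (λ _ (a , b) → a , ℕ.s<s b)) rank

module Decode {n} {V P : Fin n → Set} (V? : Decidable V) (P? : Decidable P)
  {Q : Fin n → Fin n → Set} (Q? : ∀ v → Decidable (Q v))
  (Q-down : ∀ {v i j} → i Fin.< j → Q v j → Q v i)
  (r : Fin n → ℕ)
  (room : ∀ v → V v → r v ℕ.+ # (λ v′ → (v′ Fin.<? v) ×-dec V? v′) ℕ.< # (λ j → P? j ×-dec Q? v j))
  where

  Used : (Fin n → Fin n) → Fin n → Fin n → Set
  Used f v j = ∃ λ v′ → j ≡ f v′ × v′ Fin.< v × V v′

  Used? : ∀ f v → Decidable (Used f v)
  Used? f v j = Fin.any? (λ v′ → (j Fin.≟ f v′) ×-dec (v′ Fin.<? v) ×-dec V? v′)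

  record Good (f : Fin n → Fin n) (v : Fin n) : Set where
    field
      inP  : P (f v)
      inQ  : Q v (f v)
      new  : ¬ Used f v (f v)
      rank : # (λ j → (P? j ×-dec ¬? (Used? f v j)) ×-dec (j Fin.<? f v)) ≡ r v

  private
    choose : ∀ f v → V v → ∃ λ x → P x × Q v x × ¬ Used f v x ×
             # (λ j → (P? j ×-dec ¬? (Used? f v j)) ×-dec (j Fin.<? x)) ≡ r v
    choose f v Vv =
      let x , ((Px , Qx) , ¬U) , rank = select free? (r v) enough in
      x , Px , Qx , ¬U , trans
        (#-cong (λ j → (P? j ×-dec ¬? (Used? f v j)) ×-dec (j Fin.<? x)) (λ j → free? j ×-dec (j Fin.<? x))
          (λ j ((a , b) , lt) → ((a , Q-down lt Qx) , b) , lt)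
          (λ j (((a , _) , b) , lt) → (a , b) , lt))
        rank
      where
      open ℕ.≤-Reasoning
      PQ? = λ j → P? j ×-dec Q? v j
      free? = λ j → PQ? j ×-dec ¬? (Used? f v j)
      used? = λ j → PQ? j ×-dec Used? f v j
      below? = λ v′ → (v′ Fin.<? v) ×-dec V? v′
      splitU : ∀ j → P j × Q v j → ((P j × Q v j) × Used f v j) ⊎ ((P j × Q v j) × ¬ Used f v j)
      splitU j pq with Used? f v j
      ... | yes u = inj₁ (pq , u)
      ... | no ¬u = inj₂ (pq , ¬u)
      enough : r v ℕ.< # free?
      enough = ℕ.+-cancelʳ-< (# below?) (r v) (# free?) (begin-strict
        r v ℕ.+ # below?          <⟨ room v Vv ⟩
        # PQ?                     ≡⟨ #-split PQ? used? free? splitU (λ j (a , u) → a , λ (_ , ¬u) → ¬u u) (λ _ → proj₁) ⟩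
        # used? ℕ.+ # free?       ≤⟨ ℕ.+-monoˡ-≤ (# free?) (#-image used? below? f (λ j → proj₂)) ⟩
        # below? ℕ.+ # free?      ≡⟨ ℕ.+-comm (# below?) (# free?) ⟩
        # free? ℕ.+ # below?      ∎)

    Good-resp : ∀ {f g v} → (∀ i → i Fin.≤ v → f i ≡ g i) → Good f v → Good g v
    Good-resp {f} {g} {v} eq good = record
      { inP  = subst P eqv inP
      ; inQ  = subst (Q v) eqv inQ
      ; new  = λ u → new (subst (Used f v) (sym eqv) (used⇐ _ u))
      ; rank = trans (#-cong
          (λ j → (P? j ×-dec ¬? (Used? g v j)) ×-dec (j Fin.<? g v))
          (λ j → (P? j ×-dec ¬? (Used? f v j)) ×-dec (j Fin.<? f v))
          (λ j ((a , b) , lt) → (a , b ∘ used⇒ j) , subst (j Fin.<_) (sym eqv) lt)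
          (λ j ((a , b) , lt) → (a , b ∘ used⇐ j) , subst (j Fin.<_) eqv lt)) rank
      }
      where
      open Good good
      eqv = eq v ℕ.≤-refl
      used⇒ : ∀ j → Used f v j → Used g v j
      used⇒ j (v′ , e , lt , Vv′) = v′ , trans e (eq v′ (ℕ.<⇒≤ lt)) , lt , Vv′
      used⇐ : ∀ j → Used g v j → Used f v j
      used⇐ j (v′ , e , lt , Vv′) = v′ , trans e (sym (eq v′ (ℕ.<⇒≤ lt))) , lt , Vv′

    build : ∀ k → k ℕ.≤ n → ∃ λ f → ∀ v → toℕ v ℕ.< k → V v → Good f v
    build zero    _  = (λ i → i) , λ _ ()
    build (suc k) k< with build k (ℕ.<⇒≤ k<) | V? (Fin.fromℕ< k<)
    ... | f , good | no ¬V = f , good′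
      where
      good′ : ∀ v → toℕ v ℕ.< suc k → V v → Good f v
      good′ v v<1+k Vv with ℕ.m≤n⇒m<n∨m≡n (ℕ.s≤s⁻¹ v<1+k)
      ... | inj₁ v<k = good v v<k Vv
      ... | inj₂ v≡k = contradiction (subst V (Fin.toℕ-injective (trans v≡k (sym (Fin.toℕ-fromℕ< k<)))) Vv) ¬V
    ... | f , good | yes Vu with choose f (Fin.fromℕ< k<) Vu
    ... | x , Px , Qx , ¬U , rank = g , good′
      where
      u = Fin.fromℕ< k<
      g : Fin n → Fin n
      g i with i Fin.≟ u
      ... | yes _ = x
      ... | no _  = f i
      g-u : g u ≡ x
      g-u with u Fin.≟ u
      ... | yes _ = refl
      ... | no ¬p = contradiction refl ¬p
      g-other : ∀ i → i ≢ u → f i ≡ g i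
      g-other i i≢u with i Fin.≟ u
      ... | yes p = contradiction p i≢u
      ... | no _  = refl
      <u : ∀ {i} → toℕ i ℕ.< k → i ≢ u
      <u i<k refl = ℕ.<⇒≢ i<k (Fin.toℕ-fromℕ< k<)
      used⇒ : ∀ j → Used f u j → Used g u j
      used⇒ j (v′ , e , lt , Vv′) = v′ , trans e (g-other v′ (Fin.<⇒≢ lt)) , lt , Vv′
      used⇐ : ∀ j → Used g u j → Used f u j
      used⇐ j (v′ , e , lt , Vv′) = v′ , trans e (sym (g-other v′ (Fin.<⇒≢ lt))) , lt , Vv′
      good-u : Good g u
      good-u = record
        { inP  = subst P (sym g-u) Px
        ; inQ  = subst (Q u) (sym g-u) Qx
        ; new  = λ us → ¬U (subst (Used f u) g-u (used⇐ _ us))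
        ; rank = trans (#-cong
            (λ j → (P? j ×-dec ¬? (Used? g u j)) ×-dec (j Fin.<? g u))
            (λ j → (P? j ×-dec ¬? (Used? f u j)) ×-dec (j Fin.<? x))
            (λ j ((a , b) , lt) → (a , b ∘ used⇒ j) , subst (j Fin.<_) g-u lt)
            (λ j ((a , b) , lt) → (a , b ∘ used⇐ j) , subst (j Fin.<_) (sym g-u) lt)) rank
        }
      good′ : ∀ v → toℕ v ℕ.< suc k → V v → Good g v
      good′ v v<1+k Vv with ℕ.m≤n⇒m<n∨m≡n (ℕ.s≤s⁻¹ v<1+k)
      ... | inj₁ v<k = Good-resp (λ i i≤v → g-other i (<u (ℕ.≤-<-trans i≤v v<k))) (good v v<k Vv)
      ... | inj₂ v≡k with refl ← Fin.toℕ-injective (trans v≡k (sym (Fin.toℕ-fromℕ< k<))) = good-u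

  decoded : ∃ λ f → ∀ v → V v → Good f v
  decoded = let f , good = build n ℕ.≤-refl in f , λ v → good v (Fin.toℕ<n v)

injective⇒permutation : (f : Fin n → Fin n) → Injective _≡_ _≡_ f →
                        ∃ λ (π : Permutation′ n) → ∀ i → π ⟨$⟩ˡ i ≡ f i
injective⇒permutation {n} f inj =
  Perm.permutation g f (λ i → inj (proj₂ (surj (f i)))) (λ j → proj₂ (surj j)) , λ _ → refl
  where
  surjective : ∀ {n} (f : Fin n → Fin n) → Injective _≡_ _≡_ f → ∀ j → ∃ λ i → f i ≡ j
  surjective {suc n} f inj j with Fin.any? (λ i → f i Fin.≟ j)
  ... | yes p = p
  ... | no ¬p = contradiction
    (λ {x} {y} eq → inj (Fin.punchOut-injective (missed x) (missed y) eq))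
    (Fin.<⇒notInjective {f = λ i → Fin.punchOut (missed i)} (ℕ.n<1+n n))
    where
    missed : ∀ i → j ≢ f i
    missed i eq = ¬p (i , sym eq)
  surj = surjective f inj
  g = proj₁ ∘ surj

module FZ-Preimage (W : 𝔏 n) where

  private
    module W = 𝔏 W

    a≢b : ∀ {a b x : Step} → a ≢ b → x ≡ a → ¬ x ≡ b
    a≢b ne refl eq = ne eq

    count-⊎ : {R : Fin n → Set} (R? : Decidable R) (a b : Step) → a ≢ b →
              # (λ j → R? j ×-dec ((W.w j ≟ a) ⊎-dec (W.w j ≟ b)))
              ≡ # (λ j → R? j ×-dec (W.w j ≟ a)) ℕ.+ # (λ j → R? j ×-dec (W.w j ≟ b))
    count-⊎ {R} R? a b ne = #-split
      (λ j → R? j ×-dec ((W.w j ≟ a) ⊎-dec (W.w j ≟ b)))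
      (λ j → R? j ×-dec (W.w j ≟ a)) (λ j → R? j ×-dec (W.w j ≟ b))
      (λ { j (Rj , inj₁ x) → inj₁ (Rj , x) ; j (Rj , inj₂ y) → inj₂ (Rj , y) })
      (λ j (Rj , x) → (Rj , inj₁ x) , λ (_ , y) → a≢b ne x y)
      (λ j (Rj , y) → Rj , inj₂ y)

    from-k : Step → ℕ → ℕ
    from-k a k = # (λ j → (k ℕ.≤? toℕ j) ×-dec (W.w j ≟ a))

    total : ∀ a k → before a W.w n ≡ before a W.w k ℕ.+ from-k a k
    total a k = trans
      (#-cong (λ j → (toℕ j ℕ.<? n) ×-dec (W.w j ≟ a)) (λ j → W.w j ≟ a) (λ j → proj₂) (λ j x → Fin.toℕ<n j , x))
      (#-split (λ j → W.w j ≟ a) (λ j → (toℕ j ℕ.<? k) ×-dec (W.w j ≟ a)) (λ j → (k ℕ.≤? toℕ j) ×-dec (W.w j ≟ a))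
        split (λ j (lt , x) → x , λ (le , _) → ℕ.<⇒≱ lt le) (λ j → proj₂))
      where
      split : ∀ j → W.w j ≡ a → (toℕ j ℕ.< k × W.w j ≡ a) ⊎ (k ℕ.≤ toℕ j × W.w j ≡ a)
      split j x with toℕ j ℕ.<? k
      ... | yes lt = inj₁ (lt , x)
      ... | no ¬lt = inj₂ (ℕ.≮⇒≥ ¬lt , x)

    before-h : ∀ i {H} → W.h i ≡ + H → before N W.w (toℕ i) ≡ before S W.w (toℕ i) ℕ.+ H
    before-h i {H} eq = difference⁻¹ _ _ H (trans (sym (W.h-def i)) eq)

    from-h : ∀ i {H} → W.h i ≡ + H → from-k S (toℕ i) ≡ from-k N (toℕ i) ℕ.+ H
    from-h i {H} eq = ℕ.+-cancelˡ-≡ (before S W.w k) _ _ (begin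
      before S W.w k ℕ.+ from-k S k             ≡⟨ total S k ⟨
      before S W.w n                            ≡⟨ ℕ.+-identityʳ _ ⟨
      before S W.w n ℕ.+ 0                      ≡⟨ difference⁻¹ (before N W.w n) (before S W.w n) 0 (Is2Motzkin.closed W.motzkin) ⟨
      before N W.w n                            ≡⟨ total N k ⟩
      before N W.w k ℕ.+ from-k N k             ≡⟨ cong (ℕ._+ from-k N k) (before-h i eq) ⟩
      before S W.w k ℕ.+ H ℕ.+ from-k N k       ≡⟨ lemma (before S W.w k) H (from-k N k) ⟩
      before S W.w k ℕ.+ (from-k N k ℕ.+ H)     ∎)
      where
      open ≡-Reasoning
      k = toℕ i
      lemma : ∀ a b c → a ℕ.+ b ℕ.+ c ≡ a ℕ.+ (c ℕ.+ b)
      lemma = ℕ-Solver.solve-∀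

    bounds : ∀ {l x y} → + l ℤ.≤ x × x ℤ.≤ y → ∃ λ X → ∃ λ Y → x ≡ + X × y ≡ + Y × l ℕ.≤ X × X ℕ.≤ Y
    bounds (ℤ.+≤+ p , ℤ.+≤+ q) = _ , _ , refl , refl , p , q

    r₁ r₂ : Fin n → ℕ
    r₁ v = ℤ.∣ W.c v ∣ ℕ.∸ 1
    r₂ v = ℤ.∣ W.c (opposite v) ∣

    V₁? : Decidable (λ v → SdE (W.w v))
    V₁? v = SdE? (W.w v)

    P₁? : Decidable (λ j → NdE (W.w j))
    P₁? j = NdE? (W.w j)

    V₂? : Decidable (λ v → NE (W.w (opposite v)))
    V₂? v = NE? (W.w (opposite v))

    P₂? : Decidable (λ j → ES (W.w (opposite j)))
    P₂? j = ES? (W.w (opposite j))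

    room₁ : ∀ v → SdE (W.w v) →
            r₁ v ℕ.+ # (λ v′ → (v′ Fin.<? v) ×-dec V₁? v′) ℕ.< # (λ j → P₁? j ×-dec (j Fin.<? v))
    room₁ v sd with bounds (W.c-SdE v sd)
    ... | suc X , Y , c≡ , h≡ , _ , X<Y rewrite c≡ = begin-strict
      X ℕ.+ # (λ v′ → (v′ Fin.<? v) ×-dec V₁? v′)       ≡⟨ cong (X ℕ.+_) (count-⊎ (Fin._<? v) S dE (λ ())) ⟩
      X ℕ.+ (bS ℕ.+ bdE)                                <⟨ ℕ.+-monoˡ-< (bS ℕ.+ bdE) X<Y ⟩
      Y ℕ.+ (bS ℕ.+ bdE)                                ≡⟨ lemma Y bS bdE ⟩
      bS ℕ.+ Y ℕ.+ bdE                                  ≡⟨ cong (ℕ._+ bdE) (before-h v h≡) ⟨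
      before N W.w (toℕ v) ℕ.+ bdE                      ≡⟨ count-⊎ (Fin._<? v) N dE (λ ()) ⟨
      # (λ j → (j Fin.<? v) ×-dec NdE? (W.w j))         ≡⟨ #-cong (λ j → (j Fin.<? v) ×-dec P₁? j) (λ j → P₁? j ×-dec (j Fin.<? v))
                                                             (λ j (a , b) → b , a) (λ j (a , b) → b , a) ⟩
      # (λ j → P₁? j ×-dec (j Fin.<? v))                ∎
      where
      open ℕ.≤-Reasoning
      bS  = before S W.w (toℕ v)
      bdE = before dE W.w (toℕ v)
      lemma : ∀ a b c → a ℕ.+ (b ℕ.+ c) ≡ b ℕ.+ a ℕ.+ c
      lemma = ℕ-Solver.solve-∀

    room₂ : ∀ v → NE (W.w (opposite v)) →
            r₂ v ℕ.+ # (λ v′ → (v′ Fin.<? v) ×-dec V₂? v′) ℕ.< # (λ j → P₂? j ×-dec (j Fin.≤? v))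
    room₂ v ne with bounds (W.c-NE (opposite v) ne)
    ... | X , Y , c≡ , h≡ , _ , X≤Y rewrite c≡ = begin-strict
      X ℕ.+ # (λ v′ → (v′ Fin.<? v) ×-dec V₂? v′)
        ≡⟨ cong (X ℕ.+_) (#-perm (λ v′ → (v′ Fin.<? v) ×-dec V₂? v′) Perm.reverse) ⟩
      X ℕ.+ # (λ k → (opposite k Fin.<? v) ×-dec V₂? (opposite k))
        <⟨ ℕ.+-mono-≤-< X≤Y (#-strict
             (λ k → (opposite k Fin.<? v) ×-dec V₂? (opposite k)) (λ k → (i Fin.≤? k) ×-dec NE? (W.w k))
             (λ k (lt , x) → ℕ.<⇒≤ (opp-<ˡ lt) , subst (λ k → NE (W.w k)) (opp-opp k) x)
             i (ℕ.≤-refl , ne)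
             (λ (lt , _) → ℕ.<-irrefl refl (subst (Fin._< v) (opp-opp v) lt))) ⟩
      Y ℕ.+ # (λ k → (i Fin.≤? k) ×-dec NE? (W.w k))
        ≡⟨ cong (Y ℕ.+_) (count-⊎ (i Fin.≤?_) N E (λ ())) ⟩
      Y ℕ.+ (from-k N (toℕ i) ℕ.+ from-k E (toℕ i))
        ≡⟨ lemma Y (from-k N (toℕ i)) (from-k E (toℕ i)) ⟩
      from-k E (toℕ i) ℕ.+ (from-k N (toℕ i) ℕ.+ Y)
        ≡⟨ cong (from-k E (toℕ i) ℕ.+_) (from-h i h≡) ⟨
      from-k E (toℕ i) ℕ.+ from-k S (toℕ i)
        ≡⟨ count-⊎ (i Fin.≤?_) E S (λ ()) ⟨
      # (λ k → (i Fin.≤? k) ×-dec ES? (W.w k))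
        ≡⟨ #-perm (λ k → (i Fin.≤? k) ×-dec ES? (W.w k)) Perm.reverse ⟩
      # (λ j → (i Fin.≤? opposite j) ×-dec P₂? j)
        ≡⟨ #-cong (λ j → (i Fin.≤? opposite j) ×-dec P₂? j) (λ j → P₂? j ×-dec (j Fin.≤? v))
             (λ j (le , x) → x , subst₂ Fin._≤_ (opp-opp j) (opp-opp v) (opp-≤ le)) (λ j (x , le) → opp-≤ le , x) ⟩
      # (λ j → P₂? j ×-dec (j Fin.≤? v)) ∎
      where
      open ℕ.≤-Reasoning
      i = opposite v
      lemma : ∀ a b c → a ℕ.+ (b ℕ.+ c) ≡ c ℕ.+ (b ℕ.+ a)
      lemma = ℕ-Solver.solve-∀

    module D₁ = Decode V₁? P₁? (λ v j → j Fin.<? v) Fin.<-trans r₁ room₁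
    module D₂ = Decode V₂? P₂? (λ v j → j Fin.≤? v) (λ lt le → ℕ.≤-trans (ℕ.<⇒≤ lt) le) r₂ room₂

    f₁ f₂ : Fin n → Fin n
    f₁ = proj₁ D₁.decoded
    f₂ = proj₁ D₂.decoded

    good₁ : ∀ v → SdE (W.w v) → D₁.Good f₁ v
    good₁ = proj₂ D₁.decoded

    good₂ : ∀ v → NE (W.w (opposite v)) → D₂.Good f₂ v
    good₂ = proj₂ D₂.decoded

    g : Fin n → Fin n
    g i with NE⊎SdE (W.w i)
    ... | inj₁ _ = opposite (f₂ (opposite i))
    ... | inj₂ _ = f₁ i

    g-NE : ∀ i → NE (W.w i) → g i ≡ opposite (f₂ (opposite i))
    g-NE i ne with NE⊎SdE (W.w i)
    ... | inj₁ _  = refl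
    ... | inj₂ sd = contradiction sd (¬NE×SdE ne)

    g-SdE : ∀ i → SdE (W.w i) → g i ≡ f₁ i
    g-SdE i sd with NE⊎SdE (W.w i)
    ... | inj₁ ne = contradiction sd (¬NE×SdE ne)
    ... | inj₂ _  = refl

    NE° : ∀ i → NE (W.w i) → NE (W.w (opposite (opposite i)))
    NE° i = subst (λ k → NE (W.w k)) (sym (opp-opp i))

    g-NdE : ∀ i → SdE (W.w i) → NdE (W.w (g i))
    g-NdE i sd = subst (λ k → NdE (W.w k)) (sym (g-SdE i sd)) (D₁.Good.inP (good₁ i sd))

    g-ES : ∀ i → NE (W.w i) → ES (W.w (g i))
    g-ES i ne = subst (λ k → ES (W.w k)) (sym (g-NE i ne)) (D₂.Good.inP (good₂ (opposite i) (NE° i ne)))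

    g-< : ∀ i → SdE (W.w i) → g i Fin.< i
    g-< i sd = subst (Fin._< i) (sym (g-SdE i sd)) (D₁.Good.inQ (good₁ i sd))

    g-≥ : ∀ i → NE (W.w i) → i Fin.≤ g i
    g-≥ i ne = subst₂ Fin._≤_ (opp-opp i) (sym (g-NE i ne)) (opp-≤ (D₂.Good.inQ (good₂ (opposite i) (NE° i ne))))

    f₁-injective : ∀ {i j} → SdE (W.w i) → SdE (W.w j) → f₁ i ≡ f₁ j → i ≡ j
    f₁-injective {i} {j} a b eq with Fin.<-cmp i j
    ... | tri< lt _ _ = contradiction (i , sym eq , lt , a) (D₁.Good.new (good₁ j b))
    ... | tri≈ _ e _  = e
    ... | tri> _ _ gt = contradiction (j , eq , gt , b) (D₁.Good.new (good₁ i a))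

    f₂-injective : ∀ {i j} → NE (W.w (opposite i)) → NE (W.w (opposite j)) → f₂ i ≡ f₂ j → i ≡ j
    f₂-injective {i} {j} a b eq with Fin.<-cmp i j
    ... | tri< lt _ _ = contradiction (i , sym eq , lt , a) (D₂.Good.new (good₂ j b))
    ... | tri≈ _ e _  = e
    ... | tri> _ _ gt = contradiction (j , eq , gt , b) (D₂.Good.new (good₂ i a))

    g-injective : Injective _≡_ _≡_ g
    g-injective {i} {j} eq with NE⊎SdE (W.w i) | NE⊎SdE (W.w j)
    ... | inj₁ a | inj₁ b = opp-injective (f₂-injective (NE° i a) (NE° j b) (opp-injective eq))
    ... | inj₂ a | inj₂ b = f₁-injective a b eq
    ... | inj₁ a | inj₂ b = contradiction
      (subst (λ k → ES (W.w k)) eq (D₂.Good.inP (good₂ (opposite i) (NE° i a))))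
      (¬NdE×ES (D₁.Good.inP (good₁ j b)))
    ... | inj₂ a | inj₁ b = contradiction
      (subst (λ k → ES (W.w k)) (sym eq) (D₂.Good.inP (good₂ (opposite j) (NE° j b))))
      (¬NdE×ES (D₁.Good.inP (good₁ i a)))

  preimage : Permutation′ n
  preimage = proj₁ (injective⇒permutation g g-injective)

  private
    π = preimage
    p q : Fin n → Fin n
    p = π ⟨$⟩ʳ_
    q = π ⟨$⟩ˡ_

    q≡g : ∀ i → q i ≡ g i
    q≡g = proj₂ (injective⇒permutation g g-injective)

    g-p : ∀ j → g (p j) ≡ j
    g-p j = trans (sym (q≡g (p j))) (Perm.inverseˡ π)

    p-NdE : ∀ j → NdE (W.w j) → SdE (W.w (p j))
    p-NdE j x with NE⊎SdE (W.w (p j))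
    ... | inj₁ ne = contradiction (subst (λ k → ES (W.w k)) (g-p j) (g-ES (p j) ne)) (¬NdE×ES x)
    ... | inj₂ sd = sd

    p-ES : ∀ j → ES (W.w j) → NE (W.w (p j))
    p-ES j x with NE⊎SdE (W.w (p j))
    ... | inj₁ ne = ne
    ... | inj₂ sd = contradiction x (¬NdE×ES (subst (λ k → NdE (W.w k)) (g-p j) (g-NdE (p j) sd)))

    NdE⇒Ep : ∀ j → NdE (W.w j) → Ep π j
    NdE⇒Ep j x = subst (Fin._< p j) (g-p j) (g-< (p j) (p-NdE j x))

    ES⇒¬Ep : ∀ j → ES (W.w j) → ¬ Ep π j
    ES⇒¬Ep j x = ℕ.≤⇒≯ (subst (p j Fin.≤_) (g-p j) (g-≥ (p j) (p-ES j x)))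

    Ep⇒NdE : ∀ j → Ep π j → NdE (W.w j)
    Ep⇒NdE j e with NdE⊎ES (W.w j)
    ... | inj₁ x = x
    ... | inj₂ y = contradiction e (ES⇒¬Ep j y)

    ¬Ep⇒ES : ∀ j → ¬ Ep π j → ES (W.w j)
    ¬Ep⇒ES j ¬e with NdE⊎ES (W.w j)
    ... | inj₁ x = contradiction (NdE⇒Ep j x) ¬e
    ... | inj₂ y = y

    SdE⇒exc : ∀ i → SdE (W.w i) → exc π i
    SdE⇒exc i sd = subst (Fin._< i) (sym (q≡g i)) (g-< i sd)

    NE⇒¬exc : ∀ i → NE (W.w i) → ¬ exc π i
    NE⇒¬exc i ne = ℕ.≤⇒≯ (subst (i Fin.≤_) (sym (q≡g i)) (g-≥ i ne))

    w-eq : ∀ i → wFZ π i ≡ W.w i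
    w-eq i = stepFZ-unique π (stepFZ π i) (go (W.w i) refl)
      where
      go : ∀ a → W.w i ≡ a → StepFZ π i a
      go N  eq = isN  (NdE⇒Ep i (inj₁ eq)) (NE⇒¬exc i (inj₁ eq))
      go S  eq = isS  (ES⇒¬Ep i (inj₂ eq)) (SdE⇒exc i (inj₁ eq))
      go E  eq = isE  (ES⇒¬Ep i (inj₁ eq)) (NE⇒¬exc i (inj₂ eq))
      go dE eq = isdE (NdE⇒Ep i (inj₂ eq)) (SdE⇒exc i (inj₂ eq))

    side₁ : ∀ i → SdE (W.w i) → sideNumber π (q i) ≡ r₁ i
    side₁ i sd = trans (side-code π i (SdE⇒exc i sd)) (trans
      (#-cong
        (λ j → Ep? π j ×-dec (j Fin.<? q i) ×-dec (i Fin.<? p j))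
        (λ j → (P₁? j ×-dec ¬? (D₁.Used? f₁ i j)) ×-dec (j Fin.<? f₁ i))
        (λ j (e , lt , i<) → (Ep⇒NdE j e , unused j i<) , subst (j Fin.<_) q≡f lt)
        (λ j ((x , ¬u) , lt) → NdE⇒Ep j x , subst (j Fin.<_) (sym q≡f) lt , larger j x ¬u lt))
      (D₁.Good.rank (good₁ i sd)))
      where
      q≡f : q i ≡ f₁ i
      q≡f = trans (q≡g i) (g-SdE i sd)
      p-f : ∀ v → SdE (W.w v) → p (f₁ v) ≡ v
      p-f v x = trans (cong p (sym (trans (q≡g v) (g-SdE v x)))) (Perm.inverseʳ π)
      unused : ∀ j → i Fin.< p j → ¬ D₁.Used f₁ i j
      unused _ i< (v′ , refl , lt , x) = ℕ.<-asym lt (subst (i Fin.<_) (p-f v′ x) i<)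
      larger : ∀ j → NdE (W.w j) → ¬ D₁.Used f₁ i j → j Fin.< f₁ i → i Fin.< p j
      larger j x ¬u lt with Fin.<-cmp i (p j)
      ... | tri< i<p _ _ = i<p
      ... | tri≈ _ eq _  = contradiction (trans (sym (Perm.inverseˡ π)) (trans (cong q (sym eq)) q≡f)) (Fin.<⇒≢ lt)
      ... | tri> _ _ p<i = contradiction (p j , trans (sym (g-p j)) (g-SdE (p j) (p-NdE j x)) , p<i , p-NdE j x) ¬u

    side₂ : ∀ i → NE (W.w i) → sideNumber π (q i) ≡ r₂ (opposite i)
    side₂ i ne = trans (side-code° π i (NE⇒¬exc i ne)) (trans
      (#-cong
        (λ j → ¬Ep°? π j ×-dec (j Fin.<? conj π ⟨$⟩ˡ v) ×-dec (v Fin.<? conj π ⟨$⟩ʳ j))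
        (λ j → (P₂? j ×-dec ¬? (D₂.Used? f₂ v j)) ×-dec (j Fin.<? f₂ v))
        (λ j (e , lt , v<) → (¬Ep⇒ES (opposite j) e , unused j v<) , subst (j Fin.<_) (q≡f v NEv) lt)
        (λ j ((x , ¬u) , lt) → ES⇒¬Ep (opposite j) x , subst (j Fin.<_) (sym (q≡f v NEv)) lt , larger j x ¬u lt))
      (D₂.Good.rank (good₂ v NEv)))
      where
      v = opposite i
      NEv = NE° i ne
      q≡f : ∀ v → NE (W.w (opposite v)) → conj π ⟨$⟩ˡ v ≡ f₂ v
      q≡f v x = trans (cong opposite (trans (q≡g (opposite v)) (g-NE (opposite v) x)))
        (trans (opp-opp _) (cong f₂ (opp-opp v)))
      p-f : ∀ v → NE (W.w (opposite v)) → conj π ⟨$⟩ʳ f₂ v ≡ v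
      p-f v x = trans (cong (conj π ⟨$⟩ʳ_) (sym (q≡f v x))) (Perm.inverseʳ (conj π))
      NE-p : ∀ j → ES (W.w (opposite j)) → NE (W.w (opposite (conj π ⟨$⟩ʳ j)))
      NE-p j x = NE° (p (opposite j)) (p-ES (opposite j) x)
      unused : ∀ j → v Fin.< conj π ⟨$⟩ʳ j → ¬ D₂.Used f₂ v j
      unused _ v< (v′ , refl , lt , x) = ℕ.<-asym lt (subst (v Fin.<_) (p-f v′ x) v<)
      larger : ∀ j → ES (W.w (opposite j)) → ¬ D₂.Used f₂ v j → j Fin.< f₂ v → v Fin.< conj π ⟨$⟩ʳ j
      larger j x ¬u lt with Fin.<-cmp v (conj π ⟨$⟩ʳ j)
      ... | tri< v<p _ _ = v<p
      ... | tri≈ _ eq _  = contradiction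
        (trans (sym (Perm.inverseˡ (conj π))) (trans (cong (conj π ⟨$⟩ˡ_) (sym eq)) (q≡f v NEv))) (Fin.<⇒≢ lt)
      ... | tri> _ _ p<v = contradiction
        (conj π ⟨$⟩ʳ j , trans (sym (Perm.inverseˡ (conj π))) (q≡f _ (NE-p j x)) , p<v , NE-p j x) ¬u

    c-NE : ∀ i → NE (W.w i) → + (sideNumber π (q i) ℕ.+ χ (SdE? (wFZ π i))) ≡ W.c i
    c-NE i ne = trans (cong +_ (trans
      (cong₂ ℕ._+_ (trans (side₂ i ne) (cong (λ k → ℤ.∣ W.c k ∣) (opp-opp i)))
                   (trans (cong (λ a → χ (SdE? a)) (w-eq i)) (NE-χ ne)))
      (ℕ.+-identityʳ ℤ.∣ W.c i ∣))) (ℤ.0≤i⇒+∣i∣≡i (proj₁ (W.c-NE i ne)))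

    c-SdE : ∀ i → SdE (W.w i) → + (sideNumber π (q i) ℕ.+ χ (SdE? (wFZ π i))) ≡ W.c i
    c-SdE i sd = trans (cong +_ (cong₂ ℕ._+_ (side₁ i sd) (trans (cong (λ a → χ (SdE? a)) (w-eq i)) (SdE-χ sd))))
      (pred (proj₁ (W.c-SdE i sd)))
      where
      pred : ∀ {x} → 1ℤ ℤ.≤ x → + (ℤ.∣ x ∣ ℕ.∸ 1 ℕ.+ 1) ≡ x
      pred (ℤ.+≤+ 1≤X) = cong +_ (ℕ.m∸n+n≡m 1≤X)

    c-eq : ∀ i → + (sideNumber π (q i) ℕ.+ χ (SdE? (wFZ π i))) ≡ W.c i
    c-eq i = [ c-NE i , c-SdE i ]′ (NE⊎SdE (W.w i))

  Φ-FZ-preimage : Φ-FZ preimage ≈ W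
  Φ-FZ-preimage = record
    { w≗ = w-eq
    ; h≗ = λ i → trans (height-cong w-eq (toℕ i)) (sym (W.h-def i))
    ; c≗ = c-eq
    }

≈-trans : {U V W : 𝔏 n} → U ≈ V → V ≈ W → U ≈ W
≈-trans a b = record
  { w≗ = λ i → trans (_≋_.w≗ a i) (_≋_.w≗ b i)
  ; h≗ = λ i → trans (_≋_.h≗ a i) (_≋_.h≗ b i)
  ; c≗ = λ i → trans (_≋_.c≗ a i) (_≋_.c≗ b i)
  }

Φ-FZ-bijective : Bijective Perm._≈_ _≈_ (Φ-FZ {n})
Φ-FZ-bijective =
    (λ {π} {σ} → Φ-FZ-injective {π = π} {σ})
  , λ W → FZ-Preimage.preimage W , λ {π} eq →
      ≈-trans {U = Φ-FZ π} {Φ-FZ (FZ-Preimage.preimage W)} {W}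
        (Φ-FZ-cong {π = π} {FZ-Preimage.preimage W} eq) (FZ-Preimage.Φ-FZ-preimage W)

Φ-FZ⁻¹ : 𝔏 n → Permutation′ n
Φ-FZ⁻¹ W = proj₁ (proj₂ Φ-FZ-bijective W)

{-# OPTIONS --safe #-}
module Submission where

open import Defs
open import Data.Nat.Base using (ℕ; suc)
open import Data.Fin.Permutation as Perm using (Permutation′)
open import Data.Product.Base using (_×_)
open import Data.Fin.Base as Fin using (Fin; zero; suc; toℕ; fromℕ; inject₁; opposite)
open import Data.Fin.Permutation using (_⟨$⟩ʳ_; _⟨$⟩ˡ_; _∘ₚ_)
import Data.Fin.Properties as Fin
open import Data.Fin.Relation.Unary.Top using (view; ‵fromℕ; ‵inject₁)
open import Data.Integer.Base as ℤ using (ℤ; +_; 0ℤ; 1ℤ)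
import Data.Integer.Properties as ℤ
import Data.Integer.Tactic.RingSolver as ℤ-Solver
import Data.Nat.Base as ℕ
import Data.Nat.Properties as ℕ
import Data.Nat.Tactic.RingSolver as ℕ-Solver
open import Data.Product.Base using (_,_; proj₁; proj₂)
open import Data.Sum.Base using (_⊎_; inj₁; inj₂)
open import Function.Base using (_∘_)
open import Function.Bundles using (mk⇔)
open import Relation.Binary.Definitions using (tri<; tri≈; tri>)
open import Relation.Binary.PropositionalEquality
  using (_≡_; _≢_; refl; sym; trans; cong; cong₂; subst; subst₂; module ≡-Reasoning)
open import Relation.Nullary using (¬_; Dec; yes; no; contradiction)
open import Relation.Nullary.Decidable using (_×-dec_; _⊎-dec_; ¬?)
open import Relation.Unary using (Decidable)

-- Write c for the cycle i ↦ i + 1 (mod n).  Both maps have the form π ↦ ρ ∘ c: for ϰ the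
-- permutation ρ is the inverse of π, and for θ it is the conjugate of π by the reversal;
-- hence θ(π^rci) = ϰ(π).  Passing from ρ to κ = ρ ∘ c only moves the entry ρ(1) from the
-- first position to the last, so the nestings and heights counted at a value i change by at
-- most one, according to whether i < ρ(1) or i > ρ(1).  For ρ = π⁻¹ the threshold ρ(1) is pone(π),
-- and the corrections are those that turn nest into vnest.  For the conjugate of π it is
-- n + 1 - π(n), where π(n) = cs(Φ_FZ(π)), and the corrections are the shifts of heights and
-- labels prescribed for ξ; these determine ξ, and Φ_FZ is injective.

private variable
  n m : ℕ

-- Side numbers and heights as counts over the graph of a permutation.

-- Serves to set aside one exceptional index when a count is split; `P` does not vary with `j`, so
-- the count is `χ P?`.
at? : (i : Fin n) {P : Set} → Dec P → Decidable (λ j → j ≡ i × P)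
at? i P? j = (j Fin.≟ i) ×-dec P?

module _ (π : Permutation′ n) where

  private
    p q : Fin n → Fin n
    p = π ⟨$⟩ʳ_
    q = π ⟨$⟩ˡ_

  above? : ∀ i → Decidable (λ j → j Fin.< q i × i Fin.< p j)
  above? i j = (j Fin.<? q i) ×-dec (i Fin.<? p j)

  below? : ∀ i → Decidable (λ j → q i Fin.< j × p j Fin.< i)
  below? i j = (q i Fin.<? j) ×-dec (p j Fin.<? i)

  above below : Fin n → ℕ
  above i = # (above? i)
  below i = # (below? i)

  -- Here `j < q i < i < p j` puts `j` in `Ep`, so the restriction to `Ep` in the side number is
  -- automatic. In `side-¬exc`, `p j < i ≤ q i < j` likewise excludes it.
  side-exc : ∀ {i} → exc π i → sideNumber π (q i) ≡ above i
  side-exc {i} e = trans (side-code π i e) (#-cong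
    (λ j → Ep? π j ×-dec above? i j) (above? i)
    (λ _ → proj₂)
    (λ j (j<q , i<p) → Fin.<-trans (Fin.<-trans j<q e) i<p , j<q , i<p))

  side-¬exc : ∀ {i} → ¬ exc π i → sideNumber π (q i) ≡ below i
  side-¬exc {i} ¬e = trans (side-¬Ep π (¬Ep-q π ¬e)) (#-cong
    (λ j → ¬? (Ep? π j) ×-dec (q i Fin.<? j) ×-dec (p j Fin.<? p (q i)))
    (below? i)
    (λ j (_ , q<j , p<p) → q<j , subst (p j Fin.<_) (Perm.inverseʳ π) p<p)
    (λ j (q<j , p<i) →
        (λ j<p → ℕ.<-asym j<p (Fin.<-trans p<i (ℕ.≤-<-trans (ℕ.≮⇒≥ ¬e) q<j)))
      , q<j , subst (p j Fin.<_) (sym (Perm.inverseʳ π)) p<i))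

  coarcs? : ∀ k → Decidable (λ j → k ℕ.≤ toℕ j × toℕ (p j) ℕ.< k)
  coarcs? k j = (k ℕ.≤? toℕ j) ×-dec (toℕ (p j) ℕ.<? k)

  -- As `p` is a bijection, `j < k` and `p j < k` hold equally often. Discarding the `j` that
  -- satisfy both leaves the arcs that pass level `k` upwards and downwards.
  arcs≡coarcs : ∀ k → arcs π k ≡ # (coarcs? k)
  arcs≡coarcs k = ℕ.+-cancelʳ-≡ (# both?) _ _ (begin
    arcs π k ℕ.+ # both?
      ≡⟨ #-split (λ j → toℕ j ℕ.<? k) (λ j → (toℕ j ℕ.<? k) ×-dec (k ℕ.≤? toℕ (p j))) both? split₁
           (λ j (a , b) → a , λ (_ , c) → ℕ.<⇒≱ c b) (λ _ → proj₁) ⟨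
    # (λ (j : Fin n) → toℕ j ℕ.<? k)
      ≡⟨ #-perm (λ (j : Fin n) → toℕ j ℕ.<? k) π ⟩
    # (λ j → toℕ (p j) ℕ.<? k)
      ≡⟨ #-split (λ j → toℕ (p j) ℕ.<? k) (coarcs? k) both? split₂
           (λ j (a , b) → b , λ (c , _) → ℕ.<⇒≱ c a) (λ _ → proj₂) ⟩
    # (coarcs? k) ℕ.+ # both? ∎)
    where
    open ≡-Reasoning
    both? : Decidable (λ j → toℕ j ℕ.< k × toℕ (p j) ℕ.< k)
    both? j = (toℕ j ℕ.<? k) ×-dec (toℕ (p j) ℕ.<? k)
    split₁ : ∀ j → toℕ j ℕ.< k → (toℕ j ℕ.< k × k ℕ.≤ toℕ (p j)) ⊎ (toℕ j ℕ.< k × toℕ (p j) ℕ.< k)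
    split₁ j j<k with toℕ (p j) ℕ.<? k
    ... | yes p<k = inj₂ (j<k , p<k)
    ... | no  p≮k = inj₁ (j<k , ℕ.≮⇒≥ p≮k)
    split₂ : ∀ j → toℕ (p j) ℕ.< k → (k ℕ.≤ toℕ j × toℕ (p j) ℕ.< k) ⊎ (toℕ j ℕ.< k × toℕ (p j) ℕ.< k)
    split₂ j p<k with toℕ j ℕ.<? k
    ... | yes j<k = inj₂ (j<k , p<k)
    ... | no  j≮k = inj₁ (ℕ.≮⇒≥ j≮k , p<k)

  crossing? : ∀ (i : Fin n) → Decidable (λ j → j Fin.< i × i Fin.< p j)
  crossing? i j = (j Fin.<? i) ×-dec (i Fin.<? p j)

  -- Making `i ≤ p j` strict loses only `j = q i`, which `arcs` counts exactly when `q i < i`.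
  arcs-crossing : ∀ (i : Fin n) → arcs π (toℕ i) ≡ # (crossing? i) ℕ.+ χ (exc? π i)
  arcs-crossing i = trans
    (#-split (λ j → (toℕ j ℕ.<? toℕ i) ×-dec (toℕ i ℕ.≤? toℕ (p j))) (crossing? i) (at? (q i) (exc? π i)) split
      (λ j (j<i , i<p) → (j<i , ℕ.<⇒≤ i<p)
        , λ (j≡q , _) → Fin.<⇒≢ i<p (sym (trans (cong p j≡q) (Perm.inverseʳ π))))
      (λ { j (refl , e) → e , ℕ.≤-reflexive (cong toℕ (sym (Perm.inverseʳ π))) }))
    (cong (# (crossing? i) ℕ.+_) (#-single (q i) {exc π i} (exc? π i)))
    where
    split : ∀ j → toℕ j ℕ.< toℕ i × toℕ i ℕ.≤ toℕ (p j) → (j Fin.< i × i Fin.< p j) ⊎ (j ≡ q i × exc π i)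
    split j (j<i , i≤p) with ℕ.m≤n⇒m<n∨m≡n i≤p
    ... | inj₁ i<p = inj₁ (j<i , i<p)
    ... | inj₂ i≡p = inj₂ (j≡q , subst (Fin._< i) j≡q j<i)
      where
      j≡q : j ≡ q i
      j≡q = trans (sym (Perm.inverseˡ π)) (cong q (sym (Fin.toℕ-injective i≡p)))

below-last : (π : Permutation′ (suc m)) → ∀ {i} → π ⟨$⟩ˡ i ≡ fromℕ m → below π i ≡ 0
below-last π {i} q≡ = #-none (below? π i) (λ j (lt , _) → ℕ.<⇒≱ (subst (Fin._< j) q≡ lt) (Fin.≤fromℕ j))

-- The cycle, and `θ` and `ϰ` as compositions with it.

insert-at : ∀ i j (π : Permutation′ n) → Perm.insert i j π ⟨$⟩ʳ i ≡ j
insert-at i j π with i Fin.≟ i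
... | yes _  = refl
... | no i≢i = contradiction refl i≢i

punchIn-fromℕ : (i : Fin m) → Fin.punchIn (fromℕ m) i ≡ inject₁ i
punchIn-fromℕ zero    = refl
punchIn-fromℕ (suc i) = cong suc (punchIn-fromℕ i)

cycle-fromℕ : cycle ⟨$⟩ʳ fromℕ m ≡ zero
cycle-fromℕ {m} = insert-at (fromℕ m) zero Perm.id

cycle-inject₁ : (i : Fin m) → cycle ⟨$⟩ʳ inject₁ i ≡ suc i
cycle-inject₁ {m} i = trans (cong (cycle ⟨$⟩ʳ_) (sym (punchIn-fromℕ i)))
  (Perm.insert-punchIn (fromℕ m) zero Perm.id i)

cycle⁻¹-zero : cycle ⟨$⟩ˡ zero ≡ fromℕ m
cycle⁻¹-zero = trans (cong (cycle ⟨$⟩ˡ_) (sym cycle-fromℕ)) (Perm.inverseˡ cycle)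

cycle⁻¹-suc : (i : Fin m) → cycle ⟨$⟩ˡ suc i ≡ inject₁ i
cycle⁻¹-suc i = trans (cong (cycle ⟨$⟩ˡ_) (sym (cycle-inject₁ i))) (Perm.inverseˡ cycle)

-- In one-based terms the right side sends `n` to 1 and then to `n`, and `i < n` to `i + 1` and then
-- to `n - i`.
reverseInit-cycle : (i : Fin (suc m)) → reverseInit ⟨$⟩ʳ i ≡ opposite (cycle ⟨$⟩ʳ i)
reverseInit-cycle i with view i
... | ‵fromℕ {m}  = trans (insert-at (fromℕ m) (fromℕ m) Perm.reverse) (cong opposite (sym cycle-fromℕ))
... | ‵inject₁ j = begin
  reverseInit ⟨$⟩ʳ inject₁ j                    ≡⟨ cong (reverseInit ⟨$⟩ʳ_) (punchIn-fromℕ j) ⟨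
  reverseInit ⟨$⟩ʳ Fin.punchIn (fromℕ _) j      ≡⟨ Perm.insert-punchIn (fromℕ _) (fromℕ _) Perm.reverse j ⟩
  Fin.punchIn (fromℕ _) (opposite j)            ≡⟨ punchIn-fromℕ (opposite j) ⟩
  opposite (suc j)                              ≡⟨ cong opposite (cycle-inject₁ j) ⟨
  opposite (cycle ⟨$⟩ʳ inject₁ j)               ∎
  where open ≡-Reasoning

θ≈cycle∘conj : (π : Permutation′ (suc m)) → θ π Perm.≈ cycle ∘ₚ conj π
θ≈cycle∘conj π i = cong (λ k → opposite (π ⟨$⟩ʳ k)) (reverseInit-cycle i)

-- `rci π` is the conjugate of the inverse of `π` by the reversal; the reversals in `θ` cancel these
-- two.
θ∘rci≈ϰ : (π : Permutation′ (suc m)) → θ (rci π) Perm.≈ ϰ π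
θ∘rci≈ϰ π i = trans (opp-opp _)
  (cong (π ⟨$⟩ˡ_) (trans (cong opposite (reverseInit-cycle i)) (opp-opp _)))

-- The inverse cycle lowers nonzero indices by one and turns the minimum 0 into the maximum. This
-- and the next three lemmas record the effect on strict inequalities.
cycle⁻¹-mono : {x y : Fin (suc m)} → x ≢ zero → x Fin.< y → cycle ⟨$⟩ˡ x Fin.< cycle ⟨$⟩ˡ y
cycle⁻¹-mono {x = zero}  x≢0 _ = contradiction refl x≢0
cycle⁻¹-mono {x = suc x} {suc y} _ lt = subst₂ Fin._<_ (sym (cycle⁻¹-suc x)) (sym (cycle⁻¹-suc y))
  (subst₂ ℕ._<_ (sym (Fin.toℕ-inject₁ x)) (sym (Fin.toℕ-inject₁ y)) (ℕ.s<s⁻¹ lt))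

cycle⁻¹-<-zero : {x : Fin (suc m)} → x ≢ zero → cycle ⟨$⟩ˡ x Fin.< cycle ⟨$⟩ˡ zero {m}
cycle⁻¹-<-zero {x = zero} x≢0 = contradiction refl x≢0
cycle⁻¹-<-zero {suc m} {suc x} _ = subst₂ Fin._<_ (sym (cycle⁻¹-suc x)) (sym (cycle⁻¹-zero {suc m}))
  (subst₂ ℕ._<_ (sym (Fin.toℕ-inject₁ x)) (sym (Fin.toℕ-fromℕ (suc m))) (Fin.toℕ<n x))

cycle⁻¹-≢zero : {x y : Fin (suc m)} → cycle ⟨$⟩ˡ x Fin.< cycle ⟨$⟩ˡ y → x ≢ zero
cycle⁻¹-≢zero {m} {y = y} lt refl =
  ℕ.<⇒≱ lt (subst (cycle ⟨$⟩ˡ y Fin.≤_) (sym (cycle⁻¹-zero {m})) (Fin.≤fromℕ (cycle ⟨$⟩ˡ y)))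

cycle⁻¹-cancel : {x y : Fin (suc m)} → y ≢ zero → cycle ⟨$⟩ˡ x Fin.< cycle ⟨$⟩ˡ y → x Fin.< y
cycle⁻¹-cancel {x = x} {y} y≢0 lt with Fin.<-cmp x y
... | tri< x<y _ _  = x<y
... | tri≈ _ refl _ = contradiction lt (ℕ.<-irrefl refl)
... | tri> _ _ y<x  = contradiction lt (ℕ.<-asym (cycle⁻¹-mono y≢0 y<x))

-- Turns strict comparisons into weak ones: `cycle ⟨$⟩ˡ x < y` unfolds to a bound on the successor,
-- hence to `x ≤ y`.
suc-cycle⁻¹ : {x : Fin (suc m)} → x ≢ zero → suc (toℕ (cycle ⟨$⟩ˡ x)) ≡ toℕ x
suc-cycle⁻¹ {x = zero}  x≢0 = contradiction refl x≢0
suc-cycle⁻¹ {x = suc x} _   = cong suc (trans (cong toℕ (cycle⁻¹-suc x)) (Fin.toℕ-inject₁ x))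

-- Effect of precomposition with the cycle on the counts.

module CycleThen (ρ : Permutation′ (suc m)) where

  κ : Permutation′ (suc m)
  κ = cycle ∘ₚ ρ

  private
    p q c⁻¹ : Fin (suc m) → Fin (suc m)
    p   = ρ ⟨$⟩ʳ_
    q   = ρ ⟨$⟩ˡ_
    c⁻¹ = cycle ⟨$⟩ˡ_

    κ-c⁻¹ : ∀ b → κ ⟨$⟩ʳ c⁻¹ b ≡ p b
    κ-c⁻¹ b = cong p (Perm.inverseʳ cycle)

    q≢0 : ∀ {i} → i ≢ p zero → q i ≢ zero
    q≢0 i≢ q≡0 = i≢ (trans (sym (Perm.inverseʳ ρ)) (cong p q≡0))

    κ⁻¹-p0 : ∀ {i} → i ≡ p zero → κ ⟨$⟩ˡ i ≡ fromℕ m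
    κ⁻¹-p0 refl = trans (cong c⁻¹ (Perm.inverseˡ ρ)) cycle⁻¹-zero

  exc⇒≢ : ∀ {i} → exc κ i → i ≢ p zero
  exc⇒≢ {i} e i≡ = ℕ.<⇒≱ (subst (Fin._< i) (κ⁻¹-p0 i≡) e) (Fin.≤fromℕ i)

  -- `κ` places `i` one position before `q i`, so the strict condition `exc` for `κ` is a weak one
  -- for `ρ`. The exception is `p zero`, which moves to the last position.
  exc⇒≤ : ∀ {i} → exc κ i → q i Fin.≤ i
  exc⇒≤ {i} e = subst (ℕ._≤ toℕ i) (suc-cycle⁻¹ (q≢0 (exc⇒≢ e))) e

  ≤⇒exc : ∀ {i} → i ≢ p zero → q i Fin.≤ i → exc κ i
  ≤⇒exc {i} i≢ le = subst (ℕ._≤ toℕ i) (sym (suc-cycle⁻¹ (q≢0 i≢))) le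

  below-p0 : ∀ {i} → i ≡ p zero → below κ i ≡ 0
  below-p0 i≡ = below-last κ (κ⁻¹-p0 i≡)

  -- Reindexing by `b`, where `κ` has the entry `p b` at `c⁻¹ b`, affects only `b = 0`: it precedes
  -- `q i` in `ρ` but comes last in `κ`, so only `ρ` can count it.
  above-cycle : ∀ {i} → i ≢ p zero → above ρ i ≡ above κ i ℕ.+ χ (i Fin.<? p zero)
  above-cycle {i} i≢ = begin
    above ρ i
      ≡⟨ #-split (above? ρ i) (λ b → above? κ i (c⁻¹ b)) (at? (zero {m}) (i Fin.<? p zero))
           split
           (λ b (lt , i<) → (cycle⁻¹-cancel {x = b} {q i} (q≢0 i≢) lt , subst (i Fin.<_) (κ-c⁻¹ b) i<)
             , λ (b≡0 , _) → cycle⁻¹-≢zero {x = b} {q i} lt b≡0)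
           (λ { b (refl , i<) → Fin.≤∧≢⇒< ℕ.z≤n (q≢0 i≢ ∘ sym) , i< }) ⟩
    # (λ b → above? κ i (c⁻¹ b)) ℕ.+ # (at? (zero {m}) (i Fin.<? p zero))
      ≡⟨ cong₂ ℕ._+_ (sym (#-perm (above? κ i) (Perm.flip cycle))) (#-single (zero {m}) {i Fin.< p zero} (i Fin.<? p zero)) ⟩
    above κ i ℕ.+ χ (i Fin.<? p zero) ∎
    where
    open ≡-Reasoning
    split : ∀ b → b Fin.< q i × i Fin.< p b →
            (c⁻¹ b Fin.< c⁻¹ (q i) × i Fin.< κ ⟨$⟩ʳ c⁻¹ b) ⊎ (b ≡ zero × i Fin.< p zero)
    split b (lt , i<) with b Fin.≟ zero
    ... | yes refl = inj₂ (refl , i<)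
    ... | no b≢0   = inj₁ (cycle⁻¹-mono b≢0 lt , subst (i Fin.<_) (sym (κ-c⁻¹ b)) i<)

  -- The moved entry now lies to the right of `i`, so `κ` gains it when `p zero < i`.
  below-cycle : ∀ {i} → i ≢ p zero → below κ i ≡ below ρ i ℕ.+ χ (p zero Fin.<? i)
  below-cycle {i} i≢ = begin
    below κ i
      ≡⟨ #-perm (below? κ i) (Perm.flip cycle) ⟩
    # (λ b → below? κ i (c⁻¹ b))
      ≡⟨ #-split (λ b → below? κ i (c⁻¹ b)) (below? ρ i) (at? (zero {m}) (p zero Fin.<? i))
           split
           (λ b (lt , <i) → (cycle⁻¹-mono {x = q i} {b} (q≢0 i≢) lt , subst (Fin._< i) (sym (κ-c⁻¹ b)) <i)
             , λ { (refl , _) → ℕ.n≮0 lt })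
           (λ { b (refl , <i) → cycle⁻¹-<-zero {x = q i} (q≢0 i≢) , subst (Fin._< i) (sym (κ-c⁻¹ b)) <i }) ⟩
    below ρ i ℕ.+ # (at? (zero {m}) (p zero Fin.<? i))
      ≡⟨ cong (below ρ i ℕ.+_) (#-single (zero {m}) {p zero Fin.< i} (p zero Fin.<? i)) ⟩
    below ρ i ℕ.+ χ (p zero Fin.<? i) ∎
    where
    open ≡-Reasoning
    split : ∀ b → c⁻¹ (q i) Fin.< c⁻¹ b × κ ⟨$⟩ʳ c⁻¹ b Fin.< i →
            (q i Fin.< b × p b Fin.< i) ⊎ (b ≡ zero × p zero Fin.< i)
    split b (lt , <i) with b Fin.≟ zero
    ... | yes refl = inj₂ (refl , subst (Fin._< i) (κ-c⁻¹ b) <i)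
    ... | no b≢0   = inj₁ (cycle⁻¹-cancel {x = q i} {b} b≢0 lt , subst (Fin._< i) (κ-c⁻¹ b) <i)

  cocrossing? : ∀ (i : Fin (suc m)) → Decidable (λ b → i Fin.< b × p b Fin.< i)
  cocrossing? i b = (i Fin.<? b) ×-dec (p b Fin.<? i)

  -- Downward arcs are used because for `b ≠ 0` the weak `i ≤ c⁻¹ b` becomes `i < b`, which makes
  -- both inequalities strict. For `b = 0` the position is last, and only `p zero < i` is left to
  -- test.
  arcs-cycle : ∀ (i : Fin (suc m)) → arcs κ (toℕ i) ≡ # (cocrossing? i) ℕ.+ χ (p zero Fin.<? i)
  arcs-cycle i = begin
    arcs κ (toℕ i)
      ≡⟨ arcs≡coarcs κ (toℕ i) ⟩
    # (coarcs? κ (toℕ i))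
      ≡⟨ #-perm (coarcs? κ (toℕ i)) (Perm.flip cycle) ⟩
    # (λ b → coarcs? κ (toℕ i) (c⁻¹ b))
      ≡⟨ #-split (λ b → coarcs? κ (toℕ i) (c⁻¹ b)) (cocrossing? i) (at? (zero {m}) (p zero Fin.<? i))
           split
           (λ b (i<b , <i) → (ℕ.s≤s⁻¹ (subst (toℕ i ℕ.<_) (sym (suc-cycle⁻¹ (nonzero i<b))) i<b)
                              , subst (Fin._< i) (sym (κ-c⁻¹ b)) <i)
             , λ (b≡0 , _) → nonzero i<b b≡0)
           (λ { b (refl , <i) → subst (i Fin.≤_) (sym cycle⁻¹-zero) (Fin.≤fromℕ i)
                              , subst (Fin._< i) (sym (κ-c⁻¹ b)) <i }) ⟩
    # (cocrossing? i) ℕ.+ # (at? (zero {m}) (p zero Fin.<? i))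
      ≡⟨ cong (# (cocrossing? i) ℕ.+_) (#-single (zero {m}) {p zero Fin.< i} (p zero Fin.<? i)) ⟩
    # (cocrossing? i) ℕ.+ χ (p zero Fin.<? i) ∎
    where
    open ≡-Reasoning
    nonzero : ∀ {b : Fin (suc m)} → i Fin.< b → b ≢ zero
    nonzero () refl
    split : ∀ b → i Fin.≤ c⁻¹ b × κ ⟨$⟩ʳ c⁻¹ b Fin.< i →
            (i Fin.< b × p b Fin.< i) ⊎ (b ≡ zero × p zero Fin.< i)
    split b (le , <i) with b Fin.≟ zero
    ... | yes refl = inj₂ (refl , subst (Fin._< i) (κ-c⁻¹ b) <i)
    ... | no b≢0   = inj₁ (subst (toℕ i ℕ.<_) (suc-cycle⁻¹ b≢0) (ℕ.s≤s le) , subst (Fin._< i) (κ-c⁻¹ b) <i)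

  ¬exc⇒< : ∀ {i} → i ≢ p zero → ¬ exc κ i → i Fin.< q i
  ¬exc⇒< i≢ ¬e = ℕ.≰⇒> (¬e ∘ ≤⇒exc i≢)

-- The last zero label of `Φ-FZ`.

χ-exc : (π : Permutation′ n) → ∀ i → χ (SdE? (wFZ π i)) ≡ χ (exc? π i)
χ-exc π i = χ-cong (SdE? (wFZ π i)) (exc? π i) (SdE⇒q< π) (exc⇒SdE π i)

module _ (π : Permutation′ (suc m)) where

  private
    p q : Fin (suc m) → Fin (suc m)
    p = π ⟨$⟩ʳ_
    q = π ⟨$⟩ˡ_
    l = fromℕ m

  ¬exc-last : ¬ exc π (p l)
  ¬exc-last e = ℕ.<⇒≱ (subst (Fin._< p l) (Perm.inverseˡ π) e) (Fin.≤fromℕ (p l))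

  -- No position follows the last one, so the label at `p l` is 0. A larger value `j` with label 0
  -- would have `below π j` equal to 0, yet the last position is counted there.
  cs-FZ : cs (Φ-FZ π) ≡ p l
  cs-FZ = cs-unique (Φ-FZ π) (p l)
    (cong +_ (cong₂ ℕ._+_
      (trans (side-¬exc π ¬exc-last) (below-last π (Perm.inverseˡ π)))
      (NE-χ (¬exc⇒NE π (p l) ¬exc-last))))
    max
    where
    max : ∀ j → 𝔏.c (Φ-FZ π) j ≡ 0ℤ → j Fin.≤ p l
    max j c≡0 = ℕ.≮⇒≥ λ pl<j →
      let q≢l = λ q≡l → Fin.<⇒≢ pl<j (trans (cong p (sym q≡l)) (Perm.inverseʳ π)) in
      ℕ.<⇒≢ (#-some (below? π j) l (Fin.≤∧≢⇒< (Fin.≤fromℕ (q j)) q≢l , pl<j)) (sym below≡0)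
      where
      ¬e : ¬ exc π j
      ¬e = NE⇒¬q< π (c≡0⇒NE (Φ-FZ π) {j} c≡0)
      below≡0 : below π j ≡ 0
      below≡0 = trans (sym (side-¬exc π ¬e)) (ℕ.m+n≡0⇒m≡0 _ (ℤ.+-injective c≡0))

-- Counts under conjugation by the reversal and under inversion.

module _ (π : Permutation′ n) where

  private
    p q : Fin n → Fin n
    p = π ⟨$⟩ʳ_
    q = π ⟨$⟩ˡ_

    conj-opp : ∀ i → conj π ⟨$⟩ʳ opposite i ≡ opposite (p i)
    conj-opp i = cong (opposite ∘ p) (opp-opp i)

  -- A half turn of the graph exchanges the upper left of a point with its lower right.
  above-conj : ∀ i → above (conj π) i ≡ below π (opposite i)
  above-conj i = trans (#-perm (above? (conj π) i) Perm.reverse)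
    (#-cong (λ j → above? (conj π) i (opposite j)) (below? π (opposite i))
      (λ j (lt , i<) → subst₂ Fin._<_ (opp-opp _) (opp-opp j) (opp-< lt)
                     , opp-<ʳ (subst (i Fin.<_) (conj-opp j) i<))
      (λ j (lt , <i) → opp-< lt , subst (i Fin.<_) (sym (conj-opp j)) (opp-<ʳ <i)))

  below-conj : ∀ i → below (conj π) i ≡ above π (opposite i)
  below-conj i = trans (#-perm (below? (conj π) i) Perm.reverse)
    (#-cong (λ j → below? (conj π) i (opposite j)) (above? π (opposite i))
      (λ j (lt , <i) → subst₂ Fin._<_ (opp-opp j) (opp-opp _) (opp-< lt)
                     , opp-<ˡ (subst (Fin._< i) (conj-opp j) <i))
      (λ j (lt , i<) → opp-< lt , subst (Fin._< i) (sym (conj-opp j)) (opp-<ˡ i<)))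

  -- Counting by `p j` gives the form of the second clause of `nest`; `below-flip` gives the first.
  above-flip : ∀ i → above (Perm.flip π) i ≡ # (λ j → (i Fin.<? j) ×-dec (p j Fin.<? p i))
  above-flip i = trans (#-perm (above? (Perm.flip π) i) π)
    (#-cong (λ j → above? (Perm.flip π) i (p j)) (λ j → (i Fin.<? j) ×-dec (p j Fin.<? p i))
      (λ j (lt , i<) → subst (i Fin.<_) (Perm.inverseˡ π) i< , lt)
      (λ j (i< , lt) → lt , subst (i Fin.<_) (sym (Perm.inverseˡ π)) i<))

  below-flip : ∀ i → below (Perm.flip π) i ≡ # (λ j → (j Fin.<? i) ×-dec (p i Fin.<? p j))
  below-flip i = trans (#-perm (below? (Perm.flip π) i) π)
    (#-cong (λ j → below? (Perm.flip π) i (p j)) (λ j → (j Fin.<? i) ×-dec (p i Fin.<? p j))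
      (λ j (lt , <i) → subst (Fin._< i) (Perm.inverseˡ π) <i , lt)
      (λ j (<i , lt) → lt , subst (Fin._< i) (sym (Perm.inverseˡ π)) <i))

χ-<+χ-> : {i j : Fin n} → i ≢ j → χ (i Fin.<? j) ℕ.+ χ (j Fin.<? i) ≡ 1
χ-<+χ-> {i = i} {j} i≢j with Fin.<-cmp i j
... | tri< a _ ¬c  = cong₂ ℕ._+_ (χ-yes (i Fin.<? j) a) (χ-no (j Fin.<? i) ¬c)
... | tri≈ _ i≡j _ = contradiction i≡j i≢j
... | tri> ¬a _ c  = cong₂ ℕ._+_ (χ-no (i Fin.<? j) ¬a) (χ-yes (j Fin.<? i) c)

-- The defining conditions of `ξ`, checked on the history of `θ`.

module ξ-FZ (π : Permutation′ (suc m)) where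

  open CycleThen (conj π)

  private
    p q : Fin (suc m) → Fin (suc m)
    p = π ⟨$⟩ʳ_
    q = π ⟨$⟩ˡ_
    l = fromℕ m
    M = opposite (p l)
    W = Φ-FZ π
    V = Φ-FZ κ

    -- The weak inequality of `exc⇒≤` is what reversal turns into a non-excedance of `π`; `¬exc⇒exc`
    -- is the converse away from `M`.
    exc⇒¬exc : ∀ {j} → exc κ j → ¬ exc π (opposite j)
    exc⇒¬exc {j} e = ℕ.≤⇒≯ (subst (opposite j Fin.≤_) (opp-opp _) (opp-≤ (exc⇒≤ e)))

    ¬exc⇒exc : ∀ {j} → j ≢ M → ¬ exc κ j → exc π (opposite j)
    ¬exc⇒exc {j} j≢M ¬e = opp-<ʳ (¬exc⇒< j≢M ¬e)

    crossing-conj : ∀ j → # (cocrossing? j) ≡ # (crossing? π (opposite j))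
    crossing-conj j = trans (#-perm (cocrossing? j) Perm.reverse)
      (#-cong (λ b → cocrossing? j (opposite b)) (crossing? π (opposite j))
        (λ b (j< , <j) → opp-<ʳ j< , opp-<ˡ (subst (Fin._< j) (cong (opposite ∘ p) (opp-opp b)) <j))
        (λ b (b< , <p) → opp-<ʳ b< , subst (Fin._< j) (sym (cong (opposite ∘ p) (opp-opp b))) (opp-<ˡ <p)))

    -- Both heights equal one number of crossings plus an indicator; adding the opposite indicator
    -- to each avoids subtraction in `ℕ`.
    arcs-κ : ∀ j → arcs κ (toℕ j) ℕ.+ χ (exc? π (opposite j))
                   ≡ arcs π (toℕ (opposite j)) ℕ.+ χ (M Fin.<? j)
    arcs-κ j = begin
      arcs κ (toℕ j) ℕ.+ e           ≡⟨ cong (ℕ._+ e) (arcs-cycle j) ⟩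
      # (cocrossing? j) ℕ.+ g ℕ.+ e  ≡⟨ cong (λ x → x ℕ.+ g ℕ.+ e) (crossing-conj j) ⟩
      x ℕ.+ g ℕ.+ e                  ≡⟨ lemma x g e ⟩
      x ℕ.+ e ℕ.+ g                  ≡⟨ cong (ℕ._+ g) (arcs-crossing π (opposite j)) ⟨
      arcs π (toℕ (opposite j)) ℕ.+ g ∎
      where
      open ≡-Reasoning
      e = χ (exc? π (opposite j))
      g = χ (M Fin.<? j)
      x = # (crossing? π (opposite j))
      lemma : ∀ x g e → x ℕ.+ g ℕ.+ e ≡ x ℕ.+ e ℕ.+ g
      lemma = ℕ-Solver.solve-∀

    h-κ : ∀ j → 𝔏.h V j ≡ 𝔏.h W (opposite j) ℤ.+ (+ χ (M Fin.<? j) ℤ.- + χ (exc? π (opposite j)))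
    h-κ j = begin
      𝔏.h V j                  ≡⟨ height-FZ κ (toℕ j) ⟩
      + A                      ≡⟨ lemma₁ (+ A) (+ e) ⟩
      + (A ℕ.+ e) ℤ.- + e      ≡⟨ cong (λ x → + x ℤ.- + e) (arcs-κ j) ⟩
      + (B ℕ.+ g) ℤ.- + e      ≡⟨ ℤ.+-assoc (+ B) (+ g) (ℤ.- + e) ⟩
      + B ℤ.+ (+ g ℤ.- + e)    ≡⟨ cong (ℤ._+ (+ g ℤ.- + e)) (height-FZ π (toℕ (opposite j))) ⟨
      𝔏.h W (opposite j) ℤ.+ (+ g ℤ.- + e) ∎
      where
      open ≡-Reasoning
      A = arcs κ (toℕ j)
      B = arcs π (toℕ (opposite j))
      e = χ (exc? π (opposite j))
      g = χ (M Fin.<? j)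
      lemma₁ : ∀ a e → a ≡ a ℤ.+ e ℤ.- e
      lemma₁ = ℤ-Solver.solve-∀

    -- With numerals for the indicators, the difference computes to the shift 1, -1 or 0 required by
    -- `ξSpec`.
    h-diff : ∀ j {a b} → χ (M Fin.<? j) ≡ a → χ (exc? π (opposite j)) ≡ b →
             𝔏.h V j ≡ 𝔏.h W (opposite j) ℤ.+ (+ a ℤ.- + b)
    h-diff j refl refl = h-κ j

    -- The left side is the label of `κ`. For an excedance value its indicator 1 splits over `j < M`
    -- and `M < j`, and the first part is the loss in `above-cycle`; otherwise the gain in
    -- `below-cycle` is the term on the right. At `M` everything vanishes.
    side-κ : ∀ j → sideNumber κ (κ ⟨$⟩ˡ j) ℕ.+ χ (exc? κ j)
                   ≡ sideNumber π (q (opposite j)) ℕ.+ χ (M Fin.<? j)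
    side-κ j with j Fin.≟ M | exc? κ j
    ... | yes j≡M | yes e = contradiction j≡M (exc⇒≢ e)
    ... | yes j≡M | no ¬e = cong₂ ℕ._+_
      (trans (trans (side-¬exc κ ¬e) (below-p0 j≡M)) (sym (trans (side-¬exc π ¬e′) (below-last π q≡l))))
      (trans (χ-no (exc? κ j) ¬e) (sym (χ-no (M Fin.<? j) (λ lt → Fin.<⇒≢ lt (sym j≡M)))))
      where
      ¬e′ : ¬ exc π (opposite j)
      ¬e′ = subst (¬_ ∘ exc π) (sym (opp-≡ j≡M)) (¬exc-last π)
      q≡l : q (opposite j) ≡ l
      q≡l = trans (cong q (opp-≡ j≡M)) (Perm.inverseˡ π)
    ... | no j≢M | yes e = begin
      sideNumber κ (κ ⟨$⟩ˡ j) ℕ.+ χ (exc? κ j)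
        ≡⟨ cong₂ ℕ._+_ (side-exc κ e) (trans (χ-yes (exc? κ j) e) (sym (χ-<+χ-> j≢M))) ⟩
      above κ j ℕ.+ (χ (j Fin.<? M) ℕ.+ χ (M Fin.<? j))
        ≡⟨ ℕ.+-assoc (above κ j) _ _ ⟨
      above κ j ℕ.+ χ (j Fin.<? M) ℕ.+ χ (M Fin.<? j)
        ≡⟨ cong (ℕ._+ χ (M Fin.<? j)) (above-cycle j≢M) ⟨
      above (conj π) j ℕ.+ χ (M Fin.<? j)
        ≡⟨ cong (ℕ._+ χ (M Fin.<? j)) (trans (above-conj π j) (sym (side-¬exc π (exc⇒¬exc e)))) ⟩
      sideNumber π (q (opposite j)) ℕ.+ χ (M Fin.<? j) ∎
      where open ≡-Reasoning
    ... | no j≢M | no ¬e = begin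
      sideNumber κ (κ ⟨$⟩ˡ j) ℕ.+ χ (exc? κ j)
        ≡⟨ trans (cong (sideNumber κ (κ ⟨$⟩ˡ j) ℕ.+_) (χ-no (exc? κ j) ¬e)) (ℕ.+-identityʳ _) ⟩
      sideNumber κ (κ ⟨$⟩ˡ j)
        ≡⟨ trans (side-¬exc κ ¬e) (below-cycle j≢M) ⟩
      below (conj π) j ℕ.+ χ (M Fin.<? j)
        ≡⟨ cong (ℕ._+ χ (M Fin.<? j)) (trans (below-conj π j) (sym (side-exc π (¬exc⇒exc j≢M ¬e)))) ⟩
      sideNumber π (q (opposite j)) ℕ.+ χ (M Fin.<? j) ∎
      where open ≡-Reasoning

    M≡ : opposite (cs W) ≡ M
    M≡ = cong opposite (cs-FZ π)

    -- By `side-κ` the labels differ by the same two indicators as the heights in `h-κ`.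
    c-κ : ∀ j → 𝔏.c V j ≡ 𝔏.h V j ℤ.- 𝔏.h W (opposite j) ℤ.+ 𝔏.c W (opposite j)
    c-κ j = begin
      + (sideNumber κ (κ ⟨$⟩ˡ j) ℕ.+ χ (SdE? (wFZ κ j)))
        ≡⟨ cong +_ (trans (cong (sideNumber κ (κ ⟨$⟩ˡ j) ℕ.+_) (χ-exc κ j)) (side-κ j)) ⟩
      + s ℤ.+ + g
        ≡⟨ lemma H (+ g) (+ e) (+ s) ⟩
      H ℤ.+ (+ g ℤ.- + e) ℤ.- H ℤ.+ (+ s ℤ.+ + e)
        ≡⟨ cong₂ (λ x y → x ℤ.- H ℤ.+ + (s ℕ.+ y)) (sym (h-κ j)) (sym (χ-exc π (opposite j))) ⟩
      𝔏.h V j ℤ.- H ℤ.+ 𝔏.c W (opposite j) ∎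
      where
      open ≡-Reasoning
      H = 𝔏.h W (opposite j)
      e = χ (exc? π (opposite j))
      g = χ (M Fin.<? j)
      s = sideNumber π (q (opposite j))
      lemma : ∀ h g e s → s ℤ.+ g ≡ h ℤ.+ (g ℤ.- e) ℤ.- h ℤ.+ (s ℤ.+ e)
      lemma = ℤ-Solver.solve-∀

    h-other : ∀ j → ¬ (M Fin.< j × SdE (wFZ κ j)) → ¬ (j Fin.< M × NE (wFZ κ j)) →
              𝔏.h V j ≡ 𝔏.h W (opposite j)
    h-other j ¬a ¬b = trans (go (exc? κ j) (Fin.<-cmp j M)) (ℤ.+-identityʳ _)
      where
      go : Dec (exc κ j) → _ → 𝔏.h V j ≡ 𝔏.h W (opposite j) ℤ.+ 0ℤ
      go (yes e) (tri< _ _ ¬gt) = h-diff j (χ-no (M Fin.<? j) ¬gt) (χ-no (exc? π (opposite j)) (exc⇒¬exc e))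
      go (yes e) (tri≈ _ eq _)  = contradiction eq (exc⇒≢ e)
      go (yes e) (tri> _ _ gt)  = contradiction (gt , exc⇒SdE κ j e) ¬a
      go (no ¬e) (tri< lt _ _)  = contradiction (lt , ¬exc⇒NE κ j ¬e) ¬b
      go (no ¬e) (tri≈ _ eq ¬gt) = h-diff j (χ-no (M Fin.<? j) ¬gt)
        (χ-no (exc? π (opposite j)) (subst (¬_ ∘ exc π) (sym (opp-≡ eq)) (¬exc-last π)))
      -- Beyond `M`, a non-excedance of `κ` has both indicators equal to 1, and they cancel.
      go (no ¬e) (tri> _ ne gt) = h-diff j (χ-yes (M Fin.<? j) gt)
        (χ-yes (exc? π (opposite j)) (¬exc⇒exc ne ¬e))

  ξSpec-FZ : ξSpec (Φ-FZ π) (Φ-FZ κ)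
  ξSpec-FZ = record
    -- The last entry of `κ` is the first of `conj π`, the opposite of the last entry of `π`.
    { cs-eq   = trans (cs-FZ κ) (trans (cong (λ k → opposite (p (opposite k))) cycle-fromℕ) (sym M≡))
    ; NE⇔SdE  = λ j j≢ → let j≢M = λ j≡M → j≢ (trans j≡M (sym M≡)) in mk⇔
        (λ ne → exc⇒SdE π (opposite j) (¬exc⇒exc j≢M (NE⇒¬q< κ ne)))
        (λ sd → ¬exc⇒NE κ j (λ e → exc⇒¬exc e (SdE⇒q< π sd)))
    ; h-above = λ j lt sd → h-diff j
        (χ-yes (M Fin.<? j) (subst (Fin._< j) M≡ lt))
        (χ-no (exc? π (opposite j)) (exc⇒¬exc (SdE⇒q< κ sd)))
    ; h-below = λ j lt ne → let j<M = subst (j Fin.<_) M≡ lt in h-diff j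
        (χ-no (M Fin.<? j) (ℕ.<-asym j<M))
        (χ-yes (exc? π (opposite j)) (¬exc⇒exc (Fin.<⇒≢ j<M) (NE⇒¬q< κ ne)))
    ; h-other = λ j ¬a ¬b → h-other j
        (λ (lt , sd) → ¬a (subst (Fin._< j) (sym M≡) lt , sd))
        (λ (lt , ne) → ¬b (subst (j Fin.<_) (sym M≡) lt , ne))
    ; c-eq    = c-κ
    }

Φ-FZ⁻¹∘ξ∘Φ-FZ≈θ : (π : Permutation′ (suc m)) → Φ-FZ⁻¹ (ξ (Φ-FZ π)) Perm.≈ θ π
Φ-FZ⁻¹∘ξ∘Φ-FZ≈θ π i = trans
  (Φ-FZ-injective {π = Φ-FZ⁻¹ W} {κ}
    (≈-trans {U = Φ-FZ (Φ-FZ⁻¹ W)} {W} {Φ-FZ κ}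
      (FZ-Preimage.Φ-FZ-preimage W)
      (ξSpec-unique (ξConstruction.image-spec (Φ-FZ π)) (ξ-FZ.ξSpec-FZ π)))
    i)
  (sym (θ≈cycle∘conj π i))
  where
  W = ξ (Φ-FZ π)
  κ = cycle ∘ₚ conj π

-- `Φ-YZL` as `Φ-FZ` after the Kreweras complement.

module YZL (π : Permutation′ (suc m)) where

  open CycleThen (Perm.flip π)

  private
    p q : Fin (suc m) → Fin (suc m)
    p = π ⟨$⟩ʳ_
    q = π ⟨$⟩ˡ_

    κ-inject₁ : ∀ j → κ ⟨$⟩ʳ inject₁ j ≡ q (suc j)
    κ-inject₁ j = cong q (cycle-inject₁ j)

    -- For `i = inject₁ j`, strictness in `i < κ i` absorbs one unit and yields the test
    -- `i + 1 ≤ π⁻¹(i + 1)` of `wYZL`.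
    Ep⇒ : ∀ j → Ep κ (inject₁ j) → suc j Fin.≤ q (suc j)
    Ep⇒ j = subst₂ ℕ._<_ (Fin.toℕ-inject₁ j) (cong toℕ (κ-inject₁ j))

    ⇒Ep : ∀ j → suc j Fin.≤ q (suc j) → Ep κ (inject₁ j)
    ⇒Ep j = subst₂ ℕ._<_ (sym (Fin.toℕ-inject₁ j)) (sym (cong toℕ (κ-inject₁ j)))

    ¬Ep-last : ¬ Ep κ (fromℕ m)
    ¬Ep-last lt = ℕ.<⇒≱ lt (Fin.≤fromℕ (κ ⟨$⟩ʳ fromℕ m))

    exc-≡ : ∀ {i} → i ≡ pone π → ¬ exc κ i
    exc-≡ i≡ e = exc⇒≢ e i≡

    <⇒¬exc : ∀ {i} → i Fin.< p i → ¬ exc κ i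
    <⇒¬exc i<p e = ℕ.<⇒≱ i<p (exc⇒≤ e)

    ≮⇒exc : ∀ {i} → i ≢ pone π → ¬ i Fin.< p i → exc κ i
    ≮⇒exc i≢ i≮p = ≤⇒exc i≢ (ℕ.≮⇒≥ i≮p)

  -- The tests in `wYZL` decide `exc κ` and `Ep κ`. At `pone π` the condition `exc κ` fails although
  -- `p i ≤ i`, hence the separate clause; at the last index `Ep κ` always fails.
  stepYZL : ∀ i → StepFZ κ i (wYZL π i)
  stepYZL i with view i
  ... | ‵fromℕ = if-elim (StepFZ κ (fromℕ m)) (pone π Fin.≟ fromℕ m)
    (λ eq → isE ¬Ep-last (exc-≡ (sym eq)))
    (λ ne → isS ¬Ep-last (≤⇒exc (ne ∘ sym) (Fin.≤fromℕ (p (fromℕ m)))))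
  ... | ‵inject₁ j with i Fin.≟ pone π | i Fin.<? p i | suc j Fin.≤? q (suc j)
  ...   | yes eq | _     | yes a = isN (⇒Ep j a) (exc-≡ eq)
  ...   | yes eq | _     | no ¬a = isE (¬a ∘ Ep⇒ j) (exc-≡ eq)
  ...   | no _   | yes b | yes a = isN (⇒Ep j a) (<⇒¬exc b)
  ...   | no ne  | no ¬b | no ¬a = isS (¬a ∘ Ep⇒ j) (≮⇒exc ne ¬b)
  ...   | no _   | yes b | no ¬a = isE (¬a ∘ Ep⇒ j) (<⇒¬exc b)
  ...   | no ne  | no ¬b | yes a = isdE (⇒Ep j a) (≮⇒exc ne ¬b)

  private
    -- Repeats the predicate in `nest`, so that `nest π i` is its count by computation.
    nest? : ∀ i → Decidable (λ j → (j Fin.< i × i Fin.< p i × p i Fin.< p j) ⊎ (p j Fin.< p i × p i Fin.≤ i × i Fin.< j))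
    nest? i j = ((j Fin.<? i) ×-dec (i Fin.<? p i) ×-dec (p i Fin.<? p j))
                ⊎-dec ((p j Fin.<? p i) ×-dec (p i Fin.≤? i) ×-dec (i Fin.<? j))

    nest-≥ : ∀ {i} → p i Fin.≤ i → nest π i ≡ above (Perm.flip π) i
    nest-≥ {i} p≤i = trans
      (#-cong (nest? i) (λ j → (i Fin.<? j) ×-dec (p j Fin.<? p i))
        (λ { j (inj₁ (_ , i<p , _)) → contradiction p≤i (ℕ.<⇒≱ i<p)
           ; j (inj₂ (lt , _ , i<j)) → i<j , lt })
        (λ j (i<j , lt) → inj₂ (lt , p≤i , i<j)))
      (sym (above-flip π i))

    nest-< : ∀ {i} → i Fin.< p i → nest π i ≡ below (Perm.flip π) i
    nest-< {i} i<p = trans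
      (#-cong (nest? i) (λ j → (j Fin.<? i) ×-dec (p i Fin.<? p j))
        (λ { j (inj₁ (j<i , _ , lt)) → j<i , lt
           ; j (inj₂ (_ , p≤i , _)) → contradiction p≤i (ℕ.<⇒≱ i<p) })
        (λ j (j<i , lt) → inj₁ (j<i , i<p , lt)))
      (sym (below-flip π i))

    vnest-elim : ∀ i (R : ℤ → Set) →
      (p i Fin.≤ i → i Fin.< pone π → R (+ nest π i ℤ.- 1ℤ)) →
      (i Fin.< p i → pone π Fin.< i → R (+ nest π i ℤ.+ 1ℤ)) →
      (¬ (p i Fin.≤ i × i Fin.< pone π) → ¬ (i Fin.< p i × pone π Fin.< i) → R (+ nest π i)) →
      R (vnest π i)
    vnest-elim i R f g h =
      if-elim R ((p i Fin.≤? i) ×-dec (i Fin.<? pone π)) (λ (a , b) → f a b) λ ¬a →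
      if-elim R ((i Fin.<? p i) ×-dec (pone π Fin.<? i)) (λ (a , b) → g a b) λ ¬b → h ¬a ¬b

    p-pone : ∀ {i} → i ≡ pone π → p i ≡ zero
    p-pone refl = Perm.inverseʳ π

    nest-pone : ∀ {i} → i ≡ pone π → nest π i ≡ 0
    nest-pone {i} i≡ = trans (nest-≥ (subst (Fin._≤ i) (sym (p-pone i≡)) ℕ.z≤n))
      (#-none (above? (Perm.flip π) i) (λ j (lt , _) → ℕ.n≮0 (subst (j Fin.<_) (p-pone i≡) lt)))

  -- For `p i ≤ i` the count drops by 1 when `i < pone π`, by `above-cycle`; for `i < p i` it grows
  -- by 1 when `pone π < i`, by `below-cycle`. At `pone π` both sides are 0, since `p i` is the
  -- least value and `κ` puts `i` last.
  vnest-side : ∀ i → vnest π i ≡ + sideNumber κ (κ ⟨$⟩ˡ i)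
  vnest-side i with i Fin.≟ pone π | i Fin.<? p i
  ... | yes i≡ | _ = vnest-elim i (_≡ + sideNumber κ (κ ⟨$⟩ˡ i))
    (λ _ lt → contradiction i≡ (Fin.<⇒≢ lt))
    (λ _ lt → contradiction (sym i≡) (Fin.<⇒≢ lt))
    (λ _ _ → cong +_ (trans (nest-pone i≡) (sym (trans (side-¬exc κ (exc-≡ i≡)) (below-p0 i≡)))))
  ... | no i≢ | yes i<p = vnest-elim i (_≡ + sideNumber κ (κ ⟨$⟩ˡ i))
    (λ p≤i _ → contradiction p≤i (ℕ.<⇒≱ i<p))
    (λ _ lt → cong +_ (trans (cong (nest π i ℕ.+_) (sym (χ-yes (pone π Fin.<? i) lt))) (sym side≡)))
    (λ _ ¬lt → cong +_ (trans (sym (trans (cong (nest π i ℕ.+_) (χ-no (pone π Fin.<? i) (λ lt → ¬lt (i<p , lt))))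
      (ℕ.+-identityʳ _))) (sym side≡)))
    where
    side≡ : sideNumber κ (κ ⟨$⟩ˡ i) ≡ nest π i ℕ.+ χ (pone π Fin.<? i)
    side≡ = trans (side-¬exc κ (<⇒¬exc i<p)) (trans (below-cycle i≢)
      (cong (ℕ._+ χ (pone π Fin.<? i)) (sym (nest-< i<p))))
  ... | no i≢ | no i≮p = vnest-elim i (_≡ + sideNumber κ (κ ⟨$⟩ˡ i))
    (λ _ lt → trans (cong (λ x → + x ℤ.- 1ℤ) (trans nest≡ (cong (side ℕ.+_) (χ-yes (i Fin.<? pone π) lt)))) (lemma (+ side)))
    (λ i<p _ → contradiction i<p i≮p)
    (λ ¬lt _ → cong +_ (trans nest≡ (trans
      (cong (side ℕ.+_) (χ-no (i Fin.<? pone π) (λ lt → ¬lt (ℕ.≮⇒≥ i≮p , lt)))) (ℕ.+-identityʳ _))))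
    where
    side = sideNumber κ (κ ⟨$⟩ˡ i)
    nest≡ : nest π i ≡ side ℕ.+ χ (i Fin.<? pone π)
    nest≡ = trans (nest-≥ (ℕ.≮⇒≥ i≮p)) (trans (above-cycle i≢)
      (cong (ℕ._+ χ (i Fin.<? pone π)) (sym (side-exc κ (≮⇒exc i≢ i≮p)))))
    lemma : ∀ s → s ℤ.+ 1ℤ ℤ.- 1ℤ ≡ s
    lemma = ℤ-Solver.solve-∀

  wYZL≡wFZ : ∀ i → wYZL π i ≡ wFZ κ i
  wYZL≡wFZ i = stepFZ-unique κ (stepYZL i) (stepFZ κ i)

  Φ-YZL≋Φ-FZ∘ϰ : Φ-YZL π ≋ tripleFZ (ϰ π)
  Φ-YZL≋Φ-FZ∘ϰ = record
    { w≗ = wYZL≡wFZ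
    ; h≗ = λ i → height-cong wYZL≡wFZ (toℕ i)
    ; c≗ = λ i → cong₂ (λ x a → x ℤ.+ + χ (SdE? a)) (vnest-side i) (wYZL≡wFZ i)
    }

≋-trans : {U V W : Triple n} → U ≋ V → V ≋ W → U ≋ W
≋-trans a b = record
  { w≗ = λ i → trans (_≋_.w≗ a i) (_≋_.w≗ b i)
  ; h≗ = λ i → trans (_≋_.h≗ a i) (_≋_.h≗ b i)
  ; c≗ = λ i → trans (_≋_.c≗ a i) (_≋_.c≗ b i)
  }

theorem4p24 : (m : ℕ) (π : Permutation′ (suc m)) →
    (Φ-FZ⁻¹ (ξ (Φ-FZ π)) Perm.≈ θ π)
    × (Φ-YZL π ≋ 𝔏.triple (Φ-FZ (θ (rci π))))
    × (Φ-FZ (θ (rci π)) ≈ Φ-FZ (ϰ π))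
theorem4p24 m π =
    Φ-FZ⁻¹∘ξ∘Φ-FZ≈θ π
  -- The equality is known for `ϰ π` and is carried back along `θ∘rci`.
  , ≋-trans (YZL.Φ-YZL≋Φ-FZ∘ϰ π) (≈-sym {W = Φ-FZ (θ (rci π))} {Φ-FZ (ϰ π)} θ∘rci)
  , θ∘rci
  where
  θ∘rci : Φ-FZ (θ (rci π)) ≈ Φ-FZ (ϰ π)
  θ∘rci = Φ-FZ-cong {π = θ (rci π)} {ϰ π} (θ∘rci≈ϰ π)
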